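{- (i) Any CONGEST algorithm (possibly randomized, succeeding with probability at least $2/3$) that solves Replacement Paths or Second Simple Shortest Path in undirected weighted $n$-vertex graphs of diameter $D$ requires $\Omega\!\left(\frac{\sqrt{n}}{\log n}+D\right)$ rounds in the worst case, even when the given shortest path $P_{st}$ has a constant number of edges; the same lower bound holds for $\alpha$-approximation of RPaths or 2-SiSP for any $\alpha>1$. (ii) For undirected unweighted graphs of diameter $D$, any such algorithm requires $\Omega(D)$ rounds.
   Context: CONGEST model: the communication network is the undirected graph $G=(V,E)$, $n=|V|$; each node has a unique identifier in $\{0,\dots,n-1\}$, knows its own and its neighbours' identifiers and the weights of its incident edges (integers in $\{0,\dots,W\}$, $W=\mathrm{poly}(n)$); computation proceeds in synchronous rounds in which each node may send a message of $O(\log n)$ bits to each neighbour; local computation is free. $D$ is the (unweighted hop) diameter of $G$. Replacement Paths (RPaths): given $s,t$ and a shortest $s$-$t$ path $P_{st}$, for each edge $e\in P_{st}$ some vertex must compute the weight of a shortest simple $s$-$t$ path $P_e$ avoiding $e$, and every vertex on $P_e$ must know its successor on $P_e$. Second Simple Shortest Path (2-SiSP): some vertex must compute the weight of a minimum-weight simple $s$-$t$ path not containing at least one edge of $P_{st}$, and each vertex on it must know its successor. An $\alpha$-approximation outputs a weight between the optimum and $\alpha$ times the optimum.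
   Formalization: The diameter D is restricted to a·log n ≤ D ≤ n/b in (i) and D₀ ≤ D ≤ n/b in (ii), for some constants a, b, D₀; without this the claim fails, e.g. for D = n−1, where the graph is a path and no communication is needed, or in (i) for D = 1 (complete graphs). -}

module Defs where

open import Data.Bool.Base using (Bool)
open import Data.Empty using (⊥)
open import Data.Fin.Base using (Fin; finToFun)
open import Data.Fin.Subset using (Subset; _∈_; ∣_∣)
open import Data.Integer.Base using (+_)
open import Data.List.Base using (List; []; _∷_; _∷ʳ_; map; length)
import Data.List.Membership.Propositional as List
open import Data.List.Relation.Unary.Unique.Propositional using (Unique)
open import Data.Maybe.Base as Maybe using (Maybe; just; nothing)
open import Data.Nat.Base using (ℕ; zero; suc; _+_; _*_; _∸_; _^_; _≤_; NonZero)
open import Data.Nat.Logarithm using (⌈log₂_⌉)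
open import Data.Product.Base using (Σ; ∃; _×_; _,_; proj₁)
open import Data.Rational.Base as ℚ using (ℚ; 1ℚ)
open import Data.Unit.Base using (⊤)
open import Data.Vec.Base using (Vec; tabulate)
open import Data.Vec.Bounded.Base using (Vec≤)
open import Relation.Binary.Construct.Closure.ReflexiveTransitive using (Star; ε; _◅_)
open import Relation.Binary.PropositionalEquality.Core using (_≡_; _≢_)
open import Relation.Nullary.Negation.Core using (¬_)

-- Finite simple undirected graphs with weights in ℕ; `nothing` means "no edge",
-- so that an edge of weight 0 is still an edge.
record Graph (n : ℕ) : Set where
  field
    edge   : Fin n → Fin n → Maybe ℕ
    sym    : ∀ u v → edge u v ≡ edge v u
    irrefl : ∀ v → edge v v ≡ nothing

open Graph public using (edge)

module Paths {n : ℕ} (G : Graph n) where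

  Adjacent : Fin n → Fin n → Set
  Adjacent u v = ∃ λ w → edge G u v ≡ just w

  Walk : Fin n → Fin n → Set
  Walk = Star Adjacent

  -- Each edge is listed in its direction of traversal.
  edges : ∀ {u v} → Walk u v → List (Fin n × Fin n)
  edges ε                 = []
  edges (_◅_ {i} {j} _ p) = (i , j) ∷ edges p

  hops : ∀ {u v} → Walk u v → ℕ
  hops p = length (edges p)

  weight : ∀ {u v} → Walk u v → ℕ
  weight ε             = 0
  weight ((w , _) ◅ p) = w + weight p

  vertices : ∀ {u v} → Walk u v → List (Fin n)
  vertices {v = v} p = map proj₁ (edges p) ∷ʳ v

  Simple : ∀ {u v} → Walk u v → Set
  Simple p = Unique (vertices p)

  Avoids : ∀ {u v} → Walk u v → Fin n × Fin n → Set
  Avoids p (x , y) = ¬ ((x , y) List.∈ edges p) × ¬ ((y , x) List.∈ edges p)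

  -- In particular, G is connected and nonempty.
  HasDiameter : ℕ → Set
  HasDiameter D =
    (∀ u v → Σ (Walk u v) λ p → hops p ≤ D) ×
    (∃ λ u → ∃ λ v → ∀ (p : Walk u v) → D ≤ hops p)

WeightsAtMost : ∀ {n} → Graph n → ℕ → Set
WeightsAtMost G W = ∀ u v w → edge G u v ≡ just w → w ≤ W

Unweighted : ∀ {n} → Graph n → Set
Unweighted G = ∀ u v w → edge G u v ≡ just w → w ≡ 1

record Instance (n : ℕ) : Set where
  field
    graph : Graph n

  open Paths graph public

  field
    s t      : Fin n
    s≢t      : s ≢ t
    Pst      : Walk s t
    simple   : Simple Pst
    shortest : ∀ (q : Walk s t) → weight Pst ≤ weight q

data Problem : Set where
  RPaths 2-SiSP : Problem

-- A problem asks for one shortest path per query: RPaths has a query for every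
-- edge of Pst, 2-SiSP has a single query.
Query : Problem → ℕ → Set
Query RPaths n = Fin n × Fin n
Query 2-SiSP n = ⊤

module _ {n : ℕ} (I : Instance n) where
  open Instance I

  Asked : (Π : Problem) → Query Π n → Set
  Asked RPaths e = e List.∈ edges Pst
  Asked 2-SiSP _ = ⊤

  Feasible : (Π : Problem) → Query Π n → Walk s t → Set
  Feasible RPaths e p = Simple p × Avoids p e
  Feasible 2-SiSP _ p = Simple p × ∃ λ e → e List.∈ edges Pst × Avoids p e

  IsBest : (Π : Problem) → Query Π n → Walk s t → Set
  IsBest Π q p = Feasible Π q p × (∀ p′ → Feasible Π q p′ → weight p ≤ weight p′)

data ℕ∞ : Set where
  fin : ℕ → ℕ∞
  ∞   : ℕ∞

-- The optimum is ∞ when there is no feasible path.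
IsOptimum : ∀ {n} → Instance n → (Π : Problem) → Query Π n → ℕ∞ → Set
IsOptimum I Π q (fin w) = ∃ λ p → IsBest I Π q p × Instance.weight I p ≡ w
IsOptimum I Π q ∞       = ∀ p → ¬ Feasible I Π q p

data Goal : Set where
  exact  : Goal
  approx : (α : ℚ) → 1ℚ ℚ.< α → Goal

-- An infinite optimum has no finite approximation, and vice versa.
Within : ℚ → ℕ∞ → ℕ∞ → Set
Within α (fin w) (fin x) = w ≤ x × (+ x ℚ./ 1) ℚ.≤ α ℚ.* (+ w ℚ./ 1)
Within α ∞       ∞       = ⊤
Within α _       _       = ⊥

Acceptable : Goal → ℕ∞ → ℕ∞ → Set
Acceptable exact        opt x = x ≡ opt
Acceptable (approx α _) opt x = Within α opt x

-- `report q ≡ nothing` means that the node does not announce an answer to q.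
record NodeOutput (Π : Problem) (n : ℕ) : Set where
  field
    report    : Query Π n → Maybe ℕ∞
    successor : Query Π n → Maybe (Fin n)

open NodeOutput public

-- It would not be enough to ask that some node reports the right value: the
-- nodes could then try out all values. Hence every reported value must be right.
ReportsWeight : ∀ {n} → Instance n → (Π : Problem) → Goal →
                (Fin n → NodeOutput Π n) → Query Π n → Set
ReportsWeight I Π g out q =
  ∃ λ opt → IsOptimum I Π q opt ×
    (∃ λ v → ∃ λ x → report (out v) q ≡ just x) ×
    (∀ v x → report (out v) q ≡ just x → Acceptable g opt x)

-- Nothing is asked of the nodes that are not on the chosen path.
KnowsSuccessors : ∀ {n} → Instance n → (Π : Problem) →
                  (Fin n → NodeOutput Π n) → Query Π n → Set
KnowsSuccessors I Π out q =
  ∃ (Feasible I Π q) →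
  ∃ λ p → IsBest I Π q p ×
    (∀ u v → (u , v) List.∈ Instance.edges I p → successor (out u) q ≡ just v)

Correct : ∀ {n} → Instance n → (Π : Problem) → Goal →
          (Fin n → NodeOutput Π n) → Set
Correct I Π exact out =
  ∀ q → Asked I Π q → ReportsWeight I Π exact out q × KnowsSuccessors I Π out q
Correct I Π (approx α 1<α) out =
  ∀ q → Asked I Π q → ReportsWeight I Π (approx α 1<α) out q

-- What a node knows initially. Vectors, rather than functions, so that views
-- with the same content are propositionally equal.
record View (n : ℕ) : Set where
  constructor mkView
  field
    identifier    : Fin n
    incident      : Vec (Maybe ℕ) n
    source target : Fin n
    path          : List (Fin n)

view : ∀ {n} → Instance n → Fin n → View n
view I v = mkView v (tabulate (edge graph v)) s t (vertices Pst)
  where open Instance I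

Message : ℕ → Set
Message B = Vec≤ Bool B

-- A randomized algorithm for networks with n nodes and messages of at most B
-- bits. Every node draws its private coin uniformly from Fin coinSides. It may
-- use it at any later time; a deterministic algorithm ignores it.
record Algorithm (Π : Problem) (n B : ℕ) : Set₁ where
  field
    coinSides : ℕ
    .{{coinSides-nonZero}} : NonZero coinSides
    State   : Set
    init    : View n → Fin coinSides → State
    send    : State → (neighbour : Fin n) → Message B
    receive : State → Vec (Maybe (Message B)) n → State
    output  : State → NodeOutput Π n

module _ {Π : Problem} {n B : ℕ} (A : Algorithm Π n B) where
  open Algorithm A

  -- The joint outcome of n independent coins; node v sees `finToFun r v`.
  Seed : Set
  Seed = Fin (coinSides ^ n)

  module _ (I : Instance n) (r : Seed) where
    open Instance I

    state : ℕ → Fin n → State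
    state zero    v = init (view I v) (finToFun r v)
    state (suc k) v = receive (state k v)
      (tabulate λ u → Maybe.map (λ _ → send (state k u) v) (edge graph u v))

    outputs : ℕ → Fin n → NodeOutput Π n
    outputs T v = output (state T v)

  -- Some set of at least 2/3 of the seeds lies inside the event.
  WithProbability≥2/3 : (Seed → Set) → Set
  WithProbability≥2/3 Event = Σ (Subset (coinSides ^ n)) λ S →
    2 * coinSides ^ n ≤ 3 * ∣ S ∣ × (∀ r → r ∈ S → Event r)

  SolvesWithin : Goal → (Instance n → Set) → ℕ → Set
  SolvesWithin g Class T = ∀ I → Class I →
    WithProbability≥2/3 (λ r → Correct I Π g (outputs I r T))

WeightedClass : ∀ {n} → (W D h : ℕ) → Instance n → Set
WeightedClass W D h I =
  WeightsAtMost graph W × HasDiameter D × hops Pst ≤ h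
  where open Instance I

UnweightedClass : ∀ {n} → (D : ℕ) → Instance n → Set
UnweightedClass D I = Unweighted graph × HasDiameter D
  where open Instance I

PolynomiallyBounded : (ℕ → ℕ) → Set
PolynomiallyBounded W = ∃ λ k → ∀ n → 2 ≤ n → W n ≤ n ^ k

-- √n / ⌈log₂ n⌉ + D ≤ x, for n ≥ 2, with the root and the division cleared.
√_/log+_≤_ : ℕ → ℕ → ℕ → Set
√ n /log+ D ≤ x = D ≤ x × n ≤ ((x ∸ D) * ⌈log₂ n ⌉) ^ 2

{-# OPTIONS --safe #-}
module Submission where

-- The diameter bound: on a cycle through the edge st, whether there is another s-t path depends on three edges
-- that are far from each other, and in few rounds a node learns about at most one of them.
--
-- The √n bound: Alice's bits at the left ends and Bob's bits at the right ends of long tracks of weight 0 decide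
-- where a walk from s ends; it ends in t exactly when the inner product of the two inputs is even, so the
-- replacement path of {s, t} has weight 0 or at least 1. A binary tree over the columns makes the diameter small.
-- In fewer rounds than half the length of the tracks, Alice and Bob can simulate the network by exchanging only
-- the messages that enter their shrinking regions along tree edges, two per level and round. The runs with
-- the same exchanged messages form a combinatorial rectangle, and on rectangles the inner product is almost
-- balanced (Lindsey's lemma), so too few messages cannot give the right answer for two thirds of the inputs.

open import Defs
open import Data.Bool.Base using (Bool; true; false; _∧_; _∨_; _xor_; not; if_then_else_)
open import Data.Empty using (⊥; ⊥-elim)
open import Data.Fin.Base using (Fin; zero; suc; toℕ; fromℕ<; inject₁; fromℕ; finToFun; funToFin; combine; remQuot)
import Data.Fin.Properties as Fin
import Data.Integer.Base as ℤ
open import Data.List.Base using (List; []; _∷_; _++_; map; length; allFin; cartesianProduct)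
import Data.List.Membership.Propositional as List
open import Data.List.Relation.Unary.All using ([]; _∷_)
open import Data.List.Relation.Unary.AllPairs using ([]; _∷_)
open import Data.List.Relation.Unary.Any using (here; there)
open import Data.Maybe.Base as Maybe using (Maybe; just; nothing)
open import Data.Maybe.Properties using (just-injective)
open import Data.Nat.Base as ℕ using (ℕ; zero; suc)
open import Data.Nat.Logarithm using (⌈log₂_⌉)
import Data.Nat.Properties as ℕ
open import Data.Product.Base using (Σ; ∃; _×_; _,_; proj₁; proj₂)
import Data.Rational.Base as ℚ
open import Data.Sum.Base using (_⊎_; inj₁; inj₂; [_,_]′)
open import Data.Unit.Base using (⊤; tt)
open import Data.Vec.Base as Vec using (Vec; []; _∷_)
import Data.Vec.Bounded.Base as Vec≤
open import Function.Base using (_∘_; id; case_of_)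
open import Function.Bundles using (_↔_; Inverse)
open import Relation.Binary.Construct.Closure.ReflexiveTransitive using (ε; _◅_)
open import Relation.Binary.PropositionalEquality
  using (_≡_; _≢_; refl; sym; trans; cong; cong₂; subst; subst₂; module ≡-Reasoning)
open import Relation.Nullary using (¬_; Dec; yes; no; does; contradiction)

-- Two distinctions survive approximation by every factor: zero against positive, and finite against
-- infinite. Hence the weight 0 on the tracks, and hence the question on the cycle whether a detour
-- exists at all. The given path is a single edge throughout, so that both problems ask for the same
-- detour.
--
-- The algorithm chooses which node announces the answer, and the choice may depend on the coins. A
-- single missing edge would prove nothing, since the announcing node may sit next to it.
--
-- The inner product is preferred to disjointness because its randomized hardness follows from a
-- bound on a matrix norm. To evaluate it, xᵢ and yᵢ must meet although they are visible at opposite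
-- ends only; so the walk runs out and back in each row, and the choice of a track carries xᵢ to
-- Bob's end.
--
-- The root comes from counting: two messages of O(log n) bits on each of O(log n) levels in each of
-- T rounds require some T log² n rows, and about 2T columns let the regions of both parties cover
-- the network. This takes about T² log² n nodes.

module Sums where

  open import Data.Integer.Base hiding (suc; pred; sign; ∣_∣)
  open import Data.Integer.Properties
  open import Data.Integer.Tactic.RingSolver using (solve-∀)
  import Data.List.Properties as List

  private variable A B : Set

  -- Finite sums of integers

  ∑ : List A → (A → ℤ) → ℤ
  ∑ []       f = 0ℤ
  ∑ (x ∷ xs) f = f x + ∑ xs f

  +-congˡ : ∀ i {j k} → j ≡ k → i + j ≡ i + k
  +-congˡ i = cong (λ j → i + j)

  ∑-cong : ∀ (xs : List A) {f g} → (∀ x → f x ≡ g x) → ∑ xs f ≡ ∑ xs g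
  ∑-cong []       e = refl
  ∑-cong (x ∷ xs) e = cong₂ _+_ (e x) (∑-cong xs e)

  ∑-mono : ∀ (xs : List A) {f g} → (∀ x → f x ≤ g x) → ∑ xs f ≤ ∑ xs g
  ∑-mono []       e = ≤-refl
  ∑-mono (x ∷ xs) e = +-mono-≤ (e x) (∑-mono xs e)

  interchange : ∀ a b c d → (a + b) + (c + d) ≡ (a + c) + (b + d)
  interchange = solve-∀

  ∑-+ : ∀ (xs : List A) f g → ∑ xs (λ x → f x + g x) ≡ ∑ xs f + ∑ xs g
  ∑-+ []       f g = refl
  ∑-+ (x ∷ xs) f g =
    trans (+-congˡ (f x + g x) (∑-+ xs f g)) (interchange (f x) (g x) (∑ xs f) (∑ xs g))

  ∑-* : ∀ (xs : List A) c f → ∑ xs (λ x → c * f x) ≡ c * ∑ xs f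
  ∑-* []       c f = sym (*-zeroʳ c)
  ∑-* (x ∷ xs) c f = trans (+-congˡ (c * f x) (∑-* xs c f)) (sym (*-distribˡ-+ c (f x) (∑ xs f)))

  ∑-const : ∀ (xs : List A) c → ∑ xs (λ _ → c) ≡ + length xs * c
  ∑-const []       c = sym (*-zeroˡ c)
  ∑-const (x ∷ xs) c = trans (+-congˡ c (∑-const xs c)) (sym (suc-* (+ length xs) c))

  ∑-comm : ∀ (xs : List A) (ys : List B) (f : A → B → ℤ) →
           ∑ xs (λ x → ∑ ys (f x)) ≡ ∑ ys (λ y → ∑ xs (λ x → f x y))
  ∑-comm []       ys f = sym (trans (∑-const ys 0ℤ) (*-zeroʳ (+ length ys)))
  ∑-comm (x ∷ xs) ys f =
    trans (+-congˡ (∑ ys (f x)) (∑-comm xs ys f)) (sym (∑-+ ys (f x) (λ y → ∑ xs (λ x → f x y))))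

  ∑-++ : ∀ (xs ys : List A) f → ∑ (xs ++ ys) f ≡ ∑ xs f + ∑ ys f
  ∑-++ []       ys f = sym (+-identityˡ _)
  ∑-++ (x ∷ xs) ys f = trans (+-congˡ (f x) (∑-++ xs ys f)) (sym (+-assoc (f x) _ _))

  ∑-map : ∀ (h : A → B) xs f → ∑ (map h xs) f ≡ ∑ xs (f ∘ h)
  ∑-map h []       f = refl
  ∑-map h (x ∷ xs) f = +-congˡ (f (h x)) (∑-map h xs f)

  ∑-× : ∀ (xs : List A) (ys : List B) f →
        ∑ (cartesianProduct xs ys) f ≡ ∑ xs (λ x → ∑ ys (λ y → f (x , y)))
  ∑-× []       ys f = refl
  ∑-× (x ∷ xs) ys f = trans (∑-++ (map (x ,_) ys) _ f) (cong₂ _+_ (∑-map (x ,_) ys f) (∑-× xs ys f))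

  δ : ∀ {K} → Fin K → Fin K → ℤ
  δ zero    zero    = 1ℤ
  δ zero    (suc _) = 0ℤ
  δ (suc _) zero    = 0ℤ
  δ (suc i) (suc j) = δ i j

  δ-refl : ∀ {K} (i : Fin K) → δ i i ≡ 1ℤ
  δ-refl zero    = refl
  δ-refl (suc i) = δ-refl i

  δ-≢ : ∀ {K} (i j : Fin K) → i ≢ j → δ i j ≡ 0ℤ
  δ-≢ zero    zero    i≢j = contradiction refl i≢j
  δ-≢ zero    (suc _) i≢j = refl
  δ-≢ (suc _) zero    i≢j = refl
  δ-≢ (suc i) (suc j) i≢j = δ-≢ i j (i≢j ∘ cong suc)

  ∑-allFin : ∀ {K} (f : Fin (suc K) → ℤ) → ∑ (allFin (suc K)) f ≡ f zero + ∑ (allFin K) (f ∘ suc)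
  ∑-allFin {K} f = +-congˡ (f zero)
    (trans (cong (λ xs → ∑ xs f) (sym (List.map-tabulate id suc))) (∑-map suc (allFin K) f))

  ∑-δ : ∀ {K} (k : Fin K) (f : Fin K → ℤ) → ∑ (allFin K) (λ m → δ k m * f m) ≡ f k
  ∑-δ {suc K} zero f = trans (∑-allFin {K} (λ m → δ zero m * f m))
    (trans (cong₂ _+_ (*-identityˡ (f zero))
              (trans (∑-cong (allFin K) (λ m → *-zeroˡ (f (suc m))))
                  (trans (∑-const (allFin K) 0ℤ) (*-zeroʳ (+ length (allFin K))))))
           (+-identityʳ (f zero)))
  ∑-δ {suc K} (suc k) f = trans (∑-allFin {K} (λ m → δ (suc k) m * f m))
    (trans (cong₂ _+_ (*-zeroˡ (f zero)) (∑-δ k (f ∘ suc))) (+-identityˡ (f (suc k))))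

  length-allFin : ∀ K → length (allFin K) ≡ K
  length-allFin K = List.length-tabulate id

  sq-nonneg : ∀ i → 0ℤ ≤ i * i
  sq-nonneg (+ n)    = subst (0ℤ ≤_) (pos-* n n) (+≤+ ℕ.z≤n)
  sq-nonneg -[1+ n ] = +≤+ ℕ.z≤n

  *-nonneg : ∀ {i j} → 0ℤ ≤ i → 0ℤ ≤ j → 0ℤ ≤ i * j
  *-nonneg {+ m} {+ n} _ _ = subst (0ℤ ≤_) (pos-* m n) (+≤+ ℕ.z≤n)

  *-mono : ∀ {i j k l} → 0ℤ ≤ i → i ≤ j → 0ℤ ≤ k → k ≤ l → i * k ≤ j * l
  *-mono {i} {j} {k} {l} 0≤i i≤j 0≤k k≤l = ≤-trans
    (*-monoʳ-≤-nonNeg k {{nonNegative 0≤k}} i≤j)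
    (*-monoˡ-≤-nonNeg j {{nonNegative (≤-trans 0≤i i≤j)}} k≤l)

  sq-cancel-≤ : ∀ {i j} → 0ℤ ≤ j → i * i ≤ j * j → i ≤ j
  sq-cancel-≤ {i} {j} 0≤j i²≤j² with i ≤? j
  ... | yes i≤j = i≤j
  ... | no  i≰j = contradiction i²≤j² (<⇒≱ (≤-<-trans
          (*-monoˡ-≤-nonNeg j {{nonNegative 0≤j}} (<⇒≤ j<i))
          (*-monoʳ-<-pos i {{positive (≤-<-trans 0≤j j<i)}} j<i)))
    where j<i = ≰⇒> i≰j

  -- 2uv ≤ p(αδ + βγ) by AM-GM, and the rest is (α + β)(γ + δ).
  cauchy : ∀ u v p α β γ κ → 0ℤ ≤ p → 0ℤ ≤ α → 0ℤ ≤ β → 0ℤ ≤ γ → 0ℤ ≤ κ →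
           u * u ≤ p * (α * γ) → v * v ≤ p * (β * κ) →
           (u + v) * (u + v) ≤ p * ((α + β) * (γ + κ))
  cauchy u v p α β γ κ p0 α0 β0 γ0 κ0 hu hv =
    subst₂ _≤_ (e₁ u v) (e₂ p α β γ κ) (+-mono-≤ (+-mono-≤ hu hv) cross)
    where
    e₁ : ∀ u v → (u * u + v * v) + (+ 2) * (u * v) ≡ (u + v) * (u + v)
    e₁ = solve-∀
    e₂ : ∀ p α β γ κ → (p * (α * γ) + p * (β * κ)) + p * (α * κ + β * γ) ≡ p * ((α + β) * (γ + κ))
    e₂ = solve-∀
    e₃ : ∀ u v → (+ 4) * ((u * u) * (v * v)) ≡ ((+ 2) * (u * v)) * ((+ 2) * (u * v))
    e₃ = solve-∀
    e₄ : ∀ p α β γ κ →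
         (+ 4) * ((p * (α * γ)) * (p * (β * κ)))
           + (p * (α * κ) - p * (β * γ)) * (p * (α * κ) - p * (β * γ))
         ≡ (p * (α * κ + β * γ)) * (p * (α * κ + β * γ))
    e₄ = solve-∀
    cross : (+ 2) * (u * v) ≤ p * (α * κ + β * γ)
    cross = sq-cancel-≤ (*-nonneg p0 (+-mono-≤ (*-nonneg α0 κ0) (*-nonneg β0 γ0)))
      (subst₂ _≤_ (trans (+-identityʳ _) (e₃ u v)) (e₄ p α β γ κ)
        (+-mono-≤ (*-monoˡ-≤-nonNeg (+ 4) (*-mono (sq-nonneg u) hu (sq-nonneg v) hv))
                  (sq-nonneg (p * (α * κ) - p * (β * γ)))))

  -- Lindsey's lemma

  Cube : ℕ → Set
  Cube = Vec Bool

  cube : ∀ N → List (Cube N)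
  cube zero    = [] ∷ []
  cube (suc N) = map (false ∷_) (cube N) ++ map (true ∷_) (cube N)

  ∑-cube : ∀ N (f : Cube (suc N) → ℤ) →
           ∑ (cube (suc N)) f ≡ ∑ (cube N) (f ∘ (false ∷_)) + ∑ (cube N) (f ∘ (true ∷_))
  ∑-cube N f = trans (∑-++ (map (false ∷_) (cube N)) _ f)
    (cong₂ _+_ (∑-map (false ∷_) (cube N) f) (∑-map (true ∷_) (cube N) f))

  length-cube : ∀ N → length (cube N) ≡ 2 ℕ.^ N
  length-cube zero    = refl
  length-cube (suc N) = trans (List.length-++ (map (false ∷_) (cube N)))
    (cong₂ ℕ._+_ (trans (List.length-map _ (cube N)) (length-cube N))
      (trans (trans (List.length-map _ (cube N)) (length-cube N)) (sym (ℕ.+-identityʳ _))))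

  sign : Bool → ℤ
  sign false = 1ℤ
  sign true  = -1ℤ

  -- By `sign-ip`, -1 to the power of the inner product: the entries of Sylvester's Hadamard matrix,
  -- whose block form is this recursion.
  χ : ∀ {N} → Cube N → Cube N → ℤ
  χ []      []      = 1ℤ
  χ (a ∷ x) (b ∷ y) = sign (a ∧ b) * χ x y

  ∑∑ : ∀ N → (Cube N → Cube N → ℤ) → ℤ
  ∑∑ N f = ∑ (cube N) λ x → ∑ (cube N) λ y → f x y

  ∑∑-cong : ∀ N {f g} → (∀ x y → f x y ≡ g x y) → ∑∑ N f ≡ ∑∑ N g
  ∑∑-cong N e = ∑-cong (cube N) (λ x → ∑-cong (cube N) (e x))

  ∑∑-+ : ∀ N f g → ∑∑ N (λ x y → f x y + g x y) ≡ ∑∑ N f + ∑∑ N g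
  ∑∑-+ N f g = trans (∑-cong (cube N) (λ x → ∑-+ (cube N) (f x) (g x))) (∑-+ (cube N) _ _)

  ∑∑-suc : ∀ N f → ∑∑ (suc N) f ≡
    (∑∑ N (λ x y → f (false ∷ x) (false ∷ y)) + ∑∑ N (λ x y → f (false ∷ x) (true ∷ y))) +
    (∑∑ N (λ x y → f (true ∷ x) (false ∷ y)) + ∑∑ N (λ x y → f (true ∷ x) (true ∷ y)))
  ∑∑-suc N f = trans (∑-cube N _) (cong₂ _+_ (half false) (half true))
    where
    half : ∀ b → ∑ (cube N) (λ x → ∑ (cube (suc N)) (f (b ∷ x))) ≡
                 ∑∑ N (λ x y → f (b ∷ x) (false ∷ y)) + ∑∑ N (λ x y → f (b ∷ x) (true ∷ y))
    half b = trans (∑-cong (cube N) (λ x → ∑-cube N (f (b ∷ x)))) (∑-+ (cube N) _ _)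

  bilinear : ∀ N → (a b : Cube N → ℤ) → ℤ
  bilinear N a b = ∑∑ N λ x y → (a x * b y) * χ x y

  ‖_‖² : ∀ {N} → (Cube N → ℤ) → ℤ
  ‖_‖² {N} a = ∑ (cube N) λ x → a x * a x

  ‖‖²-nonneg : ∀ {N} (a : Cube N → ℤ) → 0ℤ ≤ ‖ a ‖²
  ‖‖²-nonneg {N} a = subst (_≤ ‖ a ‖²) (trans (∑-const (cube N) 0ℤ) (*-zeroʳ (+ length (cube N))))
    (∑-mono (cube N) {λ _ → 0ℤ} (λ x → sq-nonneg (a x)))

  module _ {N} (a b : Cube (suc N) → ℤ) where
    private
      a₀ a₁ a₊ a₋ b₀ b₁ : Cube N → ℤ
      a₀ = a ∘ (false ∷_)
      a₁ = a ∘ (true ∷_)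
      b₀ = b ∘ (false ∷_)
      b₁ = b ∘ (true ∷_)
      a₊ x = a₀ x + a₁ x
      a₋ x = a₀ x - a₁ x

    -- The block form (H, H; H, -H) of the Hadamard matrix, applied to `a` first: `b₀` meets the sum
    -- of the halves of `a`, and `b₁` their difference.
    bilinear-suc : bilinear (suc N) a b ≡ bilinear N a₊ b₀ + bilinear N a₋ b₁
    bilinear-suc = begin
      bilinear (suc N) a b                            ≡⟨ ∑∑-suc N (λ x y → (a x * b y) * χ x y) ⟩
      (∑∑ N f₀₀ + ∑∑ N f₀₁) + (∑∑ N f₁₀ + ∑∑ N f₁₁)   ≡⟨ cong₂ _+_ (∑∑-+ N f₀₀ f₀₁) (∑∑-+ N f₁₀ f₁₁) ⟨
      ∑∑ N (λ x y → f₀₀ x y + f₀₁ x y) + ∑∑ N (λ x y → f₁₀ x y + f₁₁ x y)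
                                                      ≡⟨ ∑∑-+ N (λ x y → f₀₀ x y + f₀₁ x y) _ ⟨
      ∑∑ N (λ x y → (f₀₀ x y + f₀₁ x y) + (f₁₀ x y + f₁₁ x y))
                                                      ≡⟨ ∑∑-cong N (λ x y → e (a₀ x) (a₁ x) (b₀ y) (b₁ y) (χ x y)) ⟩
      ∑∑ N (λ x y → (a₊ x * b₀ y) * χ x y + (a₋ x * b₁ y) * χ x y)
                                                      ≡⟨ ∑∑-+ N (λ x y → (a₊ x * b₀ y) * χ x y) _ ⟩
      bilinear N a₊ b₀ + bilinear N a₋ b₁             ∎
      where
      open ≡-Reasoning
      f₀₀ f₀₁ f₁₀ f₁₁ : Cube N → Cube N → ℤ
      f₀₀ x y = (a₀ x * b₀ y) * (1ℤ * χ x y)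
      f₀₁ x y = (a₀ x * b₁ y) * (1ℤ * χ x y)
      f₁₀ x y = (a₁ x * b₀ y) * (1ℤ * χ x y)
      f₁₁ x y = (a₁ x * b₁ y) * (-1ℤ * χ x y)
      e : ∀ p q r s c → ((p * r) * (1ℤ * c) + (p * s) * (1ℤ * c)) + ((q * r) * (1ℤ * c) + (q * s) * (-1ℤ * c))
                      ≡ ((p + q) * r) * c + ((p - q) * s) * c
      e = solve-∀

    parallelogram : ‖ a₊ ‖² + ‖ a₋ ‖² ≡ (+ 2) * ‖ a ‖²
    parallelogram = begin
      ‖ a₊ ‖² + ‖ a₋ ‖²                                        ≡⟨ ∑-+ (cube N) _ _ ⟨
      ∑ (cube N) (λ x → a₊ x * a₊ x + a₋ x * a₋ x)             ≡⟨ ∑-cong (cube N) (λ x → e (a₀ x) (a₁ x)) ⟩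
      ∑ (cube N) (λ x → (+ 2) * (a₀ x * a₀ x + a₁ x * a₁ x))   ≡⟨ ∑-* (cube N) (+ 2) _ ⟩
      (+ 2) * ∑ (cube N) (λ x → a₀ x * a₀ x + a₁ x * a₁ x)     ≡⟨ cong ((+ 2) *_) (∑-+ (cube N) _ _) ⟩
      (+ 2) * (‖ a₀ ‖² + ‖ a₁ ‖²)                              ≡⟨ cong ((+ 2) *_) (∑-cube N _) ⟨
      (+ 2) * ‖ a ‖²                                           ∎
      where
      open ≡-Reasoning
      e : ∀ p q → (p + q) * (p + q) + (p - q) * (p - q) ≡ (+ 2) * (p * p + q * q)
      e = solve-∀

  -- The Hadamard matrix has norm 2^(N/2); squaring keeps the bound in the integers. In the
  -- induction `cauchy` joins the two halves, and `parallelogram` contributes the factor 2 per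
  -- dimension.
  lindsey : ∀ N (a b : Cube N → ℤ) →
            bilinear N a b * bilinear N a b ≤ (+ (2 ℕ.^ N)) * (‖ a ‖² * ‖ b ‖²)
  lindsey zero a b = ≤-reflexive (e (a []) (b []))
    where
    e : ∀ p q → (((p * q) * 1ℤ + 0ℤ) + 0ℤ) * (((p * q) * 1ℤ + 0ℤ) + 0ℤ) ≡ 1ℤ * ((p * p + 0ℤ) * (q * q + 0ℤ))
    e = solve-∀
  lindsey (suc N) a b = subst₂ _≤_ (cong₂ _*_ (sym split) (sym split)) total
    (cauchy (bilinear N a₊ b₀) (bilinear N a₋ b₁) (+ (2 ℕ.^ N)) ‖ a₊ ‖² ‖ a₋ ‖² ‖ b₀ ‖² ‖ b₁ ‖²
      (+≤+ ℕ.z≤n) (‖‖²-nonneg a₊) (‖‖²-nonneg a₋) (‖‖²-nonneg b₀) (‖‖²-nonneg b₁)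
      (lindsey N a₊ b₀) (lindsey N a₋ b₁))
    where
    split = bilinear-suc a b
    a₊ a₋ b₀ b₁ : Cube N → ℤ
    a₊ x = a (false ∷ x) + a (true ∷ x)
    a₋ x = a (false ∷ x) - a (true ∷ x)
    b₀ = b ∘ (false ∷_)
    b₁ = b ∘ (true ∷_)
    e : ∀ p q r → p * (((+ 2) * q) * r) ≡ ((+ 2) * p) * (q * r)
    e = solve-∀
    total : (+ (2 ℕ.^ N)) * ((‖ a₊ ‖² + ‖ a₋ ‖²) * (‖ b₀ ‖² + ‖ b₁ ‖²)) ≡ (+ (2 ℕ.^ suc N)) * (‖ a ‖² * ‖ b ‖²)
    total = begin
      _  ≡⟨ cong₂ (λ p q → (+ (2 ℕ.^ N)) * (p * q)) (parallelogram a b) (sym (∑-cube N _)) ⟩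
      (+ (2 ℕ.^ N)) * (((+ 2) * ‖ a ‖²) * ‖ b ‖²)  ≡⟨ e (+ (2 ℕ.^ N)) ‖ a ‖² ‖ b ‖² ⟩
      ((+ 2) * (+ (2 ℕ.^ N))) * (‖ a ‖² * ‖ b ‖²)  ≡⟨ cong (_* (‖ a ‖² * ‖ b ‖²)) (sym (pos-* 2 (2 ℕ.^ N))) ⟩
      _  ∎
      where open ≡-Reasoning

-- Randomized communication complexity of the inner product

module Communication where

  open import Data.Integer.Base hiding (suc; pred; sign; ∣_∣)
  open import Data.Integer.Properties
  open import Data.Integer.Tactic.RingSolver using (solve-∀)
  import Data.Fin.Properties as Fin
  open import Data.Fin.Subset using (Subset; _∈_; ∣_∣)
  import Data.List.Properties as List
  open import Data.Vec.Properties using (lookup⇒[]=)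
  open import Relation.Nullary.Decidable using (decidable-stable)
  open Sums

  private variable A : Set

  ±1 : Bool → ℤ
  ±1 true  = 1ℤ
  ±1 false = -1ℤ

  -- Members count 1 and all others -1, so that success with probability 2/3 becomes an advantage of
  -- at least R / 3.
  advantage : ∀ {R} → Subset R → ℤ
  advantage []      = 0ℤ
  advantage (b ∷ S) = ±1 b + advantage S

  advantage-size : ∀ {R} (S : Subset R) → advantage S + (+ R) ≡ (+ 2) * (+ ∣ S ∣)
  advantage-size []                = refl
  advantage-size {suc R} (true ∷ S)  = trans (e₁ (advantage S) (+ R))
    (trans (+-congˡ (+ 2) (advantage-size S)) (e₂ (+ ∣ S ∣)))
    where
    e₁ : ∀ a r → (1ℤ + a) + (1ℤ + r) ≡ (+ 2) + (a + r)
    e₁ = solve-∀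
    e₂ : ∀ s → (+ 2) + (+ 2) * s ≡ (+ 2) * (1ℤ + s)
    e₂ = solve-∀
  advantage-size {suc R} (false ∷ S) = trans (e (advantage S) (+ R)) (advantage-size S)
    where
    e : ∀ a r → (-1ℤ + a) + (1ℤ + r) ≡ a + r
    e = solve-∀

  likely⇒advantage : ∀ {R} (S : Subset R) → 2 ℕ.* R ℕ.≤ 3 ℕ.* ∣ S ∣ → + R ≤ (+ 3) * advantage S
  likely⇒advantage {R} S 2R≤3S = subst₂ _≤_ (e₁ (+ R)) e₂ (+-monoˡ-≤ (- (+ 3 * + R)) six)
    where
    six : (+ 2) * ((+ 2) * (+ R)) ≤ (+ 2) * ((+ 3) * (+ ∣ S ∣))
    six = *-monoˡ-≤-nonNeg (+ 2) (subst₂ _≤_ (pos-* 2 R) (pos-* 3 ∣ S ∣) (+≤+ 2R≤3S))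
    e₁ : ∀ r → (+ 2) * ((+ 2) * r) + (- ((+ 3) * r)) ≡ r
    e₁ = solve-∀
    e₃ : ∀ s → (+ 2) * ((+ 3) * s) ≡ (+ 3) * ((+ 2) * s)
    e₃ = solve-∀
    e₄ : ∀ a r → (+ 3) * (a + r) + (- ((+ 3) * r)) ≡ (+ 3) * a
    e₄ = solve-∀
    e₂ : (+ 2) * ((+ 3) * (+ ∣ S ∣)) + (- ((+ 3) * + R)) ≡ (+ 3) * advantage S
    e₂ = trans (cong (_+ (- ((+ 3) * + R))) (trans (e₃ (+ ∣ S ∣)) (cong ((+ 3) *_) (sym (advantage-size S)))))
               (e₄ (advantage S) (+ R))

  -- Peeling off one seed at a time exchanges the sums over inputs and seeds. The strict inequality
  -- of each seed gains one unit; together these units form the summand `+ R`, the slack that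
  -- `averaging` contradicts.
  ∑-advantage : ∀ (xs : List A) {R} (S : A → Subset R) →
    (∀ r → (+ 3) * ∑ xs (λ a → ±1 (Vec.lookup (S a) r)) < + length xs) →
    (+ 3) * ∑ xs (λ a → advantage (S a)) + (+ R) ≤ (+ length xs) * (+ R)
  ∑-advantage xs {zero} S small = ≤-reflexive (trans (trans (+-identityʳ _)
      (trans (cong ((+ 3) *_) (trans (∑-cong xs (λ a → empty (S a)))
          (trans (∑-const xs 0ℤ) (*-zeroʳ (+ length xs))))) refl))
      (sym (*-zeroʳ (+ length xs))))
    where
    empty : (S : Subset 0) → advantage S ≡ 0ℤ
    empty [] = refl
  ∑-advantage xs {suc R} S small = subst₂ _≤_
      (trans (e (∑ xs λ a → ±1 (Vec.head (S a))) (∑ xs λ a → advantage (Vec.tail (S a))) (+ R))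
        (cong (λ z → (+ 3) * z + (1ℤ + (+ R)))
          (trans (sym (∑-+ xs _ _)) (∑-cong xs λ a → uncons (S a)))))
      (sym (*-suc (+ length xs) (+ R)))
      (+-mono-≤ head≤ (∑-advantage xs (λ a → Vec.tail (S a))
          (λ r → subst (λ z → (+ 3) * z < + length xs) (∑-cong xs (λ a → shift (S a) r)) (small (suc r)))))
    where
    e : ∀ h t r → ((+ 3) * h + 1ℤ) + ((+ 3) * t + r) ≡ (+ 3) * (h + t) + (1ℤ + r)
    e = solve-∀
    uncons : (S : Subset (suc R)) → ±1 (Vec.head S) + advantage (Vec.tail S) ≡ advantage S
    uncons (b ∷ S) = refl
    shift : (S : Subset (suc R)) → ∀ r → ±1 (Vec.lookup S (suc r)) ≡ ±1 (Vec.lookup (Vec.tail S) r)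
    shift (b ∷ S) r = refl
    first : (S : Subset (suc R)) → ±1 (Vec.lookup S zero) ≡ ±1 (Vec.head S)
    first (b ∷ S) = refl
    head≤ : (+ 3) * ∑ xs (λ a → ±1 (Vec.head (S a))) + 1ℤ ≤ + length xs
    head≤ = subst (_≤ + length xs) (+-comm 1ℤ ((+ 3) * ∑ xs (λ a → ±1 (Vec.head (S a)))))
      (i<j⇒suc[i]≤j (subst (λ z → (+ 3) * z < + length xs) (∑-cong xs (λ a → first (S a))) (small zero)))

  -- The easy half of Yao's principle. The negated premise makes each seed good for fewer than two
  -- thirds of the inputs, while each input has at least two thirds of good seeds.
  averaging : ∀ (xs : List A) {R} → 0 ℕ.< R → (S : A → Subset R) → (∀ a → 2 ℕ.* R ℕ.≤ 3 ℕ.* ∣ S a ∣) →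
    ¬ (∀ r → (+ 3) * ∑ xs (λ a → ±1 (Vec.lookup (S a) r)) < + length xs)
  averaging xs {R} 0<R S likely small = ≤⇒≯
    (+-cancelˡ-≤′ (≤-trans (∑-advantage xs S small)
      (subst₂ _≤_ (∑-const xs (+ R)) (∑-* xs (+ 3) _) (∑-mono xs (λ a → likely⇒advantage (S a) (likely a))))))
    (+<+ 0<R)
    where
    +-cancelˡ-≤′ : ∀ {i j} → i + j ≤ i → j ≤ 0ℤ
    +-cancelˡ-≤′ {i} {j} h = subst₂ _≤_ (e i j) (+-inverseˡ i) (+-monoʳ-≤ (- i) h)
      where
      e : ∀ i j → (- i) + (i + j) ≡ j
      e = solve-∀

  -- Cut and paste: every fibre of `τ` is a product of a set of `x` with a set of `y`. The other
  -- corner, `τ x′ y`, follows by symmetry.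
  Rectangular : ∀ {N K} → (Cube N → Cube N → Fin K) → Set
  Rectangular τ = ∀ {x y x′ y′} → τ x y ≡ τ x′ y′ → τ x y′ ≡ τ x y

  δ² : ∀ {K} (i j : Fin K) → δ i j * δ i j ≤ 1ℤ
  δ² zero    zero    = ≤-refl
  δ² zero    (suc j) = +≤+ ℕ.z≤n
  δ² (suc i) zero    = +≤+ ℕ.z≤n
  δ² (suc i) (suc j) = δ² i j

  sign² : ∀ b → sign b * sign b ≡ 1ℤ
  sign² true  = refl
  sign² false = refl

  pow₃ : ∀ M → 2 ℕ.^ (M ℕ.+ M) ℕ.* (2 ℕ.^ (M ℕ.+ M) ℕ.* 2 ℕ.^ (M ℕ.+ M))
             ≡ 2 ℕ.^ (M ℕ.+ (M ℕ.+ M)) ℕ.* 2 ℕ.^ (M ℕ.+ (M ℕ.+ M))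
  pow₃ M rewrite ℕ.^-distribˡ-+-* 2 M (M ℕ.+ M) | ℕ.^-distribˡ-+-* 2 M M = e (2 ℕ.^ M)
    where
    open import Data.Nat.Tactic.RingSolver renaming (solve-∀ to solveℕ-∀)
    e : ∀ p → (p ℕ.* p) ℕ.* ((p ℕ.* p) ℕ.* (p ℕ.* p)) ≡ (p ℕ.* (p ℕ.* p)) ℕ.* (p ℕ.* (p ℕ.* p))
    e = solveℕ-∀

  ip : ∀ {N} → Cube N → Cube N → Bool
  ip []      []      = false
  ip (a ∷ x) (b ∷ y) = (a ∧ b) xor ip x y

  sign-ip : ∀ {N} (x y : Cube N) → sign (ip x y) ≡ χ x y
  sign-ip []      []      = refl
  sign-ip (a ∷ x) (b ∷ y) = trans (sign-xor (a ∧ b) (ip x y)) (cong (sign (a ∧ b) *_) (sign-ip x y))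
    where
    sign-xor : ∀ a b → sign (a xor b) ≡ sign a * sign b
    sign-xor false false = refl
    sign-xor false true  = refl
    sign-xor true  false = refl
    sign-xor true  true  = refl

  module _ (M : ℕ) where
    private
      -- An even dimension makes `Q`, the square root of the bound 2^N * 2^N * 2^N from `lindsey`, a
      -- power of 2.
      N = M ℕ.+ M
      Q = + (2 ℕ.^ (M ℕ.+ (M ℕ.+ M)))

    bilinear-bound : ∀ (a b : Cube N → ℤ) → (∀ x → a x * a x ≤ 1ℤ) → (∀ y → b y * b y ≤ 1ℤ) →
                     bilinear N a b ≤ Q
    bilinear-bound a b a≤1 b≤1 = sq-cancel-≤ {bilinear N a b} {Q} (+≤+ ℕ.z≤n) (≤-trans (lindsey N a b)
      (subst₂ _≤_ refl e
        (*-monoˡ-≤-nonNeg (+ (2 ℕ.^ N)) (*-mono (‖‖²-nonneg a) (norm a a≤1) (‖‖²-nonneg b) (norm b b≤1)))))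
      where
      norm : ∀ (a : Cube N → ℤ) → (∀ x → a x * a x ≤ 1ℤ) → ‖ a ‖² ≤ + (2 ℕ.^ N)
      norm a a≤1 = ≤-trans (∑-mono (cube N) a≤1)
        (≤-reflexive (trans (∑-const (cube N) 1ℤ) (trans (*-identityʳ _) (cong +_ (length-cube N)))))
      e : (+ (2 ℕ.^ N)) * ((+ (2 ℕ.^ N)) * (+ (2 ℕ.^ N))) ≡ Q * Q
      e = trans (cong ((+ (2 ℕ.^ N)) *_) (sym (pos-* (2 ℕ.^ N) (2 ℕ.^ N))))
        (trans (sym (pos-* (2 ℕ.^ N) (2 ℕ.^ N ℕ.* 2 ℕ.^ N)))
            (trans (cong +_ (pow₃ M)) (pos-* (2 ℕ.^ (M ℕ.+ (M ℕ.+ M))) (2 ℕ.^ (M ℕ.+ (M ℕ.+ M))))))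

    module _ {K} (τ : Cube N → Cube N → Fin K) (rect : Rectangular τ) (out : Fin K → Bool) where

      piece : Fin K → ℤ
      piece m = ∑∑ N λ x y → δ (τ x y) m * (sign (out m) * χ x y)

      -- If τ x₀ y₀ ≡ m, then the fibre of m is {x | τ x y₀ ≡ m} × {y | τ x₀ y ≡ m}.
      fibre : ∀ {x₀ y₀ m} → τ x₀ y₀ ≡ m → ∀ x y → δ (τ x y) m ≡ δ (τ x y₀) m * δ (τ x₀ y) m
      fibre {x₀} {y₀} {m} refl x y with τ x y₀ Fin.≟ m | τ x₀ y Fin.≟ m
      ... | yes p | yes q = trans (cong (λ k → δ k m) (trans (rect (trans p (sym q))) p))
                                  (trans (δ-refl m) (sym (cong₂ _*_ (trans (cong (λ k → δ k m) p) (δ-refl m))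
                                                                    (trans (cong (λ k → δ k m) q) (δ-refl m)))))
      ... | no ¬p | _     = trans (δ-≢ (τ x y) m (λ e → ¬p (trans (rect e) e)))
                                  (sym (trans (cong (_* _) (δ-≢ (τ x y₀) m ¬p)) (*-zeroˡ (δ (τ x₀ y) m))))
      ... | _     | no ¬q = trans (δ-≢ (τ x y) m (λ e → ¬q (rect (sym e))))
                                  (sym (trans (cong (δ (τ x y₀) m *_) (δ-≢ (τ x₀ y) m ¬q)) (*-zeroʳ (δ (τ x y₀) m))))

      piece-hit : ∀ {x₀ y₀ m} → τ x₀ y₀ ≡ m → piece m ≤ Q
      piece-hit {x₀} {y₀} {m} hit = subst (_≤ Q) (sym (∑∑-cong N reassoc)) (bilinear-bound a b a≤1 b≤1)
        where
        a b : Cube N → ℤ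
        a x = sign (out m) * δ (τ x y₀) m
        b y = δ (τ x₀ y) m
        e : ∀ p q s c → (p * q) * (s * c) ≡ ((s * p) * q) * c
        e = solve-∀
        reassoc : ∀ x y → δ (τ x y) m * (sign (out m) * χ x y) ≡ (a x * b y) * χ x y
        reassoc x y = trans (cong (_* (sign (out m) * χ x y)) (fibre hit x y))
                            (e (δ (τ x y₀) m) (δ (τ x₀ y) m) (sign (out m)) (χ x y))
        e′ : ∀ s p → (s * p) * (s * p) ≡ (s * s) * (p * p)
        e′ = solve-∀
        a≤1 : ∀ x → a x * a x ≤ 1ℤ
        a≤1 x = subst (_≤ 1ℤ) (sym (trans (e′ (sign (out m)) (δ (τ x y₀) m))
          (trans (cong (_* (δ (τ x y₀) m * δ (τ x y₀) m)) (sign² (out m))) (*-identityˡ _)))) (δ² (τ x y₀) m)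
        b≤1 : ∀ y → b y * b y ≤ 1ℤ
        b≤1 y = δ² (τ x₀ y) m

      piece-bound : ∀ m → piece m ≤ Q
      -- Whether `m` is a value of `τ` need not be decided: the inequality is decidable, hence
      -- stable under double negation.
      piece-bound m = decidable-stable (_ ≤? _) λ piece≰Q → piece≰Q
        (subst (_≤ Q) (sym (missed λ x y hit → piece≰Q (piece-hit hit))) (+≤+ ℕ.z≤n))
        where
        zeros : ∑∑ N (λ _ _ → 0ℤ) ≡ 0ℤ
        zeros = trans (∑-cong (cube N) (λ _ → trans (∑-const (cube N) 0ℤ) (*-zeroʳ (+ length (cube N)))))
                      (trans (∑-const (cube N) 0ℤ) (*-zeroʳ (+ length (cube N))))
        missed : (∀ x y → τ x y ≢ m) → piece m ≡ 0ℤ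
        missed miss = trans (∑∑-cong N (λ x y → trans (cong (_* _) (δ-≢ (τ x y) m (miss x y)))
            (*-zeroˡ (sign (out m) * χ x y)))) zeros

      correlation-bound : ∑∑ N (λ x y → sign (out (τ x y)) * χ x y) ≤ (+ K) * Q
      correlation-bound = subst₂ _≤_ (sym expand)
        (trans (∑-const (allFin K) Q) (cong (λ k → + k * Q) (length-allFin K)))
        (∑-mono (allFin K) piece-bound)
        where
        f : Cube N → Cube N → Fin K → ℤ
        f x y m = δ (τ x y) m * (sign (out m) * χ x y)
        expand : ∑∑ N (λ x y → sign (out (τ x y)) * χ x y) ≡ ∑ (allFin K) piece
        expand = trans (∑∑-cong N (λ x y → sym (∑-δ (τ x y) (λ m → sign (out m) * χ x y))))
          (trans (∑-cong (cube N) (λ x → ∑-comm (cube N) (allFin K) (f x)))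
                 (∑-comm (cube N) (allFin K) (λ x m → ∑ (cube N) (λ y → f x y m))))

    -- With the seed fixed, the output is right at most K * 2^(3M) more often than wrong, on 2^(4M)
    -- inputs. If 3 * K < 2^M, this is less than the third that success with probability 2/3 demands
    -- on average. The whole seed may enter `τ` and `out`, so private coins need no separate
    -- treatment.
    ip-hard : ∀ {K R} → 0 ℕ.< R → 3 ℕ.* K ℕ.< 2 ℕ.^ M →
      (S : Cube N → Cube N → Subset R) → (∀ x y → 2 ℕ.* R ℕ.≤ 3 ℕ.* ∣ S x y ∣) →
      (τ : Fin R → Cube N → Cube N → Fin K) → (∀ r → Rectangular (τ r)) → (out : Fin R → Fin K → Bool) →
      ¬ (∀ x y r → r ∈ S x y → out r (τ r x y) ≡ ip x y)
    ip-hard {K} {R} 0<R small S likely τ rect out correct =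
      averaging (cartesianProduct (cube N) (cube N)) 0<R (λ p → S (proj₁ p) (proj₂ p))
          (λ p → likely (proj₁ p) (proj₂ p)) λ r →
        subst₂ _<_ (cong ((+ 3) *_) (sym (∑-× (cube N) (cube N) _))) (cong +_ (sym inputs))
          (≤-<-trans (*-monoˡ-≤-nonNeg (+ 3)
              (≤-trans (∑-mono (cube N) λ x → ∑-mono (cube N) (λ y → pointwise r x y))
              (correlation-bound (τ r) (rect r) (out r))))
            strict)
      where
      inputs : length (cartesianProduct (cube N) (cube N)) ≡ 2 ℕ.^ N ℕ.* 2 ℕ.^ N
      inputs = trans (length-cartesianProduct (cube N) (cube N)) (cong₂ ℕ._*_ (length-cube N) (length-cube N))
        where
        length-cartesianProduct : ∀ {B C : Set} (xs : List B) (ys : List C) → length (cartesianProduct xs ys) ≡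
            length xs ℕ.* length ys
        length-cartesianProduct []       ys = refl
        length-cartesianProduct (x ∷ xs) ys = trans (List.length-++ (map (x ,_) ys))
          (cong₂ ℕ._+_ (List.length-map _ ys) (length-cartesianProduct xs ys))
      -1≤ : ∀ a b → -1ℤ ≤ sign a * sign b
      -1≤ false false = -≤+
      -1≤ false true  = ≤-refl
      -1≤ true  false = ≤-refl
      -1≤ true  true  = -≤+
      pointwise : ∀ r x y → ±1 (Vec.lookup (S x y) r) ≤ sign (out r (τ r x y)) * χ x y
      pointwise r x y with Vec.lookup (S x y) r in eq
      ... | true  = ≤-reflexive (sym (trans
          (cong₂ _*_ (cong sign (correct x y r (lookup⇒[]= r (S x y) eq))) (sym (sign-ip x y))) (sign² (ip x y))))
      -- On a seed outside `S x y` the answer may be right by accident, so there is only an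
      -- inequality.
      ... | false = subst (λ z → -1ℤ ≤ sign (out r (τ r x y)) * z) (sign-ip x y) (-1≤ (out r (τ r x y)) (ip x y))
      strictℕ : 3 ℕ.* (K ℕ.* 2 ℕ.^ (M ℕ.+ N)) ℕ.< 2 ℕ.^ N ℕ.* 2 ℕ.^ N
      strictℕ = begin-strict
        3 ℕ.* (K ℕ.* 2 ℕ.^ (M ℕ.+ N))   ≡⟨ ℕ.*-assoc 3 K _ ⟨
        3 ℕ.* K ℕ.* 2 ℕ.^ (M ℕ.+ N)     <⟨ ℕ.*-monoˡ-< (2 ℕ.^ (M ℕ.+ N)) {{ℕ.m^n≢0 2 (M ℕ.+ N)}} small ⟩
        2 ℕ.^ M ℕ.* 2 ℕ.^ (M ℕ.+ N)     ≡⟨ ℕ.^-distribˡ-+-* 2 M (M ℕ.+ N) ⟨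
        2 ℕ.^ (M ℕ.+ (M ℕ.+ N))         ≡⟨ cong (2 ℕ.^_) (ℕ.+-assoc M M N) ⟨
        2 ℕ.^ (N ℕ.+ N)                 ≡⟨ ℕ.^-distribˡ-+-* 2 N N ⟩
        2 ℕ.^ N ℕ.* 2 ℕ.^ N             ∎
        where open ℕ.≤-Reasoning
      strict : (+ 3) * ((+ K) * Q) < + (2 ℕ.^ N ℕ.* 2 ℕ.^ N)
      strict = subst (_< _) (trans (pos-* 3 (K ℕ.* 2 ℕ.^ (M ℕ.+ N)))
          (cong ((+ 3) *_) (pos-* K (2 ℕ.^ (M ℕ.+ N))))) (+<+ strictℕ)

open import Data.Nat.Base using (_+_; _*_; _∸_; _^_; _⊓_; _≤_; _<_; z≤n; s≤s; ⌊_/2⌋; ⌈_/2⌉)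

-- Walks, loop erasure and hop distances

module Walks {n} (G : Graph n) where

  open Paths G
  open import Data.List.Membership.DecPropositional (Fin._≟_ {n}) using (_∈?_)
  open import Data.List.Relation.Unary.All.Properties using (¬Any⇒All¬)
  open import Data.List.Relation.Binary.Subset.Propositional using (_⊆_)

  adjacent-sym : ∀ {u v} → Adjacent u v → Adjacent v u
  adjacent-sym {u} {v} (w , e) = w , trans (Graph.sym G v u) e

  -- The inclusion of the edges keeps a shortened walk off the edge that has to be avoided.
  Shortcut : ∀ {u v} → Walk u v → ∀ {x} → Walk x v → Set
  Shortcut p q = Simple q × edges q ⊆ edges p × weight q ≤ weight p

  suffix : ∀ {u v x} (p : Walk u v) → Simple p → x List.∈ vertices p → Σ (Walk x v) (Shortcut p)
  suffix ε       s (here refl)  = ε , s , id , z≤n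
  suffix (a ◅ p) s (here refl)  = a ◅ p , s , id , ℕ.≤-refl
  suffix (a ◅ p) (_ ∷ s) (there x∈) with suffix p s x∈
  ... | q , s′ , sub , le = q , s′ , there ∘ sub , ℕ.≤-trans le (ℕ.m≤n+m _ (proj₁ a))

  -- Feasible paths are simple; thanks to loop erasure, detours can be constructed as arbitrary
  -- walks.
  erase-loops : ∀ {u v} (p : Walk u v) → Σ (Walk u v) (Shortcut p)
  erase-loops ε = ε , [] ∷ [] , id , z≤n
  erase-loops {u} (a ◅ p) with erase-loops p
  ... | q , s , sub , le with u ∈? vertices q
  ...   | no  u∉ = a ◅ q , ¬Any⇒All¬ _ u∉ ∷ s , (λ { (here e) → here e ; (there m) → there (sub m) })
                 , ℕ.+-monoʳ-≤ (proj₁ a) le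
  ...   | yes u∈ with suffix q s u∈
  ...     | q′ , s′ , sub′ , le′ = q′ , s′ , there ∘ sub ∘ sub′
                                 , ℕ.≤-trans le′ (ℕ.≤-trans le (ℕ.m≤n+m _ (proj₁ a)))

  Reach : ℕ → Fin n → Fin n → Set
  Reach k u v = Σ (Walk u v) λ p → hops p ≤ k

  reach-refl : ∀ {u} → Reach 0 u u
  reach-refl = ε , z≤n

  reach-mono : ∀ {j k u v} → j ≤ k → Reach j u v → Reach k u v
  reach-mono j≤k (p , h) = p , ℕ.≤-trans h j≤k

  reach-trans : ∀ {j k u v x} → Reach j u v → Reach k v x → Reach (j + k) u x
  reach-trans {j} {k} (ε     , _)     (q , h′) = q , ℕ.≤-trans h′ (ℕ.m≤n+m k j)
  reach-trans         (a ◅ p , s≤s h) (q , h′) with reach-trans (p , h) (q , h′)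
  ... | r , h″ = a ◅ r , s≤s h″

  reach-sym : ∀ {k u v} → Reach k u v → Reach k v u
  reach-sym (ε     , h)         = ε , h
  reach-sym {suc k} (a ◅ p , s≤s h) = reach-mono (ℕ.≤-reflexive (ℕ.+-comm k 1))
    (reach-trans (reach-sym (p , h)) (adjacent-sym a ◅ ε , s≤s z≤n))

  lipschitz : (φ : Fin n → ℕ) → (∀ {u v} → Adjacent u v → φ v ≤ suc (φ u)) →
              ∀ {u v} (p : Walk u v) → φ v ≤ hops p + φ u
  lipschitz φ step ε       = ℕ.≤-refl
  lipschitz φ step (a ◅ p) = ℕ.≤-trans (lipschitz φ step p)
    (ℕ.≤-trans (ℕ.+-monoʳ-≤ (hops p) (step a)) (ℕ.≤-reflexive (ℕ.+-suc (hops p) _)))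

-- Distinctions that survive approximation, and what correct outputs announce

record Criterion : Set₁ where
  field
    -- With `cheap-≤` and `cheap-approx`, an optimum and its approximation are both cheap or both
    -- not, whatever the factor. `weightless` serves the weighted bound, `finite` the diameter
    -- bound.
    Cheap        : ℕ → Set
    cheap-≤      : ∀ {w x} → w ≤ x → Cheap x → Cheap w
    cheap-approx : ∀ α {w x} → (ℤ.+ x ℚ./ 1) ℚ.≤ α ℚ.* (ℤ.+ w ℚ./ 1) → Cheap w → Cheap x

  Meets : ℕ∞ → Set
  Meets (fin w) = Cheap w
  Meets ∞       = ⊥

  acceptable⇒ : ∀ g opt x → Acceptable g opt x → Meets opt → Meets x
  acceptable⇒ exact        opt     .opt    refl    m = m
  acceptable⇒ (approx α _) (fin w) (fin x) (_ , h) m = cheap-approx α h m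

  acceptable⇐ : ∀ g opt x → Acceptable g opt x → Meets x → Meets opt
  acceptable⇐ exact        opt     .opt    refl    m = m
  acceptable⇐ (approx α _) (fin w) (fin x) (h , _) m = cheap-≤ h m

weightless : Criterion
weightless = record
  { Cheap        = _≡ 0
  ; cheap-≤      = λ { h refl → ℕ.n≤0⇒n≡0 h }
  ; cheap-approx = λ { α {x = x} h refl → zero-approx α x h }
  }
  where
  import Data.Rational.Properties as ℚ
  zero-approx : ∀ α x → (ℤ.+ x ℚ./ 1) ℚ.≤ α ℚ.* (ℤ.+ 0 ℚ./ 1) → x ≡ 0
  zero-approx α zero    h = refl
  zero-approx α (suc x) h = ⊥-elim (ℚ.<-irrefl refl (ℚ.<-≤-trans
    (ℚ.positive⁻¹ (ℤ.+ suc x ℚ./ 1) {{ℚ.normalize-pos (suc x) 1}}) (subst ((ℤ.+ suc x ℚ./ 1) ℚ.≤_) (ℚ.*-zeroʳ α) h)))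

finite : Criterion
finite = record
  { Cheap        = λ _ → ⊤
  ; cheap-≤      = λ _ _ → tt
  ; cheap-approx = λ _ _ _ → tt
  }

-- A path of one edge leaves a single edge to avoid, so that RPaths and 2-SiSP have the same
-- feasible paths, and h = 1 suffices in `WeightedClass`.
module EdgeInstance {n} (G : Graph n) (s t : Fin n) (s≢t : s ≢ t) {w₀} (st : edge G s t ≡ just w₀)
                    (light : ∀ (q : Paths.Walk G s t) → w₀ ≤ Paths.weight G q) where

  open Paths G

  edgeInstance : Instance n
  edgeInstance = record
    { graph    = G
    ; s        = s
    ; t        = t
    ; s≢t      = s≢t
    ; Pst      = (w₀ , st) ◅ ε
    ; simple   = (s≢t ∷ []) ∷ [] ∷ []
    ; shortest = λ q → ℕ.≤-trans (ℕ.≤-reflexive (ℕ.+-identityʳ w₀)) (light q)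
    }

query : ∀ Π {n} → Fin n → Fin n → Query Π n
query RPaths s t = s , t
query 2-SiSP s t = tt

module Reports (cr : Criterion) {n} {G : Graph n} {s t : Fin n} {s≢t : s ≢ t} {w₀} {st : edge G s t ≡ just w₀}
               {light : ∀ (q : Paths.Walk G s t) → w₀ ≤ Paths.weight G q}
               {Π : Problem} (g : Goal) {out : Fin n → NodeOutput Π n}
               (correct : Correct (EdgeInstance.edgeInstance G s t s≢t st light) Π g out) where

  open Criterion cr
  open Paths G
  open Walks G
  private I = EdgeInstance.edgeInstance G s t s≢t st light

  feasible⇒ : ∀ Π p → Feasible I Π (query Π s t) p → Avoids p (s , t)
  feasible⇒ RPaths p (_ , a)                   = a
  feasible⇒ 2-SiSP p (_ , _ , here refl , a)   = a

  feasible⇐ : ∀ Π p → Simple p → Avoids p (s , t) → Feasible I Π (query Π s t) p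
  feasible⇐ RPaths p sm a = sm , a
  feasible⇐ 2-SiSP p sm a = sm , _ , here refl , a

  asked : ∀ Π → Asked I Π (query Π s t)
  asked RPaths = here refl
  asked 2-SiSP = tt

  weight-report : ∀ g → Correct I Π g out → ReportsWeight I Π g out (query Π s t)
  weight-report exact        c = proj₁ (c (query Π s t) (asked Π))
  weight-report (approx _ _) c = c (query Π s t) (asked Π)

  optimum-cheap : ∀ opt → IsOptimum I Π (query Π s t) opt →
                  (p : Walk s t) → Avoids p (s , t) → Cheap (weight p) → Meets opt
  optimum-cheap opt isOpt p (a₁ , a₂) c with erase-loops p
  optimum-cheap (fin _) (p* , (_ , best) , refl) p (a₁ , a₂) c | q , sm , sub , le =
    cheap-≤ (ℕ.≤-trans (best q (feasible⇐ Π q sm (a₁ ∘ sub , a₂ ∘ sub))) le) c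
  optimum-cheap ∞ none p (a₁ , a₂) c | q , sm , sub , le =
    none q (feasible⇐ Π q sm (a₁ ∘ sub , a₂ ∘ sub))

  -- Here some node announces a cheap value; in `reports-costly` no node does. The lower bounds rest
  -- on this asymmetry.
  reports-cheap : (p : Walk s t) → Avoids p (s , t) → Cheap (weight p) →
                  ∃ λ v → ∃ λ x → report (out v) (query Π s t) ≡ just x × Meets x
  reports-cheap p a c with weight-report g correct
  ... | opt , isOpt , (v , x , r) , sound =
    v , x , r , acceptable⇒ g opt x (sound v x r) (optimum-cheap opt isOpt p a c)

  reports-costly : (∀ p → Avoids p (s , t) → ¬ Cheap (weight p)) →
                   ∀ v x → report (out v) (query Π s t) ≡ just x → ¬ Meets x
  reports-costly costly v x r m with weight-report g correct
  ... | opt , isOpt , _ , sound with opt | isOpt | acceptable⇐ g opt x (sound v x r) m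
  ...   | fin _ | p , (f , _) , refl | c = costly p (feasible⇒ Π p f) c

-- Locality of a round

view-cong : ∀ {n} (I I′ : Instance n) v → let open Instance in
  (∀ u → edge (graph I) v u ≡ edge (graph I′) v u) → s I ≡ s I′ → t I ≡ t I′ →
  vertices I (Pst I) ≡ vertices I′ (Pst I′) → view I v ≡ view I′ v
view-cong I I′ v same refl refl e = cong₂ (λ inc vs → mkView v inc _ _ vs) (tabulate-cong same) e
  where open import Data.Vec.Properties using (tabulate-cong)

state-step : ∀ {Π n B} (A : Algorithm Π n B) (I I′ : Instance n) r k v → let open Algorithm A in
  state A I r k v ≡ state A I′ r k v →
  (∀ u → edge (Instance.graph I) u v ≡ edge (Instance.graph I′) u v) →
  (∀ u w → edge (Instance.graph I) u v ≡ just w → send (state A I r k u) v ≡ send (state A I′ r k u) v) →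
  state A I r (suc k) v ≡ state A I′ r (suc k) v
state-step {n = n} A I I′ r k v same edges-same msgs = cong₂ receive same (tabulate-cong message)
  where
  open Algorithm A
  open import Data.Vec.Properties using (tabulate-cong)
  message : ∀ u → Maybe.map (λ _ → send (state A I r k u) v) (edge (Instance.graph I) u v)
                ≡ Maybe.map (λ _ → send (state A I′ r k u) v) (edge (Instance.graph I′) u v)
  message u rewrite sym (edges-same u) with edge (Instance.graph I) u v in e
  ... | nothing = refl
  ... | just w  = cong just (msgs u w e)

-- Graphs described by arcs

private variable P P′ : Set

when : Dec P → ℕ → Maybe ℕ
when p? w = if does p? then just w else nothing

when-elim : ∀ (p? : Dec P) {w x} → when p? w ≡ just x → P × w ≡ x
when-elim (yes p) e = p , just-injective e

when-intro : ∀ (p? : Dec P) {w} → P → when p? w ≡ just w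
when-intro (yes _) p = refl
when-intro (no ¬p) p = contradiction p ¬p

when-cong : ∀ (p? : Dec P) (p′? : Dec P′) {w} → (P → P′) → (P′ → P) → when p? w ≡ when p′? w
when-cong (yes p) p′?     f g = sym (when-intro p′? (f p))
when-cong (no ¬p) (yes p) f g = contradiction (g p) ¬p
when-cong (no _)  (no _)  f g = refl

-- Arcs are specified in one direction, and `merge` combines the two. The minimum makes the graph
-- symmetric and never exceeds the weight of a specified arc.
merge : Maybe ℕ → Maybe ℕ → Maybe ℕ
merge nothing  m        = m
merge (just a) nothing  = just a
merge (just a) (just b) = just (a ⊓ b)

merge-comm : ∀ m m′ → merge m m′ ≡ merge m′ m
merge-comm nothing  nothing  = refl
merge-comm nothing  (just _) = refl
merge-comm (just _) nothing  = refl
merge-comm (just a) (just b) = cong just (ℕ.⊓-comm a b)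

merge-elim : ∀ m m′ {w} → merge m m′ ≡ just w → m ≡ just w ⊎ m′ ≡ just w
merge-elim nothing  m′       e = inj₂ e
merge-elim (just a) nothing  e = inj₁ e
merge-elim (just a) (just b) e with ℕ.⊓-sel a b
... | inj₁ a⊓b≡a = inj₁ (trans (cong just (sym a⊓b≡a)) e)
... | inj₂ a⊓b≡b = inj₂ (trans (cong just (sym a⊓b≡b)) e)

merge-intro : ∀ m m′ {w} → m ≡ just w → ∃ λ w′ → merge m m′ ≡ just w′ × w′ ≤ w
merge-intro (just a) nothing  refl = a , refl , ℕ.≤-refl
merge-intro (just a) (just b) refl = a ⊓ b , refl , ℕ.m⊓n≤m a b

-- Loops are dropped, so that the root of a tree may be its own parent.
module Net {n} {V : Set} (iso : Fin n ↔ V) (f : V → V → Maybe ℕ) where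

  at : Fin n → V
  at = Inverse.to iso

  node : V → Fin n
  node = Inverse.from iso

  at-node : ∀ a → at (node a) ≡ a
  at-node = Inverse.strictlyInverseˡ iso

  node-at : ∀ u → node (at u) ≡ u
  node-at = Inverse.strictlyInverseʳ iso

  node-injective : ∀ {a b} → node a ≡ node b → a ≡ b
  node-injective {a} {b} e = trans (sym (at-node a)) (trans (cong at e) (at-node b))

  link : Fin n → Fin n → Maybe ℕ
  link u v with u Fin.≟ v
  ... | yes _ = nothing
  ... | no  _ = merge (f (at u) (at v)) (f (at v) (at u))

  link-sym : ∀ u v → link u v ≡ link v u
  link-sym u v with u Fin.≟ v | v Fin.≟ u
  ... | yes _ | yes _ = refl
  ... | yes e | no ¬e = contradiction (sym e) ¬e
  ... | no ¬e | yes e = contradiction (sym e) ¬e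
  ... | no  _ | no  _ = merge-comm (f (at u) (at v)) _

  link-irrefl : ∀ v → link v v ≡ nothing
  link-irrefl v with v Fin.≟ v
  ... | yes _ = refl
  ... | no ¬e = contradiction refl ¬e

  net : Graph n
  net = record { edge = link ; sym = link-sym ; irrefl = link-irrefl }

  link⇒arc : ∀ u v {w} → link u v ≡ just w → f (at u) (at v) ≡ just w ⊎ f (at v) (at u) ≡ just w
  link⇒arc u v e with u Fin.≟ v
  ... | no _ = merge-elim (f (at u) (at v)) _ e

  arc⇒link : ∀ {a b w} → f a b ≡ just w → a ≢ b → ∃ λ w′ → link (node a) (node b) ≡ just w′ × w′ ≤ w
  arc⇒link {a} {b} e a≢b with node a Fin.≟ node b
  ... | yes e′ = contradiction (node-injective e′) a≢b
  ... | no  _  rewrite at-node a | at-node b = merge-intro (f a b) (f b a) e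

  open Walks net

  -- A loop is no edge, but its two ends coincide, so the empty walk serves.
  arc⇒reach : ∀ {a b w} → f a b ≡ just w → Reach 1 (node a) (node b)
  arc⇒reach {a} {b} e with node a Fin.≟ node b
  ... | yes e′ = subst (Reach 1 (node a)) e′ (reach-mono z≤n reach-refl)
  ... | no  ne with arc⇒link e (λ a≡b → ne (cong node a≡b))
  ...   | w′ , e′ , _ = (w′ , e′) ◅ ε , s≤s z≤n

link-cong : ∀ {n} {V : Set} (iso : Fin n ↔ V) {f f′ : V → V → Maybe ℕ} {u v} → let a = Inverse.to iso u ; b = Inverse.to iso v in
            f a b ≡ f′ a b → f b a ≡ f′ b a → Net.link iso f u v ≡ Net.link iso f′ u v
link-cong iso {u = u} {v} e e′ with u Fin.≟ v
... | yes _ = refl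
... | no  _ = cong₂ merge e e′

-- Adjusting the diameter and the number of nodes

-- Two paths with ⌊D/2⌋ and ⌈D/2⌉ nodes are attached to the roots of a core of small depth, which makes
-- the diameter exactly D; all remaining nodes are leaves at the roots.
module Tails {C : Set} {n q} (iso : Fin n ↔ (C ⊎ Fin q)) (core : C → C → Maybe ℕ) (isRoot : C → Bool) (D : ℕ) where

  open import Data.Bool.Properties using () renaming (_≟_ to _≟ᵇ_)
  open import Relation.Nullary.Decidable using (_×-dec_; _⊎-dec_; ¬?)

  h : ℕ
  h = ⌊ D /2⌋

  -- The extra nodes 0, ..., h - 1 form one tail, h, ..., D - 1 the other, and those from D on are
  -- the leaves; the heads of the tails and the leaves are the ones next to a root.
  Attached : Fin q → Set
  Attached j = toℕ j ≡ 0 ⊎ toℕ j ≡ h ⊎ D ≤ toℕ j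

  attached? : ∀ j → Dec (Attached j)
  attached? j = (toℕ j ℕ.≟ 0) ⊎-dec ((toℕ j ℕ.≟ h) ⊎-dec (D ℕ.≤? toℕ j))

  Next : Fin q → Fin q → Set
  Next i j = toℕ j ≡ suc (toℕ i) × toℕ j ≢ h × toℕ j < D

  next? : ∀ i j → Dec (Next i j)
  next? i j = (toℕ j ℕ.≟ suc (toℕ i)) ×-dec (¬? (toℕ j ℕ.≟ h) ×-dec (toℕ j ℕ.<? D))

  arc : C ⊎ Fin q → C ⊎ Fin q → Maybe ℕ
  arc (inj₁ a) (inj₁ b) = core a b
  arc (inj₁ a) (inj₂ j) = when ((isRoot a ≟ᵇ true) ×-dec attached? j) 1
  arc (inj₂ _) (inj₁ _) = nothing
  arc (inj₂ i) (inj₂ j) = when (next? i j) 1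

  attached-elim : ∀ a j {w} → arc (inj₁ a) (inj₂ j) ≡ just w → isRoot a ≡ true × Attached j × 1 ≡ w
  attached-elim a j e with when-elim ((isRoot a ≟ᵇ true) ×-dec attached? j) e
  ... | (r , x) , w = r , x , w

  open Net iso arc public
  open Walks net

  module Depths (root : C) (isRoot-root : isRoot root ≡ true) (D≤q : D ≤ q) (2≤D : 2 ≤ D)
                {e} (e≤h : e ≤ h) (depth : ∀ c → Reach e (node (inj₁ root)) (node (inj₁ c))) where

    open Paths net using (HasDiameter; Adjacent)

    private
      R : Fin n
      R = node (inj₁ root)

    1≤h : 1 ≤ h
    1≤h = ℕ.⌊n/2⌋-mono 2≤D

    h≤D : h ≤ D
    h≤D = ℕ.⌊n/2⌋≤n D

    h+h≤D : h + h ≤ D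
    h+h≤D = ℕ.≤-trans (ℕ.+-monoʳ-≤ h (ℕ.⌊n/2⌋≤⌈n/2⌉ D)) (ℕ.≤-reflexive (ℕ.⌊n/2⌋+⌈n/2⌉≡n D))

    h<D : h < D
    h<D = ℕ.≤-trans (ℕ.+-monoˡ-≤ h 1≤h) h+h≤D

    D≤1+h+h : D ≤ suc (h + h)
    D≤1+h+h = ℕ.≤-trans (ℕ.≤-reflexive (sym (ℕ.⌊n/2⌋+⌈n/2⌉≡n D)))
      (ℕ.≤-trans (ℕ.+-monoʳ-≤ h (ceil D)) (ℕ.≤-reflexive (ℕ.+-suc h h)))
      where
      ceil : ∀ m → ⌈ m /2⌉ ≤ suc ⌊ m /2⌋
      ceil zero          = z≤n
      ceil (suc zero)    = s≤s z≤n
      ceil (suc (suc m)) = s≤s (ceil m)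

    first : ∀ j → Attached j → Reach 1 R (node (inj₂ j))
    first j a = arc⇒reach (when-intro ((isRoot root ≟ᵇ true) ×-dec attached? j) (isRoot-root , a))

    next : ∀ i j → Next i j → Reach 1 (node (inj₂ i)) (node (inj₂ j))
    next i j x = arc⇒reach (when-intro (next? i j) x)

    tail₁ : ∀ k j → toℕ j ≡ k → k < h → Reach (suc k) R (node (inj₂ j))
    tail₁ zero    j e k<h = first j (inj₁ e)
    tail₁ (suc k) j e k<h = reach-mono (ℕ.≤-reflexive (ℕ.+-comm (suc k) 1))
      (reach-trans (tail₁ k i i≡k (ℕ.<-trans (ℕ.n<1+n k) k<h))
        (next i j (trans e (cong suc (sym i≡k)) , (λ j≡h → ℕ.<-irrefl (trans (sym e) j≡h) k<h)
                  , subst (_< D) (sym e) (ℕ.<-≤-trans k<h h≤D))))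
      where
      k<q : k < q
      k<q = ℕ.<-trans (ℕ.n<1+n k) (subst (_< q) e (Fin.toℕ<n j))
      i : Fin q
      i = fromℕ< k<q
      i≡k : toℕ i ≡ k
      i≡k = Fin.toℕ-fromℕ< k<q

    tail₂ : ∀ k j → toℕ j ≡ k + h → k + h < D → Reach (suc k) R (node (inj₂ j))
    tail₂ zero    j e k<D = first j (inj₂ (inj₁ e))
    tail₂ (suc k) j e k<D = reach-mono (ℕ.≤-reflexive (ℕ.+-comm (suc k) 1))
      (reach-trans (tail₂ k i i≡k (ℕ.<-trans (ℕ.n<1+n _) k<D))
        (next i j (trans e (cong suc (sym i≡k)) , (λ j≡h → ℕ.m≢1+n+m h (sym (trans (sym e) j≡h)))
                  , subst (_< D) (sym e) k<D)))
      where
      k<q : k + h < q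
      k<q = ℕ.<-trans (ℕ.n<1+n _) (subst (_< q) e (Fin.toℕ<n j))
      i : Fin q
      i = fromℕ< k<q
      i≡k : toℕ i ≡ k + h
      i≡k = Fin.toℕ-fromℕ< k<q

    -- For odd D the end of the second tail is h + 1 hops from the root. It is the only node that
    -- far, so that two nodes are still within D hops: h + (D - h) if just one of them is this end,
    -- and 0 if both are.
    Shallow Deepest : C ⊎ Fin q → Set
    Shallow a = Reach h R (node a)
    Deepest a = Reach (D ∸ h) R (node a) × ∃ λ j → a ≡ inj₂ j × suc (toℕ j) ≡ D

    classify : ∀ a → Shallow a ⊎ Deepest a
    classify (inj₁ c) = inj₁ (reach-mono e≤h (depth c))
    classify (inj₂ j) with toℕ j ℕ.<? h | toℕ j ℕ.<? D
    ... | yes j<h | _       = inj₁ (reach-mono j<h (tail₁ (toℕ j) j refl j<h))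
    ... | no  _   | no  j≮D = inj₁ (reach-mono 1≤h (first j (inj₂ (inj₂ (ℕ.≮⇒≥ j≮D)))))
    ... | no  j≮h | yes j<D with suc (toℕ j) ℕ.≟ D
    ...   | yes j+1≡D = inj₂ (reach-mono (ℕ.≤-reflexive (trans (sym (ℕ.+-∸-assoc 1 h≤j)) (cong (_∸ h) j+1≡D)))
        r , j , refl , j+1≡D)
      where
      h≤j = ℕ.≮⇒≥ j≮h
      j≡ : toℕ j ∸ h + h ≡ toℕ j
      j≡ = ℕ.m∸n+n≡m h≤j
      r : Reach (suc (toℕ j ∸ h)) R (node (inj₂ j))
      r = tail₂ (toℕ j ∸ h) j (sym j≡) (subst (_< D) (sym j≡) j<D)
    ...   | no  j+1≢D = inj₁ (reach-mono short r)
      where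
      h≤j = ℕ.≮⇒≥ j≮h
      j≡ : toℕ j ∸ h + h ≡ toℕ j
      j≡ = ℕ.m∸n+n≡m h≤j
      r : Reach (suc (toℕ j ∸ h)) R (node (inj₂ j))
      r = tail₂ (toℕ j ∸ h) j (sym j≡) (subst (_< D) (sym j≡) j<D)
      short : suc (toℕ j ∸ h) ≤ h
      short = ℕ.+-cancelʳ-≤ h _ _ (subst (_≤ h + h) (cong suc (sym j≡))
          (ℕ.s≤s⁻¹ (ℕ.≤-trans (ℕ.≤∧≢⇒< j<D j+1≢D) D≤1+h+h)))

    upper : ∀ a b → Reach D (node a) (node b)
    upper a b with classify a | classify b
    ... | inj₁ r | inj₁ r′ = reach-mono h+h≤D (reach-trans (reach-sym r) r′)
    ... | inj₁ r | inj₂ (r′ , _) = reach-mono (ℕ.≤-reflexive (ℕ.m+[n∸m]≡n h≤D)) (reach-trans (reach-sym r) r′)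
    ... | inj₂ (r , _) | inj₁ r′ = reach-mono (ℕ.≤-reflexive (ℕ.m∸n+n≡m h≤D)) (reach-trans (reach-sym r) r′)
    ... | inj₂ (_ , i , refl , i+1) | inj₂ (_ , j , refl , j+1) =
      subst (λ k → Reach D (node (inj₂ i)) (node (inj₂ k)))
            (Fin.toℕ-injective (ℕ.suc-injective (trans i+1 (sym j+1)))) (reach-mono z≤n reach-refl)

    -- The signed position along the two tails, with the core at position h.
    ψ : ℕ → ℕ
    ψ k with k ℕ.<? h | k ℕ.<? D
    ... | yes _ | _     = h ∸ suc k
    ... | no  _ | yes _ = suc k
    ... | no  _ | no  _ = h

    ψ-left : ∀ {k} → k < h → ψ k ≡ h ∸ suc k
    ψ-left {k} k<h with k ℕ.<? h | k ℕ.<? D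
    ... | yes _ | _ = refl
    ... | no ¬p | _ = contradiction k<h ¬p

    ψ-right : ∀ {k} → h ≤ k → k < D → ψ k ≡ suc k
    ψ-right {k} h≤k k<D with k ℕ.<? h | k ℕ.<? D
    ... | yes p | _     = contradiction p (ℕ.≤⇒≯ h≤k)
    ... | no  _ | yes _ = refl
    ... | no  _ | no ¬p = contradiction k<D ¬p

    ψ-pad : ∀ {k} → D ≤ k → ψ k ≡ h
    ψ-pad {k} D≤k with k ℕ.<? h | k ℕ.<? D
    ... | yes p | _     = contradiction (ℕ.<-≤-trans p h≤D) (ℕ.≤⇒≯ D≤k)
    ... | no  _ | yes p = contradiction p (ℕ.≤⇒≯ D≤k)
    ... | no  _ | no  _ = refl

    position : C ⊎ Fin q → ℕ
    position (inj₁ _) = h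
    position (inj₂ j) = ψ (toℕ j)

    Close : ℕ → ℕ → Set
    Close x y = x ≤ suc y × y ≤ suc x

    close-next : ∀ {k} → suc k ≢ h → suc k < D → Close (ψ k) (ψ (suc k))
    close-next {k} k+1≢h k+1<D with ℕ.<-≤-connex (suc k) h
    ... | inj₁ k+1<h rewrite ψ-left k+1<h | ψ-left (ℕ.<-trans (ℕ.n<1+n k) k+1<h) =
      ℕ.≤-reflexive (ℕ.+-∸-assoc 1 k+1<h) , ℕ.≤-trans (ℕ.∸-monoʳ-≤ h (ℕ.n≤1+n (suc k))) (ℕ.n≤1+n _)
    ... | inj₂ h≤k+1 rewrite ψ-right h≤k+1 k+1<D
                           | ψ-right (ℕ.s≤s⁻¹ (ℕ.≤∧≢⇒< h≤k+1 (λ e → k+1≢h (sym e)))) (ℕ.<-trans (ℕ.n<1+n k) k+1<D) =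
      ℕ.≤-trans (ℕ.n≤1+n _) (ℕ.n≤1+n _) , ℕ.≤-refl

    close-arc : ∀ a b {w} → arc a b ≡ just w → Close (position a) (position b)
    close-arc (inj₁ a) (inj₁ b) _ = ℕ.n≤1+n h , ℕ.n≤1+n h
    close-arc (inj₁ a) (inj₂ j) e with proj₁ (proj₂ (attached-elim a j e))
    ... | inj₁ j≡0 rewrite j≡0 | ψ-left 1≤h =
      ℕ.≤-reflexive (sym (ℕ.m+[n∸m]≡n 1≤h)) , ℕ.≤-trans (ℕ.m∸n≤m h 1) (ℕ.n≤1+n h)
    ... | inj₂ (inj₁ j≡h) rewrite j≡h | ψ-right ℕ.≤-refl h<D =
      ℕ.≤-trans (ℕ.n≤1+n h) (ℕ.n≤1+n _) , ℕ.≤-refl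
    ... | inj₂ (inj₂ D≤j) rewrite ψ-pad D≤j = ℕ.n≤1+n h , ℕ.n≤1+n h
    close-arc (inj₂ i) (inj₂ j) e with when-elim (next? i j) e
    ... | (j≡ , j≢h , j<D) , _ rewrite j≡ = close-next j≢h j<D

    diameter : HasDiameter D
    diameter = (λ u v → subst₂ (Reach D) (node-at u) (node-at v) (upper (at u) (at v)))
             -- The ends of the two tails have positions 0 and `D`, and an edge changes the position
             -- by at most one.
             , node (inj₂ left) , node (inj₂ right) , λ p →
                 subst₂ _≤_ at-right (trans (cong (λ x → Paths.hops net p + x) at-left) (ℕ.+-identityʳ _))
                   (lipschitz (position ∘ at) step p)
      where
      step : ∀ {u v} → Adjacent u v → position (at v) ≤ suc (position (at u))
      step {u} {v} (_ , e) with link⇒arc u v e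
      ... | inj₁ e′ = proj₂ (close-arc (at u) (at v) e′)
      ... | inj₂ e′ = proj₁ (close-arc (at v) (at u) e′)
      h∸1<q : h ∸ 1 < q
      h∸1<q = ℕ.<-≤-trans (ℕ.≤-<-trans (ℕ.m∸n≤m h 1) h<D) D≤q
      D∸1<D : D ∸ 1 < D
      D∸1<D = ℕ.≤-reflexive (ℕ.m+[n∸m]≡n (ℕ.≤-trans (s≤s z≤n) 2≤D))
      left right : Fin q
      left  = fromℕ< h∸1<q
      right = fromℕ< (ℕ.<-≤-trans D∸1<D D≤q)
      1+[h∸1]≡h : suc (h ∸ 1) ≡ h
      1+[h∸1]≡h = ℕ.m+[n∸m]≡n 1≤h
      at-left : position (at (node (inj₂ left))) ≡ 0
      at-left rewrite at-node (inj₂ left) | Fin.toℕ-fromℕ< h∸1<q | ψ-left {h ∸ 1} (ℕ.≤-reflexive 1+[h∸1]≡h) |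
          1+[h∸1]≡h = ℕ.n∸n≡0 h
      at-right : position (at (node (inj₂ right))) ≡ D
      at-right rewrite at-node (inj₂ right) | Fin.toℕ-fromℕ< (ℕ.<-≤-trans D∸1<D D≤q)
                     | ψ-right {D ∸ 1} (ℕ.s≤s⁻¹ (ℕ.≤-trans h<D
                         (ℕ.≤-reflexive (sym (ℕ.m+[n∸m]≡n (ℕ.≤-trans (s≤s z≤n) 2≤D)))))) D∸1<D = ℕ.m+[n∸m]≡n
                         (ℕ.≤-trans (s≤s z≤n) 2≤D)

-- Detours that avoid the given edge

module Detours (cr : Criterion) {n} (G : Graph n) (s t : Fin n) where

  open Criterion cr
  open Paths G

  Other : Fin n → Fin n → Set
  Other u v = ((s , t) ≢ (u , v)) × ((t , s) ≢ (u , v))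

  avoids-cons : ∀ {u v x} (a : Adjacent u v) {p : Walk v x} → Other u v → Avoids p (s , t) → Avoids (a ◅ p) (s , t)
  avoids-cons a (o₁ , o₂) (a₁ , a₂) = (λ { (here e) → o₁ e ; (there m) → a₁ m })
                                    , (λ { (here e) → o₂ e ; (there m) → a₂ m })

  -- A certificate against cheap detours: a set that contains s, misses t and is left by no cheap
  -- edge other than {s, t}. Weights add up, so every edge of a cheap walk is cheap.
  invariant : (S : Fin n → Set) →
    (∀ {u v w} → edge G u v ≡ just w → Cheap w → Other u v → S u → S v) →
    ∀ {u v} (p : Walk u v) → Avoids p (s , t) → Cheap (weight p) → S u → S v
  invariant S step ε _ _ su = su
  invariant S step ((w , e) ◅ p) (a₁ , a₂) c su =
    invariant S step p (a₁ ∘ there , a₂ ∘ there) (cheap-≤ (ℕ.m≤n+m _ w) c)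
      (step e (cheap-≤ (ℕ.m≤m+n w _) c) ((λ e → a₁ (here e)) , (λ e → a₂ (here e))) su)

-- The diameter bound on a cycle

-- The cycle 0, 1, …, m with the given path {0, m}. An instance lacks the edge {ρ, ρ + 1}, where ρ ≡ m stands for
-- the full cycle. In T rounds a node learns about at most one of the edges at g, 2g and 3g.
module Cycle (D m : ℕ) (2≤m : 2 ≤ m) (m+m≤D : m + m ≤ D) {n q} (iso : Fin n ↔ (Fin (suc m) ⊎ Fin q)) (D≤q : D ≤ q) where

  open import Relation.Nullary.Decidable using (_×-dec_; _⊎-dec_; ¬?)

  1≤m : 1 ≤ m
  1≤m = ℕ.<⇒≤ 2≤m

  C : Set
  C = Fin (suc m)

  Arc : ℕ → C → C → Set
  Arc ρ a b = (toℕ b ≡ suc (toℕ a) × toℕ a ≢ ρ) ⊎ (toℕ a ≡ 0 × toℕ b ≡ m)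

  arc? : ∀ ρ a b → Dec (Arc ρ a b)
  arc? ρ a b = ((toℕ b ℕ.≟ suc (toℕ a)) ×-dec ¬? (toℕ a ℕ.≟ ρ)) ⊎-dec ((toℕ a ℕ.≟ 0) ×-dec (toℕ b ℕ.≟ m))

  core : ℕ → C → C → Maybe ℕ
  core ρ a b = when (arc? ρ a b) 1

  isRoot : C → Bool
  isRoot zero    = true
  isRoot (suc _) = false

  isRoot⇒0 : ∀ a → isRoot a ≡ true → toℕ a ≡ 0
  isRoot⇒0 zero _ = refl

  last : C
  last = fromℕ m

  toℕ-last : toℕ last ≡ m
  toℕ-last = Fin.toℕ-fromℕ m

  inj₁-index : ∀ {a b : C} → _≡_ {A = C ⊎ Fin q} (inj₁ a) (inj₁ b) → toℕ a ≡ toℕ b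
  inj₁-index refl = refl

  module _ (ρ : ℕ) where

    open Tails iso (core ρ) isRoot D
    open Walks net
    open Paths net

    root t : Fin n
    root = node (inj₁ zero)
    t    = node (inj₁ last)

    arc-weight : ∀ a b {w} → arc a b ≡ just w → w ≡ 1
    arc-weight (inj₁ a) (inj₁ b) e = sym (proj₂ (when-elim (arc? ρ a b) e))
    arc-weight (inj₁ a) (inj₂ j) e = sym (proj₂ (proj₂ (attached-elim a j e)))
    arc-weight (inj₂ i) (inj₂ j) e = sym (proj₂ (when-elim (next? i j) e))

    unweighted : Unweighted net
    unweighted u v w e with link⇒arc u v e
    ... | inj₁ e′ = arc-weight (at u) (at v) e′
    ... | inj₂ e′ = arc-weight (at v) (at u) e′

    arc-adjacent : ∀ {a b} → Arc ρ a b → toℕ a ≢ toℕ b → edge net (node (inj₁ a)) (node (inj₁ b)) ≡ just 1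
    arc-adjacent {a} {b} x a≢b with arc⇒link {inj₁ a} {inj₁ b} (when-intro (arc? ρ a b) x) (λ { refl → a≢b refl })
    ... | w , e , _ = trans e (cong just (unweighted (node (inj₁ a)) (node (inj₁ b)) w e))

    up : ∀ k j → toℕ j ≡ k → k ≤ ρ → Reach k root (node (inj₁ j))
    up zero    zero    e k≤ρ = reach-refl
    up (suc k) (suc i) e k<ρ = reach-mono (ℕ.≤-reflexive (ℕ.+-comm k 1))
      (reach-trans (up k (inject₁ i) i≡k (ℕ.<⇒≤ k<ρ))
        (arc⇒reach (when-intro (arc? ρ (inject₁ i) (suc i))
          (inj₁ (cong suc (sym (Fin.toℕ-inject₁ i)) , λ i≡ρ → ℕ.<-irrefl (trans (sym i≡k) i≡ρ) k<ρ)))))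
      where
      i≡k : toℕ (inject₁ i) ≡ k
      i≡k = trans (Fin.toℕ-inject₁ i) (ℕ.suc-injective e)

    -- Nodes beyond the missing edge are reached from the other side, through the edge {0, m}.
    down : ∀ i j → toℕ j + i ≡ m → ρ < toℕ j → Reach (suc i) root (node (inj₁ j))
    down zero    j e ρ<j = arc⇒reach (when-intro (arc? ρ zero j) (inj₂ (refl , trans (sym (ℕ.+-identityʳ _)) e)))
    down (suc i) j e ρ<j = reach-mono (ℕ.≤-reflexive (ℕ.+-comm (suc i) 1))
      (reach-trans (down i j′ (trans (cong (_+ i) j′≡) (trans (sym (ℕ.+-suc (toℕ j) i)) e))
          (subst (ρ <_) (sym j′≡) (ℕ.m<n⇒m<1+n ρ<j)))
        (reach-sym (arc⇒reach (when-intro (arc? ρ j j′) (inj₁ (j′≡ , λ j≡ρ → ℕ.<-irrefl (sym j≡ρ) ρ<j))))))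
      where
      j<m : suc (toℕ j) < suc m
      j<m = s≤s (subst (suc (toℕ j) ≤_) e
          (subst (_≤ toℕ j + suc i) (ℕ.+-comm (toℕ j) 1) (ℕ.+-monoʳ-≤ (toℕ j) (s≤s z≤n))))
      j′ : C
      j′ = fromℕ< j<m
      j′≡ : toℕ j′ ≡ suc (toℕ j)
      j′≡ = Fin.toℕ-fromℕ< j<m

    depth : ∀ c → Reach m root (node (inj₁ c))
    depth c with toℕ c ℕ.≤? ρ
    ... | yes c≤ρ = reach-mono (ℕ.s≤s⁻¹ (Fin.toℕ<n c)) (up (toℕ c) c refl c≤ρ)
    -- Since `c` is not 0, the extra hop over {0, m} still leaves at most `m` hops.
    ... | no  c≰ρ = reach-mono (ℕ.∸-monoʳ-< {m} (ℕ.≤-<-trans z≤n ρ<c) c≤m) (down (m ∸ toℕ c) c (ℕ.m+[n∸m]≡n c≤m) ρ<c)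
      where
      ρ<c = ℕ.≰⇒> c≰ρ
      c≤m = ℕ.s≤s⁻¹ (Fin.toℕ<n c)

    m≤h : m ≤ h
    m≤h = subst (_≤ h) (sym (ℕ.n≡⌊n+n/2⌋ m)) (ℕ.⌊n/2⌋-mono m+m≤D)

    diameter : HasDiameter D
    diameter = Depths.diameter zero refl D≤q (ℕ.≤-trans (ℕ.+-mono-≤ 1≤m 1≤m) m+m≤D) m≤h depth

    0≢last : 0 ≢ toℕ last
    0≢last e = ℕ.<-irrefl (trans e toℕ-last) 1≤m

    root≢t : root ≢ t
    root≢t e = 0≢last (inj₁-index (node-injective {inj₁ zero} {inj₁ last} e))

    rt : edge net root t ≡ just 1
    rt = arc-adjacent (inj₂ (refl , toℕ-last)) 0≢last

    light : ∀ {u v} → u ≢ v → (p : Walk u v) → 1 ≤ weight p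
    light u≢v ε             = contradiction refl u≢v
    light {u} u≢v (_◅_ {j = j} (w , e) p) = ℕ.≤-trans (ℕ.≤-reflexive (sym (unweighted u j w e))) (ℕ.m≤m+n w _)

    inst : Instance n
    inst = EdgeInstance.edgeInstance net root t root≢t rt (light root≢t)

    open Detours finite net root t

    other : ∀ {a b} → toℕ b ≡ suc (toℕ a) → Other (node (inj₁ a)) (node (inj₁ b))
    other {a} {b} e =
        (λ x → ℕ.<-irrefl (sym (trans (sym toℕ-last)
            (trans (position (cong proj₂ x)) (trans e (cong suc (sym (position (cong proj₁ x)))))))) 2≤m)
      , (λ x → ℕ.0≢1+n (trans (position (cong proj₂ x)) e))
      where
      position : ∀ {a b : C} → node (inj₁ a) ≡ node (inj₁ b) → toℕ a ≡ toℕ b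
      position {a} {b} x = inj₁-index (node-injective {inj₁ a} {inj₁ b} x)

    full⇒detour : ρ ≡ m → Σ (Walk root t) λ p → Avoids p (root , t)
    full⇒detour ρ≡m = go m zero refl
      where
      go : ∀ i j → toℕ j + i ≡ m → Σ (Walk (node (inj₁ j)) t) λ p → Avoids p (root , t)
      go zero    j e with Fin.toℕ-injective (trans (trans (sym (ℕ.+-identityʳ (toℕ j))) e) (sym toℕ-last))
      ... | refl = ε , (λ ()) , (λ ())
      go (suc i) j e = a ◅ proj₁ rest , avoids-cons a (other {j} {j′} j′≡) (proj₂ rest)
        where
        j<m : suc (toℕ j) < suc m
        j<m = s≤s (subst (suc (toℕ j) ≤_) e
            (subst (_≤ toℕ j + suc i) (ℕ.+-comm (toℕ j) 1) (ℕ.+-monoʳ-≤ (toℕ j) (s≤s z≤n))))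
        j′ : C
        j′ = fromℕ< j<m
        j′≡ : toℕ j′ ≡ suc (toℕ j)
        j′≡ = Fin.toℕ-fromℕ< j<m
        j≢ρ : toℕ j ≢ ρ
        j≢ρ j≡ρ = ℕ.<-irrefl (trans j≡ρ ρ≡m) (ℕ.s≤s⁻¹ j<m)
        a : Adjacent (node (inj₁ j)) (node (inj₁ j′))
        a = 1 , arc-adjacent (inj₁ (j′≡ , j≢ρ)) (λ x → ℕ.1+n≢n (trans (sym j′≡) (sym x)))
        rest = go i j′ (trans (cong (_+ i) j′≡) (trans (sym (ℕ.+-suc (toℕ j) i)) e))

    -- The component of `root` without {0, m} and {ρ, ρ + 1}: the indices up to the missing edge,
    -- and all extra nodes, which hang at node 0.
    Near : C ⊎ Fin q → Set
    Near (inj₁ a) = toℕ a ≤ ρ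
    Near (inj₂ _) = ⊤

    near-arc : ∀ a b {w} → arc a b ≡ just w → (a ≢ inj₁ zero ⊎ b ≢ inj₁ last) → (Near a → Near b) × (Near b → Near a)
    near-arc (inj₁ a) (inj₁ b) e ≢st with proj₁ (when-elim (arc? ρ a b) e)
    ... | inj₁ (b≡ , a≢ρ) = (λ a≤ρ → subst (_≤ ρ) (sym b≡) (ℕ.≤∧≢⇒< a≤ρ a≢ρ)) , (λ b≤ρ → ℕ.<⇒≤ (subst (_≤ ρ) b≡ b≤ρ))
    ... | inj₂ (a≡0 , b≡m) = contradiction ≢st λ where
      (inj₁ ne) → ne (cong inj₁ (Fin.toℕ-injective a≡0))
      (inj₂ ne) → ne (cong inj₁ (Fin.toℕ-injective (trans b≡m (sym toℕ-last))))
    near-arc (inj₁ a) (inj₂ j) e _ = (λ _ → tt)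
      , (λ _ → subst (_≤ ρ) (sym (isRoot⇒0 a (proj₁ (attached-elim a j e)))) z≤n)
    near-arc (inj₂ i) (inj₂ j) e _ = (λ _ → tt) , (λ _ → tt)

    cut⇒¬detour : ρ < m → ∀ (p : Walk root t) → ¬ Avoids p (root , t)
    cut⇒¬detour ρ<m p a = contradiction
      (subst Near (at-node (inj₁ last))
          (invariant (Near ∘ at) step p a tt (subst Near (sym (at-node (inj₁ zero))) z≤n)))
      (λ last≤ρ → ℕ.<⇒≱ ρ<m (subst (_≤ ρ) toℕ-last last≤ρ))
      where
      is-node : ∀ {u a} → at u ≡ a → node a ≡ u
      is-node {u} refl = node-at u
      ends : ∀ {u v} → ((root , t) ≢ (u , v)) → at u ≢ inj₁ zero ⊎ at v ≢ inj₁ last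
      ends {u} {v} ne with root Fin.≟ u | t Fin.≟ v
      ... | no ne′  | _       = inj₁ (λ e → ne′ (is-node e))
      ... | yes _   | no ne′  = inj₂ (λ e → ne′ (is-node e))
      ... | yes e   | yes e′  = contradiction (cong₂ _,_ e e′) ne
      step : ∀ {u v w} → edge net u v ≡ just w → ⊤ → Other u v → Near (at u) → Near (at v)
      step {u} {v} e _ (o₁ , o₂) with link⇒arc u v e
      ... | inj₁ e′ = proj₁ (near-arc (at u) (at v) e′ (ends o₁))
      ... | inj₂ e′ = proj₂ (near-arc (at v) (at u) e′ (ends (λ x → o₂ (cong (λ { (a , b) → b , a }) x))))

  -- More than `k` hops from both ends of the missing edge. The way around through {0, m} is too
  -- long to matter when `k ≤ ρ` and `ρ + k < m`, as `same-state` assumes; then all extra nodes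
  -- qualify as well.
  Unaffected : ℕ → ℕ → C ⊎ Fin q → Set
  Unaffected ρ k (inj₁ a) = toℕ a + k < ρ ⊎ suc ρ + k < toℕ a
  Unaffected ρ k (inj₂ _) = ⊤

  unaffected-pred : ∀ {ρ k} a → Unaffected ρ (suc k) a → Unaffected ρ k a
  unaffected-pred (inj₁ a) (inj₁ x) = inj₁ (ℕ.<-trans (ℕ.+-monoʳ-< (toℕ a) (ℕ.n<1+n _)) x)
  unaffected-pred {ρ} (inj₁ a) (inj₂ x) = inj₂ (ℕ.<-trans (ℕ.+-monoʳ-< (suc ρ) (ℕ.n<1+n _)) x)
  unaffected-pred (inj₂ _) _ = tt

  module _ (ρ : ℕ) where

    private
      module N = Tails iso (core ρ) isRoot D
      module F = Tails iso (core m) isRoot D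

    core-same : ∀ a b → toℕ a ≢ ρ ⊎ toℕ b ≢ suc ρ → core ρ a b ≡ core m a b
    core-same a b away = when-cong (arc? ρ a b) (arc? m a b)
      (λ { (inj₁ (b≡ , _)) → inj₁ (b≡ , λ a≡m → ℕ.<-irrefl (trans b≡ (cong suc a≡m)) (Fin.toℕ<n b)) ; (inj₂ x) → inj₂ x })
      (λ { (inj₁ (b≡ , _)) → inj₁ (b≡ , λ a≡ρ → [ (λ ne → ne a≡ρ) , (λ ne → ne (trans b≡ (cong suc a≡ρ))) ]′ away) ; (inj₂ x) → inj₂ x })

    not-ends : ∀ {k} a → Unaffected ρ k (inj₁ a) → toℕ a ≢ ρ × toℕ a ≢ suc ρ
    not-ends {k} a (inj₁ x) = (λ e → ℕ.<-irrefl e (ℕ.≤-<-trans (ℕ.m≤m+n _ k) x))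
                            , (λ e → ℕ.<-irrefl e (ℕ.m<n⇒m<1+n (ℕ.≤-<-trans (ℕ.m≤m+n _ k) x)))
    not-ends {k} a (inj₂ x) = (λ e → ℕ.<-irrefl (sym e) (ℕ.<-trans (ℕ.n<1+n ρ) (ℕ.≤-<-trans (ℕ.m≤m+n _ k) x)))
                            , (λ e → ℕ.<-irrefl (sym e) (ℕ.≤-<-trans (ℕ.m≤m+n _ k) x))

    arc-same : ∀ {k} a b → Unaffected ρ k a ⊎ Unaffected ρ k b → N.arc a b ≡ F.arc a b
    arc-same (inj₁ a) (inj₁ b) (inj₁ x) = core-same a b (inj₁ (proj₁ (not-ends a x)))
    arc-same (inj₁ a) (inj₁ b) (inj₂ x) = core-same a b (inj₂ (proj₂ (not-ends b x)))
    arc-same (inj₁ a) (inj₂ j) _ = refl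
    arc-same (inj₂ i) (inj₁ b) _ = refl
    arc-same (inj₂ i) (inj₂ j) _ = refl

    module _ {k} (k<ρ : k < ρ) (ρ+k<m : suc ρ + k < m) where

      unaffected-arc : ∀ a b {w} → N.arc a b ≡ just w →
        (Unaffected ρ (suc k) a → Unaffected ρ k b) × (Unaffected ρ (suc k) b → Unaffected ρ k a)
      unaffected-arc (inj₁ a) (inj₁ b) e with proj₁ (when-elim (arc? ρ a b) e)
      ... | inj₁ (b≡ , _) rewrite b≡ =
          (λ { (inj₁ x) → inj₁ (subst (_< ρ) (ℕ.+-suc (toℕ a) k) x)
             ; (inj₂ x) → inj₂ (ℕ.m<n⇒m<1+n (ℕ.<-trans (ℕ.+-monoʳ-< (suc ρ) (ℕ.n<1+n k)) x)) })
        , (λ { (inj₁ x) → inj₁ (ℕ.≤-<-trans (ℕ.+-mono-≤ (ℕ.n≤1+n (toℕ a)) (ℕ.n≤1+n k)) x)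
             ; (inj₂ x) → inj₂ (ℕ.s<s⁻¹ (subst (_< suc (toℕ a)) (ℕ.+-suc (suc ρ) k) x)) })
      -- Both ends of {0, m} are unaffected in any case, since the missing edge is far from node 0
      -- and from node `m`.
      ... | inj₂ (a≡0 , b≡m) rewrite a≡0 | b≡m = (λ _ → inj₂ ρ+k<m) , (λ _ → inj₁ k<ρ)
      unaffected-arc (inj₁ a) (inj₂ j) e = (λ _ → tt)
        , (λ _ → inj₁ (subst (λ z → z + k < ρ) (sym (isRoot⇒0 a (proj₁ (N.attached-elim a j e)))) k<ρ))
      unaffected-arc (inj₂ i) (inj₂ j) e = (λ _ → tt) , (λ _ → tt)

    link-same : ∀ {k} u v → Unaffected ρ k (N.at u) ⊎ Unaffected ρ k (N.at v) → N.link u v ≡ F.link u v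
    link-same u v (inj₁ x) = link-cong iso {u = u} {v} (arc-same (N.at u) (N.at v) (inj₁ x))
        (arc-same (N.at v) (N.at u) (inj₂ x))
    link-same u v (inj₂ x) = link-cong iso {u = u} {v} (arc-same (N.at u) (N.at v) (inj₂ x))
        (arc-same (N.at v) (N.at u) (inj₁ x))

    same-state : ∀ {Π B} (A : Algorithm Π n B) r k → k ≤ ρ → ρ + k < m → ∀ v → Unaffected ρ k (N.at v) →
                 state A (inst ρ) r k v ≡ state A (inst m) r k v
    same-state A r zero _ _ v x = cong (λ V → Algorithm.init A V (finToFun r v))
      (view-cong (inst ρ) (inst m) v (λ u → link-same v u (inj₁ x)) refl refl refl)
    same-state A r (suc k) k<ρ ρ+k<m v x = state-step A (inst ρ) (inst m) r k v (ih v (unaffected-pred (N.at v) x))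
      (λ u → link-same u v (inj₂ x))
      (λ u w e → cong (λ σ → Algorithm.send A σ v) (ih u (neighbour u e (N.link⇒arc u v e))))
      where
      ρ+k<m′ : suc ρ + k < m
      ρ+k<m′ = subst (_< m) (ℕ.+-suc ρ k) ρ+k<m
      ih : ∀ u → Unaffected ρ k (N.at u) → state A (inst ρ) r k u ≡ state A (inst m) r k u
      ih = same-state A r k (ℕ.<⇒≤ k<ρ) (ℕ.<-trans (ℕ.n<1+n (ρ + k)) ρ+k<m′)
      neighbour : ∀ u {w} → N.link u v ≡ just w → N.arc (N.at u) (N.at v) ≡ just w ⊎ N.arc (N.at v) (N.at u) ≡
          just w → Unaffected ρ k (N.at u)
      neighbour u e (inj₁ e′) = proj₂ (unaffected-arc k<ρ ρ+k<m′ (N.at u) (N.at v) e′) x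
      neighbour u e (inj₂ e′) = proj₁ (unaffected-arc k<ρ ρ+k<m′ (N.at v) (N.at u) e′) x

  module LowerBound (T : ℕ) (g : ℕ) (T<g : T < g) (gap : 2 * T + 2 ≤ g) (m≡4g : m ≡ 4 * g) where

    -- The source of `gap`: at offset `2 * T + 2`, the neighbourhoods of radius `T` around the two
    -- missing edges are disjoint.
    cuts-apart : ∀ {ρ ρ′} → ρ + g ≤ ρ′ → ∀ a → Unaffected ρ T a ⊎ Unaffected ρ′ T a
    cuts-apart {ρ} {ρ′} ρ+g≤ρ′ (inj₁ a) with toℕ a + T ℕ.<? ρ′
    ... | yes x = inj₂ (inj₁ x)
    ... | no ¬x = inj₁ (inj₂ (ℕ.+-cancelʳ-≤ T _ _ (begin
      suc (suc ρ + T) + T    ≡⟨ e ρ T ⟩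
      ρ + (2 * T + 2)        ≤⟨ ℕ.+-monoʳ-≤ ρ gap ⟩
      ρ + g                  ≤⟨ ρ+g≤ρ′ ⟩
      ρ′                     ≤⟨ ℕ.≮⇒≥ ¬x ⟩
      toℕ a + T              ∎)))
      where
      open ℕ.≤-Reasoning
      open import Data.Nat.Tactic.RingSolver using (solve-∀)
      e : ∀ ρ T → suc (suc ρ + T) + T ≡ ρ + (2 * T + 2)
      e = solve-∀
    cuts-apart _ (inj₂ _) = inj₁ tt

    module _ {Π : Problem} {B} (goal : Goal) (A : Algorithm Π n B)
             (solves : ∀ ρ → WithProbability≥2/3 A (λ r → Correct (inst ρ) Π goal (outputs A (inst ρ) r T))) where

      open import Data.Fin.Subset using (Subset; _∈_)
      open import Data.Vec.Properties using (lookup⇒[]=)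
      open Algorithm A using (coinSides; coinSides-nonZero)
      import Data.Integer.Properties as ℤ
      open Communication using (averaging; ±1)
      open Sums using (∑)

      likely : ℕ → Subset (coinSides ^ n)
      likely ρ = proj₁ (solves ρ)

      reported : ∀ ρ → (Fin n → NodeOutput Π n) → Fin n → ℕ∞ → Set
      reported ρ out v x = report (out v) (query Π (root ρ) (t ρ)) ≡ just x

      refuted : ∀ {ρ r} → T ≤ ρ → ρ + T < m → r ∈ likely ρ → ∀ {v x} → reported m (outputs A (inst m) r T) v x →
                Criterion.Meets finite x → ¬ Unaffected ρ T (Inverse.to iso v)
      refuted {ρ} {r} T≤ρ ρ+T<m r∈ {v} {x} rep meets far = Reports.reports-costly finite goal
        (proj₂ (proj₂ (solves ρ)) r r∈) (λ p a _ → cut⇒¬detour ρ (ℕ.≤-<-trans (ℕ.m≤m+n ρ T) ρ+T<m) p a) v x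
        (trans (cong (λ σ → report (Algorithm.output A σ) _) (same-state ρ A r T T≤ρ ρ+T<m v far)) rep) meets

      -- On the full cycle some node announces a finite value. It is too far from one of the two
      -- cuts to notice it, and announces the same value there, although no detour exists.
      not-both : ∀ {ρ ρ′ r} → T ≤ ρ → ρ + g ≤ ρ′ → ρ′ + T < m → r ∈ likely m → r ∈ likely ρ → r ∈ likely ρ′ → ⊥
      not-both {ρ} {ρ′} {r} T≤ρ ρ+g≤ρ′ ρ′+T<m r∈ r∈ρ r∈ρ′ with full⇒detour m refl
      ... | p , a with Reports.reports-cheap finite goal (proj₂ (proj₂ (solves m)) r r∈) p a tt
      ...   | v , x , rep , meets with cuts-apart ρ+g≤ρ′ (Inverse.to iso v)
      ...     | inj₁ far = refuted T≤ρ (ℕ.≤-<-trans (ℕ.+-monoˡ-≤ T (ℕ.≤-trans (ℕ.m≤m+n ρ g) ρ+g≤ρ′)) ρ′+T<m)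
          r∈ρ rep meets far
      ...     | inj₂ far = refuted (ℕ.≤-trans T≤ρ (ℕ.≤-trans (ℕ.m≤m+n ρ g) ρ+g≤ρ′)) ρ′+T<m r∈ρ′ rep meets far

      -- The full cycle counts twice: a seed could be good for three of the four distinct instances.
      instances : List ℕ
      instances = m ∷ m ∷ g ∷ 2 * g ∷ 3 * g ∷ []

      3<5 : ℤ.+ 3 ℤ.< ℤ.+ 5
      3<5 = ℤ.+<+ (ℕ.m≤m+n 4 1)

      -- By `not-both`, a seed is good for at most three of the five list entries: the three cuts,
      -- or the full cycle twice and one cut. This is less than 2/3. Two cuts would not do: however
      -- three instances are weighted, some two of them carry at least 2/3 of the total.
      count : ∀ b₀ b₁ b₂ b₃ →
        (b₀ ≡ true → b₁ ≡ true → b₂ ≡ true → ⊥) → (b₀ ≡ true → b₁ ≡ true → b₃ ≡ true → ⊥) →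
            (b₀ ≡ true → b₂ ≡ true → b₃ ≡ true → ⊥) →
        (ℤ.+ 3) ℤ.* (±1 b₀ ℤ.+ (±1 b₀ ℤ.+ (±1 b₁ ℤ.+ (±1 b₂ ℤ.+ (±1 b₃ ℤ.+ ℤ.0ℤ))))) ℤ.< ℤ.+ 5
      count false false false false _ _ _ = ℤ.-<+
      count false false false true  _ _ _ = ℤ.-<+
      count false false true false _ _ _ = ℤ.-<+
      count false false true true  _ _ _ = ℤ.-<+
      count false true false false _ _ _ = ℤ.-<+
      count false true false true  _ _ _ = ℤ.-<+
      count false true true false _ _ _ = ℤ.-<+
      count false true true true  _ _ _ = 3<5
      count true false false false _ _ _ = ℤ.-<+
      count true false false true  _ _ _ = 3<5
      count true false true false _ _ _ = 3<5
      count true true false false _ _ _ = 3<5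
      count true  true  true  _     f _ _ = ⊥-elim (f refl refl refl)
      count true  true  false true  _ f _ = ⊥-elim (f refl refl refl)
      count true  false true  true  _ _ f = ⊥-elim (f refl refl refl)

      impossible : ⊥
      impossible = averaging instances (ℕ.m^n>0 coinSides n) likely (λ ρ → proj₁ (proj₂ (solves ρ))) λ r →
        count (Vec.lookup (likely m) r) (Vec.lookup (likely g) r) (Vec.lookup (likely (2 * g)) r)
            (Vec.lookup (likely (3 * g)) r)
          (λ e₀ e₁ e₂ → not-both T≤g (ℕ.≤-reflexive (d₁ g)) (below 2 (s≤s (s≤s (s≤s z≤n)))) (∈-likely r e₀)
              (∈-likely r e₁) (∈-likely r e₂))
          (λ e₀ e₁ e₃ → not-both T≤g (ℕ.≤-trans (ℕ.≤-reflexive (d₁ g)) (ℕ.*-monoˡ-≤ g (s≤s (s≤s (z≤n {1})))))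
              (below 3 ℕ.≤-refl) (∈-likely r e₀) (∈-likely r e₁) (∈-likely r e₃))
          (λ e₀ e₂ e₃ → not-both (ℕ.≤-trans T≤g (ℕ.m≤m+n g (1 * g))) (ℕ.≤-reflexive (ℕ.+-comm (2 * g) g))
              (below 3 ℕ.≤-refl) (∈-likely r e₀) (∈-likely r e₂) (∈-likely r e₃))
        where
        T≤g : T ≤ g
        T≤g = ℕ.<⇒≤ T<g
        d₁ : ∀ g → g + g ≡ 2 * g
        d₁ g = cong (λ x → g + x) (sym (ℕ.+-identityʳ g))
        below : ∀ i → i < 4 → i * g + T < m
        below i i<4 = begin-strict
          i * g + T    <⟨ ℕ.+-monoʳ-< (i * g) T<g ⟩
          i * g + g    ≡⟨ ℕ.+-comm (i * g) g ⟩
          suc i * g    ≤⟨ ℕ.*-monoˡ-≤ g i<4 ⟩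
          4 * g        ≡⟨ m≡4g ⟨
          m            ∎
          where open ℕ.≤-Reasoning
        ∈-likely : ∀ {ρ} r → Vec.lookup (likely ρ) r ≡ true → r ∈ likely ρ
        ∈-likely {ρ} r e = lookup⇒[]= r (likely ρ) e

-- The number of bit strings of length at most `B`, namely 2^(B+1) - 1: a message may be shorter
-- than `B`, and its length carries information too.
letters : ℕ → ℕ
letters zero    = 1
letters (suc B) = suc (2 * letters B)

letters<2^ : ∀ B → suc (letters B) ≡ 2 ^ suc B
letters<2^ zero    = refl
letters<2^ (suc B) = trans (e (letters B)) (cong (2 *_) (letters<2^ B))
  where
  open import Data.Nat.Tactic.RingSolver using (solve-∀)
  e : ∀ a → suc (suc (2 * a)) ≡ 2 * suc a
  e = solve-∀

bit : Bool → Fin 2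
bit false = zero
bit true  = suc zero

bool : Fin 2 → Bool
bool zero       = false
bool (suc zero) = true

bool-bit : ∀ b → bool (bit b) ≡ b
bool-bit false = refl
bool-bit true  = refl

bit-injective : ∀ {a b} → bit a ≡ bit b → a ≡ b
bit-injective {a} {b} e = trans (sym (bool-bit a)) (trans (cong bool e) (bool-bit b))

either : Fin (2 * 2) → Bool
either c = bool (proj₁ (remQuot {2} 2 c)) ∨ bool (proj₂ (remQuot {2} 2 c))

either-bits : ∀ a b → either (combine (bit a) (bit b)) ≡ a ∨ b
either-bits false false = refl
either-bits false true  = refl
either-bits true  false = refl
either-bits true  true  = refl

code : ∀ B {m} → Vec Bool m → Fin (letters B)
code zero    _       = zero
code (suc B) []      = zero
code (suc B) (b ∷ v) = suc (combine (bit b) (code B v))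

code-injective : ∀ B {m m′} (v : Vec Bool m) (v′ : Vec Bool m′) → m ≤ B → m′ ≤ B →
                 code B v ≡ code B v′ → _≡_ {A = Σ ℕ (Vec Bool)} (m , v) (m′ , v′)
code-injective zero    []      []        _       _        _ = refl
code-injective (suc B) []      []        _       _        _ = refl
code-injective (suc B) (b ∷ v) (b′ ∷ v′) (s≤s h) (s≤s h′) e
  with Fin.combine-injective (bit b) (code B v) (bit b′) (code B v′) (Fin.suc-injective e)
... | eb , ev with bit-injective eb | code-injective B v v′ h h′ ev
...   | refl | refl = refl

encode : ∀ {B} → Message B → Fin (letters B)
encode {B} (v Vec≤., _) = code B v

encode-injective : ∀ {B} (μ ν : Message B) → encode μ ≡ encode ν → μ ≡ ν
encode-injective {B} μ@(v Vec≤., _) ν@(v′ Vec≤., _) e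
  with code-injective B v v′ (Vec≤.isBounded μ) (Vec≤.isBounded ν) e
... | refl = refl

funToFin-cong : ∀ {k l} {f f′ : Fin k → Fin l} → (∀ i → f i ≡ f′ i) → funToFin f ≡ funToFin f′
funToFin-cong {zero}  e = refl
funToFin-cong {suc k} e = cong₂ combine (e zero) (funToFin-cong (e ∘ suc))

funToFin-injective : ∀ {k l} {f f′ : Fin k → Fin l} → funToFin f ≡ funToFin f′ → ∀ i → f i ≡ f′ i
funToFin-injective {f = f} {f′} e i =
  trans (sym (Fin.finToFun-funToFin f i)) (trans (cong (λ x → finToFun x i) e) (Fin.finToFun-funToFin f′ i))


-- Simulation of a run by two parties

-- One of two parties that jointly simulate the runs of an algorithm on the instances I z. Of z it knows the part
-- described by _≈_. After k rounds it knows the states of the nodes in Knows k, provided that the other party,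
-- who knows the nodes in Other k, tells it the messages that are sent along the pairs heard k.
record Party {n : ℕ} {Z : Set} (I : Z → Instance n) (_≈_ : Z → Z → Set) (T L : ℕ)
             (Knows Other : ℕ → Fin n → Set) : Set where
  open Instance
  field
    heard      : ℕ → Fin L → Fin n × Fin n
    knows?     : ∀ v → Dec (Knows T v)
    shrink     : ∀ {k v} → k < T → Knows (suc k) v → Knows k v
    view-known : ∀ {z z′ v} → z ≈ z′ → Knows 0 v → view (I z) v ≡ view (I z′) v
    edge-known : ∀ {k z z′ v} → z ≈ z′ → Knows k v → ∀ u → edge (graph (I z)) u v ≡ edge (graph (I z′)) u v
    neighbour  : ∀ {k v} → k < T → ∀ z u w → edge (graph (I z)) u v ≡ just w → Knows (suc k) v →
                 Knows k u ⊎ ∃ λ l → heard k l ≡ (u , v)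
    sender     : ∀ {k} → k < T → ∀ l → Other k (proj₁ (heard k l))

module CutAndPaste {Π n B} (A : Algorithm Π n B) (r : Seed A) {Z : Set} (I : Z → Instance n) where

  open Algorithm A

  run : Z → ℕ → Fin n → State
  run z = state A (I z) r

  message : Z → ℕ → Fin n × Fin n → Message B
  message z k (u , v) = send (run z k u) v

  party-step : ∀ {_≈_ : Z → Z → Set} {T L Knows Other} (P : Party I _≈_ T L Knows Other) → let open Party P in
    ∀ {k z z′} → k < T → z ≈ z′ → (∀ v → Knows k v → run z k v ≡ run z′ k v) →
    (∀ l → message z k (heard k l) ≡ message z′ k (heard k l)) →
    ∀ v → Knows (suc k) v → run z (suc k) v ≡ run z′ (suc k) v
  party-step P {k} {z} {z′} k<T z≈z′ ih told v kv = state-step A (I z) (I z′) r k v (ih v (shrink k<T kv))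
    (edge-known z≈z′ kv) λ u w e → case neighbour k<T z u w e kv of λ where
      (inj₁ ku)         → cong (λ σ → send σ v) (ih u ku)
      (inj₂ (l , refl)) → told l
    where open Party P

  module _ {_≈₁_ _≈₂_ : Z → Z → Set} {T L : ℕ} {K₁ K₂ : ℕ → Fin n → Set}
           (P₁ : Party I _≈₁_ T L K₁ K₂) (P₂ : Party I _≈₂_ T L K₂ K₁) (covered : ∀ v → K₁ T v ⊎ K₂ T v) where

    private
      module P₁ = Party P₁
      module P₂ = Party P₂
      a : ℕ
      a = letters B

    entry : Z → ℕ → Fin L → Fin (a * a)
    entry z k l = combine (encode (message z k (P₁.heard k l))) (encode (message z k (P₂.heard k l)))

    exchanged : Z → Fin (((a * a) ^ L) ^ T)
    exchanged z = funToFin {T} λ k → funToFin {L} (entry z (toℕ k))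

    Agree : Z → Z → Set
    Agree z z′ = ∀ k → k < T → ∀ l → message z k (P₁.heard k l) ≡ message z′ k (P₁.heard k l)
                                   × message z k (P₂.heard k l) ≡ message z′ k (P₂.heard k l)

    exchanged⇒agree : ∀ {z z′} → exchanged z ≡ exchanged z′ → Agree z z′
    exchanged⇒agree {z} {z′} e k k<T l with Fin.combine-injective
      (encode (message z k (P₁.heard k l))) (encode (message z k (P₂.heard k l)))
      (encode (message z′ k (P₁.heard k l))) (encode (message z′ k (P₂.heard k l)))
      (subst (λ i → entry z i l ≡ entry z′ i l) (Fin.toℕ-fromℕ< k<T)
        (funToFin-injective {L} (funToFin-injective {T} e (fromℕ< k<T)) l))
    ... | e₁ , e₂ = encode-injective _ _ e₁ , encode-injective _ _ e₂

    agree⇒exchanged : ∀ {z z′} → Agree z z′ → exchanged z ≡ exchanged z′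
    agree⇒exchanged same = funToFin-cong {T} λ k → funToFin-cong {L} λ l → let e₁ , e₂ = same (toℕ k) (Fin.toℕ<n k) l in
      cong₂ combine (cong encode e₁) (cong encode e₂)

    module _ {z z₁ z₂ : Z} (z≈z₁ : z ≈₁ z₁) (z≈z₂ : z ≈₂ z₂) (agree : Agree z₁ z₂) where

      told₁ : ∀ {k} → k < T → (∀ v → K₂ k v → run z k v ≡ run z₂ k v) →
              ∀ l → message z k (P₁.heard k l) ≡ message z₁ k (P₁.heard k l)
      told₁ {k} k<T same l = trans (cong (λ σ → send σ (proj₂ (P₁.heard k l))) (same _ (P₁.sender k<T l)))
                                   (sym (proj₁ (agree k k<T l)))

      told₂ : ∀ {k} → k < T → (∀ v → K₁ k v → run z k v ≡ run z₁ k v) →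
              ∀ l → message z k (P₂.heard k l) ≡ message z₂ k (P₂.heard k l)
      told₂ {k} k<T same l = trans (cong (λ σ → send σ (proj₂ (P₂.heard k l))) (same _ (P₂.sender k<T l)))
                                   (proj₂ (agree k k<T l))

      -- The run on `z` looks to the first party like the run on `z₁` and to the second like the run
      -- on `z₂`. The two claims need each other: what one party is told comes from nodes that the
      -- other knows, and `agree` identifies the messages of the two runs.
      paste : ∀ k → k ≤ T → (∀ v → K₁ k v → run z k v ≡ run z₁ k v) × (∀ v → K₂ k v → run z k v ≡ run z₂ k v)
      paste zero    _   = (λ v kv → cong (λ V → init V (finToFun r v)) (P₁.view-known z≈z₁ kv))
                        , (λ v kv → cong (λ V → init V (finToFun r v)) (P₂.view-known z≈z₂ kv))
      paste (suc k) k<T = let same₁ , same₂ = paste k (ℕ.<⇒≤ k<T) in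
          party-step P₁ k<T z≈z₁ same₁ (told₁ k<T same₂)
        , party-step P₂ k<T z≈z₂ same₂ (told₂ k<T same₁)

      agree₁ : Agree z z₁
      agree₁ k k<T l = let same₁ , same₂ = paste k (ℕ.<⇒≤ k<T) in
        told₁ k<T same₂ l , trans (told₂ k<T same₁ l) (sym (proj₂ (agree k k<T l)))

    module _ (announces : State → Bool) where

      open import Data.Bool.Properties using () renaming (_≟_ to _≟ᵇ_)
      open import Relation.Nullary.Decidable using (_×-dec_; does-⇔; dec-true; dec-false)
      open import Function.Bundles using (mk⇔)

      Heard : (ℕ → Fin n → Set) → Z → Set
      Heard K z = ∃ λ v → K T v × announces (run z T v) ≡ true

      heard₁? : ∀ z → Dec (Heard K₁ z)
      heard₁? z = Fin.any? (λ v → P₁.knows? v ×-dec (announces (run z T v) ≟ᵇ true))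

      heard₂? : ∀ z → Dec (Heard K₂ z)
      heard₂? z = Fin.any? (λ v → P₂.knows? v ×-dec (announces (run z T v) ≟ᵇ true))

      heard-same : ∀ {K z z′} → (∀ v → K T v → run z T v ≡ run z′ T v) → Heard K z → Heard K z′
      heard-same same (v , kv , e) = v , kv , trans (cong announces (sym (same v kv))) e

      -- The announcing node may be known to one party alone, so each party adds a bit for the nodes
      -- that it knows; by `covered` no announcement is missed.
      transcript : Z → Fin ((2 * 2) * ((a * a) ^ L) ^ T)
      transcript z = combine (combine (bit (does (heard₁? z))) (bit (does (heard₂? z)))) (exchanged z)

      announced : Fin ((2 * 2) * ((a * a) ^ L) ^ T) → Bool
      announced c = either (proj₁ (remQuot {2 * 2} (((a * a) ^ L) ^ T) c))

      announced-transcript : ∀ z → announced (transcript z) ≡ does (heard₁? z) ∨ does (heard₂? z)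
      announced-transcript z = trans
        (cong (either ∘ proj₁) (Fin.remQuot-combine (combine (bit (does (heard₁? z))) (bit (does (heard₂? z))))
            (exchanged z)))
        (either-bits (does (heard₁? z)) (does (heard₂? z)))

      announced-true : ∀ z v → announces (run z T v) ≡ true → announced (transcript z) ≡ true
      announced-true z v e with covered v
      ... | inj₁ kv = trans (announced-transcript z) (cong (_∨ does (heard₂? z)) (dec-true (heard₁? z) (v , kv , e)))
      ... | inj₂ kv = trans (announced-transcript z)
          (trans (cong (does (heard₁? z) ∨_) (dec-true (heard₂? z) (v , kv , e))) (∨-zeroʳ _))
        where open import Data.Bool.Properties using (∨-zeroʳ)

      announced-false : ∀ z → (∀ v → announces (run z T v) ≡ false) → announced (transcript z) ≡ false
      announced-false z silent = trans (announced-transcript z)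
        (cong₂ _∨_ (dec-false (heard₁? z) (λ { (v , _ , e) → true≢false (trans (sym e) (silent v)) }))
                   (dec-false (heard₂? z) (λ { (v , _ , e) → true≢false (trans (sym e) (silent v)) })))
        where
        true≢false : true ≢ false
        true≢false ()

      transcript-rectangular : ∀ {z z₁ z₂} → z ≈₁ z₁ → z ≈₂ z₂ → transcript z₁ ≡ transcript z₂ → transcript z ≡
          transcript z₁
      transcript-rectangular {z} {z₁} {z₂} z≈z₁ z≈z₂ e
        with Fin.combine-injective (combine (bit (does (heard₁? z₁))) (bit (does (heard₂? z₁)))) (exchanged z₁)
                                   (combine (bit (does (heard₁? z₂))) (bit (does (heard₂? z₂)))) (exchanged z₂) e
      ... | ev , ex with Fin.combine-injective (bit (does (heard₁? z₁))) (bit (does (heard₂? z₁)))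
          (bit (does (heard₁? z₂))) (bit (does (heard₂? z₂))) ev
      ...   | _ , ev₂ = cong₂ combine
        (cong₂ (λ b b′ → combine (bit b) (bit b′))
          (does-⇔ (mk⇔ (heard-same {K₁} same₁) (heard-same {K₁} (λ v kv → sym (same₁ v kv)))) (heard₁? z)
              (heard₁? z₁))
          -- The bit of the second party is the one of `z₂`, and the equality of the two transcripts
          -- carries it over to `z₁`.
          (trans (does-⇔ (mk⇔ (heard-same {K₂} same₂) (heard-same {K₂} (λ v kv → sym (same₂ v kv))))
              (heard₂? z) (heard₂? z₂))
                 (sym (bit-injective ev₂))))
        (agree⇒exchanged (agree₁ z≈z₁ z≈z₂ (exchanged⇒agree ex)))
        where
        pasted = paste z≈z₁ z≈z₂ (exchanged⇒agree {z₁} {z₂} ex) T ℕ.≤-refl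
        same₁ = proj₁ pasted
        same₂ = proj₂ pasted

-- These are ⌈c / 2^j⌉ and ⌊b / 2^j⌋. The tree node with index p on level j lies over some column
-- below c if and only if p < `up j c`, and over some column from b on if and only if `down j b` ≤
-- p.
up down : ℕ → ℕ → ℕ
up zero    c = c
up (suc j) c = up j ⌈ c /2⌉
down zero    b = b
down (suc j) b = down j ⌊ b /2⌋

up-suc : ∀ j c → up (suc j) c ≡ ⌈ up j c /2⌉
up-suc zero    c = refl
up-suc (suc j) c = up-suc j ⌈ c /2⌉

down-suc : ∀ j b → down (suc j) b ≡ ⌊ down j b /2⌋
down-suc zero    b = refl
down-suc (suc j) b = down-suc j ⌊ b /2⌋

up-mono : ∀ j {c c′} → c ≤ c′ → up j c ≤ up j c′
up-mono zero    h = h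
up-mono (suc j) h = up-mono j (ℕ.⌈n/2⌉-mono h)

down-mono : ∀ j {b b′} → b ≤ b′ → down j b ≤ down j b′
down-mono zero    h = h
down-mono (suc j) h = down-mono j (ℕ.⌊n/2⌋-mono h)

up≤ : ∀ j c → up j c ≤ c
up≤ zero    c = ℕ.≤-refl
up≤ (suc j) c = ℕ.≤-trans (up≤ j ⌈ c /2⌉) (ℕ.⌈n/2⌉≤n c)

down≤up : ∀ j {b c} → b ≤ c → down j b ≤ up j c
down≤up zero    h = h
down≤up (suc j) {b} {c} h = down≤up j (ℕ.≤-trans (ℕ.⌊n/2⌋-mono h) (ℕ.⌊n/2⌋≤⌈n/2⌉ c))

1≤up : ∀ j {c} → 1 ≤ c → 1 ≤ up j c
1≤up zero    h = h
1≤up (suc j) h = 1≤up j (ℕ.⌈n/2⌉-mono h)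

⌊/2⌋<⌈/2⌉ : ∀ {p u} → p < u → ⌊ p /2⌋ < ⌈ u /2⌉
⌊/2⌋<⌈/2⌉ p<u = ℕ.⌊n/2⌋-mono (s≤s p<u)

-- A child of a node inside the left region lies inside as well, or is the very first node past the
-- border `u`; `⌊/2⌋-cancel-≤` is the mirror image. This leaves one sender per level.
⌊/2⌋<⌈/2⌉⇒≤ : ∀ {p u} → ⌊ p /2⌋ < ⌈ u /2⌉ → p ≤ u
⌊/2⌋<⌈/2⌉⇒≤ {p} {u} h = ℕ.≮⇒≥ λ u<p → ℕ.<⇒≱ h (ℕ.⌊n/2⌋-mono u<p)

⌊/2⌋-cancel-≤ : ∀ {b p} → ⌊ b /2⌋ ≤ ⌊ p /2⌋ → b ≤ suc p
⌊/2⌋-cancel-≤ {b} {p} h = ℕ.≮⇒≥ λ p+1<b → ℕ.<⇒≱ (ℕ.⌊n/2⌋-mono p+1<b) h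

n+n-halves : ∀ n → ⌊ n + n /2⌋ ≡ n × ⌈ n + n /2⌉ ≡ n
n+n-halves n = sym (ℕ.n≡⌊n+n/2⌋ n) , sym (ℕ.n≡⌈n+n/2⌉ n)

⌈/2⌉-2^ : ∀ d {c} → c ≤ 2 ^ suc d → ⌈ c /2⌉ ≤ 2 ^ d
⌈/2⌉-2^ d h = ℕ.≤-trans (ℕ.⌈n/2⌉-mono (ℕ.≤-trans h (ℕ.≤-reflexive (cong (λ x → 2 ^ d + x) (ℕ.+-identityʳ (2 ^ d))))))
                        (ℕ.≤-reflexive (proj₂ (n+n-halves (2 ^ d))))

⌊/2⌋-2^ : ∀ d {b} → b < 2 ^ suc d → ⌊ b /2⌋ < 2 ^ d
⌊/2⌋-2^ d h = ℕ.≤-trans (⌊/2⌋<⌈/2⌉ h) (⌈/2⌉-2^ d ℕ.≤-refl)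

up-top : ∀ d {c} → 1 ≤ c → c ≤ 2 ^ d → up d c ≡ 1
up-top zero    h h′ = ℕ.≤-antisym h′ h
up-top (suc d) h h′ = up-top d (ℕ.⌈n/2⌉-mono h) (⌈/2⌉-2^ d h′)

down-top : ∀ d {b} → b < 2 ^ d → down d b ≡ 0
down-top zero    h = ℕ.n≤0⇒n≡0 (ℕ.s≤s⁻¹ h)
down-top (suc d) h = down-top d (⌊/2⌋-2^ d h)

-- The cap at `d` makes the root its own parent. Halving tolerates this because the border on level
-- `d` is 1, a fixed point of ⌈ /2⌉; in `down-parent` it is 0.
up-parent : ∀ d {j c} → j ≤ d → up d c ≡ 1 → up (suc j ⊓ d) c ≡ ⌈ up j c /2⌉
up-parent d {j} {c} j≤d top with ℕ.m≤n⇒m<n∨m≡n j≤d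
... | inj₁ j<d  = trans (cong (λ k → up k c) (ℕ.m≤n⇒m⊓n≡m j<d)) (up-suc j c)
... | inj₂ refl = trans (cong (λ k → up k c) (ℕ.m≥n⇒m⊓n≡n (ℕ.n≤1+n j))) (trans top (sym (cong ⌈_/2⌉ top)))

down-parent : ∀ d {j b} → j ≤ d → down d b ≡ 0 → down (suc j ⊓ d) b ≡ ⌊ down j b /2⌋
down-parent d {j} {b} j≤d top with ℕ.m≤n⇒m<n∨m≡n j≤d
... | inj₁ j<d  = trans (cong (λ k → down k b) (ℕ.m≤n⇒m⊓n≡m j<d)) (down-suc j b)
... | inj₂ refl = trans (cong (λ k → down k b) (ℕ.m≥n⇒m⊓n≡n (ℕ.n≤1+n j))) (trans top (sym (cong ⌊_/2⌋ top)))

-- Input bits and running parities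

digit : ∀ {N} → Vec Bool N → ℕ → Bool
digit []      _       = false
digit (b ∷ v) zero    = b
digit (b ∷ v) (suc i) = digit v i

-- Rows 0 and N + 1, where the walk starts and ends, carry no input bit.
row : ∀ {N} → Vec Bool N → ℕ → Bool
row x = digit (false ∷ x)

row-end : ∀ {N} (x : Vec Bool N) → row x (suc N) ≡ false
row-end []      = refl
row-end (b ∷ x) = row-end x

parity : (ℕ → Bool) → (ℕ → Bool) → ℕ → Bool
parity u v zero    = false
parity u v (suc i) = parity u v i xor (u i ∧ v i)

open Communication using (ip)

-- `parity` takes in the newest product last, as the walk meets it, whereas `ip` recurses from the
-- front; row 0 contributes `false`.
parity-ip : ∀ {N} (x y : Vec Bool N) → parity (row x) (row y) (suc N) ≡ ip x y
parity-ip {N} x y = trans (shift (row x) (row y) N) (go x y)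
  where
  open import Data.Bool.Properties using (xor-assoc)
  shift : ∀ u v i → parity u v (suc i) ≡ (u 0 ∧ v 0) xor parity (u ∘ suc) (v ∘ suc) i
  shift u v zero    = sym (xor-false (u 0 ∧ v 0))
    where
    xor-false : ∀ b → b xor false ≡ b
    xor-false false = refl
    xor-false true  = refl
  shift u v (suc i) = trans (cong (_xor (u (suc i) ∧ v (suc i))) (shift u v i)) (xor-assoc (u 0 ∧ v 0) _ _)
  go : ∀ {N} (x y : Vec Bool N) → parity (row x ∘ suc) (row y ∘ suc) N ≡ ip x y
  go []          []      = refl
  go {suc N} (a ∷ x) (b ∷ y) = trans (shift (row (a ∷ x) ∘ suc) (row (b ∷ y) ∘ suc) N) (cong ((a ∧ b) xor_) (go x y))

-- The comb network

Track : ℕ → ℕ → Set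
Track N last = Fin (suc (suc N)) × Bool × Bool × Bool × Fin (suc last)

column : ∀ {N last} → Track N last → ℕ
column (_ , _ , _ , _ , p) = toℕ p

-- Every level is as wide as the bottom one, which makes the type a product. Surplus nodes still
-- reach the root by halving their index, on level `d` too, where the level no longer changes.
Tree : ℕ → ℕ → Set
Tree d last = Fin (suc d) × Fin (suc last)

pattern track u  = inj₁ (inj₁ u)
pattern tree j p = inj₁ (inj₂ (j , p))

-- Row i has an outward (k ≡ false) and a return (k ≡ true) bundle of tracks, each with a track for every g, b.
-- The walk from s in row i uses the tracks with g ≡ xᵢ, and b is the parity of the products so far: Bob, at
-- the last column, swaps the two tracks with g ≡ true when yᵢ ≡ true.
module Comb (N last d D : ℕ) (1≤N : 1 ≤ N) (1≤last : 1 ≤ last) (last<2^d : last < 2 ^ d) (2+2d≤D : suc d + suc d ≤ D)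
            {n q} (iso : Fin n ↔ ((Track N last ⊎ Tree d last) ⊎ Fin q)) (D≤q : D ≤ q) where

  open import Data.Bool.Properties using () renaming (_≟_ to _≟ᵇ_)
  open import Relation.Nullary.Decidable using (_×-dec_; _⊎-dec_; ¬?)

  X : Set
  X = Vec Bool N

  V : Set
  V = (Track N last ⊎ Tree d last) ⊎ Fin q

  -- `x` enters only through `Turn`, in column 0, and `y` only through `Swap`, in the last column.
  -- `Swap` covers every `g` and `b`, so it multiplies by xᵢ without depending on `x`.
  Along Turn Swap : X → X → Track N last → Track N last → Set
  Along x y (i , k , g , b , p) (i′ , k′ , g′ , b′ , p′) = (toℕ i ≡ toℕ i′ × k ≡ k′ × g ≡ g′ × b ≡ b′) × toℕ p′
      ≡ suc (toℕ p)
  Turn x y (i , k , g , b , p) (i′ , k′ , g′ , b′ , p′) =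
    (k ≡ true × k′ ≡ false × toℕ i′ ≡ suc (toℕ i) × b ≡ b′) × (g ≡ row x (toℕ i) × g′ ≡ row x (toℕ i′)) ×
        (toℕ p ≡ 0 × toℕ p′ ≡ 0)
  Swap x y (i , k , g , b , p) (i′ , k′ , g′ , b′ , p′) =
    (k ≡ false × k′ ≡ true × toℕ i ≡ toℕ i′ × g ≡ g′) × (b′ ≡ b xor (g ∧ row y (toℕ i))) ×
        (toℕ p ≡ last × toℕ p′ ≡ last)

  Link : X → X → Track N last → Track N last → Set
  Link x y u v = Along x y u v ⊎ Turn x y u v ⊎ Swap x y u v

  -- Starting on the return bundle of row 0 and stopping on entry to row `N + 1` puts both ends in
  -- column 0, so that the edge {s, t} lies on Alice's side.
  Start End : Track N last → Set
  Start (i , k , g , b , p) = toℕ i ≡ 0 × k ≡ true × g ≡ false × b ≡ false × toℕ p ≡ 0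
  End   (i , k , g , b , p) = toℕ i ≡ suc N × k ≡ false × g ≡ false × b ≡ false × toℕ p ≡ 0

  link? : ∀ x y u v → Dec (Link x y u v)
  link? x y (i , k , g , b , p) (i′ , k′ , g′ , b′ , p′) =
    (((toℕ i ℕ.≟ toℕ i′) ×-dec ((k ≟ᵇ k′) ×-dec ((g ≟ᵇ g′) ×-dec (b ≟ᵇ b′)))) ×-dec (toℕ p′ ℕ.≟ suc (toℕ p)))
    ⊎-dec
    ((((k ≟ᵇ true) ×-dec ((k′ ≟ᵇ false) ×-dec ((toℕ i′ ℕ.≟ suc (toℕ i)) ×-dec (b ≟ᵇ b′)))) ×-dec
      (((g ≟ᵇ row x (toℕ i)) ×-dec (g′ ≟ᵇ row x (toℕ i′))) ×-dec ((toℕ p ℕ.≟ 0) ×-dec (toℕ p′ ℕ.≟ 0))))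
    ⊎-dec
     (((k ≟ᵇ false) ×-dec ((k′ ≟ᵇ true) ×-dec ((toℕ i ℕ.≟ toℕ i′) ×-dec (g ≟ᵇ g′)))) ×-dec
      ((b′ ≟ᵇ (b xor (g ∧ row y (toℕ i)))) ×-dec ((toℕ p ℕ.≟ last) ×-dec (toℕ p′ ℕ.≟ last)))))

  start? : ∀ u → Dec (Start u)
  start? (i , k , g , b , p) = (toℕ i ℕ.≟ 0) ×-dec
      ((k ≟ᵇ true) ×-dec ((g ≟ᵇ false) ×-dec ((b ≟ᵇ false) ×-dec (toℕ p ℕ.≟ 0))))

  end? : ∀ u → Dec (End u)
  end? (i , k , g , b , p) = (toℕ i ℕ.≟ suc N) ×-dec
      ((k ≟ᵇ false) ×-dec ((g ≟ᵇ false) ×-dec ((b ≟ᵇ false) ×-dec (toℕ p ℕ.≟ 0))))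

  arc? : ∀ x y u v → Dec (Link x y u v ⊎ (Start u × End v))
  arc? x y u v = link? x y u v ⊎-dec (start? u ×-dec end? v)

  Above : Track N last → Tree d last → Set
  Above u (j , p) = column u ≡ toℕ p × toℕ j ≡ 0

  above? : ∀ u v → Dec (Above u v)
  above? u (j , p) = (column u ℕ.≟ toℕ p) ×-dec (toℕ j ℕ.≟ 0)

  Parent : Tree d last → Tree d last → Set
  Parent (j , p) (j′ , p′) = toℕ j′ ≡ suc (toℕ j) ⊓ d × toℕ p′ ≡ ⌊ toℕ p /2⌋

  parent? : ∀ u v → Dec (Parent u v)
  parent? (j , p) (j′ , p′) = (toℕ j′ ℕ.≟ suc (toℕ j) ⊓ d) ×-dec (toℕ p′ ℕ.≟ ⌊ toℕ p /2⌋)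

  -- Tree edges have weight 1: they shorten hop distances without offering a weightless detour.
  core : X → X → Track N last ⊎ Tree d last → Track N last ⊎ Tree d last → Maybe ℕ
  core x y (inj₁ u) (inj₁ v) = when (arc? x y u v) 0
  core x y (inj₁ u) (inj₂ v) = when (above? u v) 1
  core x y (inj₂ u) (inj₁ v) = nothing
  core x y (inj₂ u) (inj₂ v) = when (parent? u v) 1

  root? : ∀ (v : Tree d last) → Dec (toℕ (proj₁ v) ≡ d × toℕ (proj₂ v) ≡ 0)
  root? (j , p) = (toℕ j ℕ.≟ d) ×-dec (toℕ p ℕ.≟ 0)

  isRoot : Track N last ⊎ Tree d last → Bool
  isRoot (inj₁ _) = false
  isRoot (inj₂ v) = does (root? v)

  isRoot⇒ : ∀ v → isRoot (inj₂ v) ≡ true → toℕ (proj₁ v) ≡ d × toℕ (proj₂ v) ≡ 0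
  isRoot⇒ v e = does-true (root? v) e
    where
    does-true : ∀ {P : Set} (p? : Dec P) → does p? ≡ true → P
    does-true (yes p) _ = p

  clamp : ℕ → Fin (suc last)
  clamp k = fromℕ< (s≤s (ℕ.m⊓n≤n k last))

  toℕ-clamp : ∀ {k} → k ≤ last → toℕ (clamp k) ≡ k
  toℕ-clamp {k} k≤ = trans (Fin.toℕ-fromℕ< (s≤s (ℕ.m⊓n≤n k last))) (ℕ.m≤n⇒m⊓n≡m k≤)

  clamp-toℕ : ∀ p → clamp (toℕ p) ≡ p
  clamp-toℕ p = Fin.toℕ-injective (toℕ-clamp (ℕ.s≤s⁻¹ (Fin.toℕ<n p)))

  parent : Tree d last → Tree d last
  parent (j , p) = fromℕ< (s≤s (ℕ.m⊓n≤n (suc (toℕ j)) d)) , clamp ⌊ toℕ p /2⌋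

  parent-is : ∀ v → Parent v (parent v)
  parent-is (j , p) = Fin.toℕ-fromℕ< (s≤s (ℕ.m⊓n≤n (suc (toℕ j)) d))
                    , toℕ-clamp (ℕ.≤-trans (ℕ.⌊n/2⌋≤n (toℕ p)) (ℕ.s≤s⁻¹ (Fin.toℕ<n p)))

  parent-unique : ∀ u v → Parent u v → v ≡ parent u
  parent-unique u v (e , e′) with parent-is u
  ... | f , f′ = cong₂ _,_ (Fin.toℕ-injective (trans e (sym f))) (Fin.toℕ-injective (trans e′ (sym f′)))

  top : Tree d last
  top = fromℕ d , zero

  sTrack tTrack : Track N last
  sTrack = zero , true , false , false , zero
  tTrack = fromℕ (suc N) , false , false , false , zero

  module _ (x y : X) where

    open Tails iso (core x y) isRoot D
    open Walks net
    open Paths net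

    s t R : Fin n
    s = node (track sTrack)
    t = node (track tTrack)
    R = node (inj₁ (inj₂ top))

    climb : ∀ k v → d ≤ toℕ (proj₁ v) + k → toℕ (proj₂ v) < 2 ^ k → Reach k (node (inj₁ (inj₂ v))) R
    climb zero    v@(j , p) d≤ p<1 = subst (λ z → Reach 0 (node (inj₁ (inj₂ z))) R) top≡ reach-refl
      where
      top≡ : top ≡ v
      top≡ = cong₂ _,_
        (Fin.toℕ-injective (trans (Fin.toℕ-fromℕ d)
            (ℕ.≤-antisym (subst (d ≤_) (ℕ.+-identityʳ (toℕ j)) d≤) (ℕ.s≤s⁻¹ (Fin.toℕ<n j)))))
        (Fin.toℕ-injective (sym (ℕ.n≤0⇒n≡0 (ℕ.s≤s⁻¹ p<1))))
    climb (suc k) v@(j , p) d≤ p< = reach-trans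
      (arc⇒reach {inj₁ (inj₂ v)} {inj₁ (inj₂ (parent v))} (when-intro (parent? v (parent v)) (parent-is v)))
      (climb k (parent v) (subst (λ z → d ≤ z + k) (sym (proj₁ (parent-is v))) d≤′)
        (subst (_< 2 ^ k) (sym (proj₂ (parent-is v))) (⌊/2⌋-2^ k p<)))
      where
      d≤′ : d ≤ suc (toℕ j) ⊓ d + k
      d≤′ with ℕ.⊓-sel (suc (toℕ j)) d
      ... | inj₁ e = subst (λ z → d ≤ z + k) (sym e) (subst (d ≤_) (ℕ.+-suc (toℕ j) k) d≤)
      ... | inj₂ e = subst (λ z → d ≤ z + k) (sym e) (ℕ.m≤m+n d k)

    climb-top : ∀ v → Reach d (node (inj₁ (inj₂ v))) R
    climb-top v = climb d v (ℕ.m≤n+m d _) (ℕ.<-≤-trans (Fin.toℕ<n (proj₂ v)) last<2^d)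

    depth : ∀ c → Reach (suc d) R (node (inj₁ c))
    depth (inj₁ u@(i , k , g , b , p)) = reach-sym (reach-trans
      (arc⇒reach {track u} {tree zero p} (when-intro (above? u (zero , p)) (refl , refl))) (climb-top (zero , p)))
    depth (inj₂ v) = reach-sym (reach-mono (ℕ.n≤1+n d) (climb-top v))

    isRoot-top : isRoot (inj₂ top) ≡ true
    isRoot-top = dec-true (root? top) (Fin.toℕ-fromℕ d , refl)
      where open import Relation.Nullary.Decidable using (dec-true)

    diameter : HasDiameter D
    diameter = Depths.diameter (inj₂ top) isRoot-top D≤q
        (ℕ.≤-trans (s≤s (ℕ.≤-trans (s≤s z≤n) (ℕ.m≤n+m (suc d) d))) 2+2d≤D)
      (subst (_≤ h) (sym (ℕ.n≡⌊n+n/2⌋ (suc d))) (ℕ.⌊n/2⌋-mono 2+2d≤D)) depth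

    arc-weight : ∀ a b {w} → arc a b ≡ just w → w ≤ 1
    arc-weight (track u)       (track v)       e = ℕ.≤-trans
        (ℕ.≤-reflexive (sym (proj₂ (when-elim (arc? x y u v) e)))) z≤n
    arc-weight (track u)       (inj₁ (inj₂ v)) e = ℕ.≤-reflexive (sym (proj₂ (when-elim (above? u v) e)))
    arc-weight (inj₁ (inj₂ u)) (inj₁ (inj₂ v)) e = ℕ.≤-reflexive (sym (proj₂ (when-elim (parent? u v) e)))
    arc-weight (inj₁ a)        (inj₂ j)        e = ℕ.≤-reflexive (sym (proj₂ (proj₂ (attached-elim a j e))))
    arc-weight (inj₂ i)        (inj₂ j)        e = ℕ.≤-reflexive (sym (proj₂ (when-elim (next? i j) e)))

    weights≤1 : WeightsAtMost net 1
    weights≤1 u v w e with link⇒arc u v e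
    ... | inj₁ e′ = arc-weight (at u) (at v) e′
    ... | inj₂ e′ = arc-weight (at v) (at u) e′

    track-injective : ∀ {u v : Track N last} → node (track u) ≡ node (track v) → u ≡ v
    track-injective e with node-injective e
    ... | e′ = track-inj e′
      where
      track-inj : ∀ {u v : Track N last} → _≡_ {A = V} (track u) (track v) → u ≡ v
      track-inj refl = refl

    s≢t : s ≢ t
    s≢t e with cong (proj₁ ∘ proj₂) (track-injective e)
    ... | ()

    zero-link : ∀ {u v} → Link x y u v ⊎ (Start u × End v) → u ≢ v → edge net (node (track u)) (node (track v))
        ≡ just 0
    zero-link {u} {v} l u≢v with arc⇒link {track u} {track v} (when-intro (arc? x y u v) l) (λ { refl → u≢v refl })
    ... | w , e , w≤0 = trans e (cong just (ℕ.n≤0⇒n≡0 w≤0))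

    st : edge net s t ≡ just 0
    st = zero-link (inj₂ ((refl , refl , refl , refl , refl) ,
        (Fin.toℕ-fromℕ (suc N) , refl , refl , refl , refl))) (λ ())

    inst : Instance n
    inst = EdgeInstance.edgeInstance net s t s≢t st (λ _ → z≤n)

    phase : Bool → ℕ → Bool
    phase false i = parity (row x) (row y) i
    phase true  i = parity (row x) (row y) (suc i)

    On : Track N last → Set
    On (i , k , g , b , p) = g ≡ row x (toℕ i) × b ≡ phase k (toℕ i)

    Visited : V → Set
    Visited (track u)       = On u
    Visited (inj₁ (inj₂ _)) = ⊥
    Visited (inj₂ _)        = ⊥

    -- Both directions matter, since a walk may go back along a link; for a swap this works because
    -- xor with a fixed bit is invertible.
    on-link : ∀ u v → Link x y u v → (On u → On v) × (On v → On u)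
    on-link u v (inj₁ ((i≡ , refl , refl , refl) , _)) rewrite i≡ = id , id
    on-link u v (inj₂ (inj₁ ((refl , refl , i′≡ , refl) , (g≡ , g′≡) , _))) =
        (λ (_ , b≡) → g′≡ , trans b≡ (cong (parity (row x) (row y)) (sym i′≡)))
      , (λ (_ , b≡) → g≡ , trans b≡ (cong (parity (row x) (row y)) i′≡))
    on-link (i , _ , g , b , _) (i′ , _) (inj₂ (inj₂ ((refl , refl , i≡ , refl) , b′≡ , _))) rewrite sym i≡ =
        (λ (g≡ , b≡) → g≡ , trans b′≡ (cong₂ (λ g b → b xor (g ∧ row y (toℕ i))) g≡ b≡))
      , (λ (g≡ , b≡) → g≡ , xor-cancelʳ b _ _
          (trans (sym b′≡) (trans b≡ (cong (λ g → parity (row x) (row y) (toℕ i) xor (g ∧ row y (toℕ i))) (sym g≡)))))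
      where
      xor-cancelʳ : ∀ a b c → a xor c ≡ b xor c → a ≡ b
      xor-cancelʳ false false _     _ = refl
      xor-cancelʳ true  true  _     _ = refl
      xor-cancelʳ false true  false ()
      xor-cancelʳ false true  true  ()
      xor-cancelʳ true  false false ()
      xor-cancelʳ true  false true  ()

    start≡ : ∀ u → Start u → u ≡ sTrack
    start≡ (i , k , g , b , p) (e , refl , refl , refl , e′) =
      cong₂ (λ i p → i , true , false , false , p) (Fin.toℕ-injective e) (Fin.toℕ-injective e′)

    end≡ : ∀ u → End u → u ≡ tTrack
    end≡ (i , k , g , b , p) (e , refl , refl , refl , e′) =
      cong₂ (λ i p → i , false , false , false , p) (Fin.toℕ-injective (trans e (sym (Fin.toℕ-fromℕ (suc N)))))
          (Fin.toℕ-injective e′)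

    visited-arc : ∀ a b {w} → arc a b ≡ just w → w ≡ 0 → ¬ (a ≡ track sTrack × b ≡ track tTrack) →
                  (Visited a → Visited b) × (Visited b → Visited a)
    visited-arc (track u) (track v) e _ ¬st with proj₁ (when-elim (arc? x y u v) e)
    ... | inj₁ l         = on-link u v l
    ... | inj₂ (su , ev) = contradiction (cong (λ u → track u) (start≡ u su) , cong (λ u → track u) (end≡ v ev)) ¬st
    visited-arc (track u)       (inj₁ (inj₂ v)) e refl _ with when-elim (above? u v) e
    ... | _ , ()
    visited-arc (inj₁ (inj₂ u)) (inj₁ (inj₂ v)) e _ _ = id , id
    visited-arc (inj₁ (inj₂ u)) (track v)       () _ _
    visited-arc (inj₁ a)        (inj₂ j) e refl _ with attached-elim a j e
    ... | _ , _ , ()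
    visited-arc (inj₂ i)        (inj₂ j) e _ _ = id , id

    open Detours weightless net s t

    odd⇒¬detour : ip x y ≡ true → ∀ (p : Walk s t) → Avoids p (s , t) → weight p ≢ 0
    odd⇒¬detour odd p a w≡0 = true≢false (trans (sym odd) (trans (sym (parity-ip x y)) (sym even)))
      where
      true≢false : true ≢ false
      true≢false ()
      is-node : ∀ {u a} → at u ≡ a → node a ≡ u
      is-node {u} refl = node-at u
      step : ∀ {u v w} → edge net u v ≡ just w → w ≡ 0 → Other u v → Visited (at u) → Visited (at v)
      step {u} {v} e w≡0 (o₁ , o₂) with link⇒arc u v e
      ... | inj₁ e′ = proj₁ (visited-arc (at u) (at v) e′ w≡0
          (λ (e₁ , e₂) → o₁ (cong₂ _,_ (is-node e₁) (is-node e₂))))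
      ... | inj₂ e′ = proj₂ (visited-arc (at v) (at u) e′ w≡0
          (λ (e₁ , e₂) → o₂ (cong₂ _,_ (is-node e₂) (is-node e₁))))
      end : Visited (track tTrack)
      end = subst Visited (at-node (track tTrack))
        (invariant (Visited ∘ at) step p a w≡0 (subst Visited (sym (at-node (track sTrack))) (refl , refl)))
      even : false ≡ parity (row x) (row y) (suc N)
      even = trans (proj₂ end) (cong (parity (row x) (row y)) (Fin.toℕ-fromℕ (suc N)))

    link-irrefl′ : ∀ u → ¬ Link x y u u
    link-irrefl′ u (inj₁ (_ , e)) = ℕ.1+n≢n (sym e)
    link-irrefl′ u (inj₂ (inj₁ ((refl , () , _) , _)))
    link-irrefl′ u (inj₂ (inj₂ ((refl , () , _) , _)))

    ¬link-st : ¬ Link x y sTrack tTrack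
    ¬link-st (inj₁ ((_ , () , _) , _))
    -- A turn leads from row 0 to row 1, which is not row `N + 1`.
    ¬link-st (inj₂ (inj₁ ((_ , _ , e , _) , _))) = ℕ.<-irrefl
        (sym (ℕ.suc-injective (trans (sym (Fin.toℕ-fromℕ (suc N))) e))) 1≤N
    ¬link-st (inj₂ (inj₂ ((() , _) , _)))

    ¬link-ts : ¬ Link x y tTrack sTrack
    ¬link-ts (inj₁ ((_ , () , _) , _))
    ¬link-ts (inj₂ (inj₁ ((() , _) , _)))
    ¬link-ts (inj₂ (inj₂ ((_ , _ , () , _) , _)))

    Free : Track N last → Set
    Free u = Σ (Walk (node (track u)) t) λ p → Avoids p (s , t) × weight p ≡ 0

    free-cons : ∀ u v → Link x y u v ⊎ Link x y v u → Free v → Free u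
    free-cons u v l (p , a , w≡0) = (0 , e) ◅ p , avoids-cons (0 , e) {p} (o₁ , o₂) a , w≡0
      where
      e : edge net (node (track u)) (node (track v)) ≡ just 0
      e = [ (λ l → zero-link (inj₁ l) (λ { refl → link-irrefl′ u l }))
          , (λ l → trans (Graph.sym net (node (track u)) (node (track v))) (zero-link (inj₁ l) (λ { refl → link-irrefl′ u l }))) ]′ l
      o₁ : (s , t) ≢ (node (track u) , node (track v))
      o₁ eq = [ ¬link-st , ¬link-ts ]′ (subst₂ (λ u v → Link x y u v ⊎ Link x y v u)
        (sym (track-injective (cong proj₁ eq))) (sym (track-injective (cong proj₂ eq))) l)
      o₂ : (t , s) ≢ (node (track u) , node (track v))
      o₂ eq = [ ¬link-ts , ¬link-st ]′ (subst₂ (λ u v → Link x y u v ⊎ Link x y v u)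
        (sym (track-injective (cong proj₁ eq))) (sym (track-injective (cong proj₂ eq))) l)

    module _ (i : Fin (suc (suc N))) (k g b : Bool) where

      free-from-last : ∀ f p → toℕ p + f ≡ last → Free (i , k , g , b , fromℕ last) → Free (i , k , g , b , p)
      free-from-last zero    p e w with Fin.toℕ-injective
          (trans (trans (sym (ℕ.+-identityʳ (toℕ p))) e) (sym (Fin.toℕ-fromℕ last)))
      ... | refl = w
      free-from-last (suc f) p e w = free-cons _ (i , k , g , b , p′)
          (inj₁ (inj₁ ((refl , refl , refl , refl) , p′≡)))
        (free-from-last f p′ (trans (cong (_+ f) p′≡) (trans (sym (ℕ.+-suc (toℕ p) f)) e)) w)
        where
        p<last : suc (toℕ p) < suc last
        p<last = s≤s (subst (suc (toℕ p) ≤_) e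
            (subst (_≤ toℕ p + suc f) (ℕ.+-comm (toℕ p) 1) (ℕ.+-monoʳ-≤ (toℕ p) (s≤s z≤n))))
        p′ : Fin (suc last)
        p′ = fromℕ< p<last
        p′≡ : toℕ p′ ≡ suc (toℕ p)
        p′≡ = Fin.toℕ-fromℕ< p<last

      free-from-first : ∀ f p → toℕ p ≡ f → Free (i , k , g , b , zero) → Free (i , k , g , b , p)
      free-from-first zero    zero    e w = w
      free-from-first (suc f) (suc p) e w = free-cons _ (i , k , g , b , inject₁ p)
        (inj₂ (inj₁ ((refl , refl , refl , refl) , cong suc (sym (Fin.toℕ-inject₁ p)))))
        (free-from-first f (inject₁ p) (trans (Fin.toℕ-inject₁ p) (ℕ.suc-injective e)) w)

    module _ (even : ip x y ≡ false) where

      free-out : ∀ f i → toℕ i + f ≡ suc N → Free (i , false , row x (toℕ i) , phase false (toℕ i) , zero)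
      free-out zero i e = subst Free (sym final) (ε , ((λ ()) , (λ ())) , refl)
        where
        i≡ : toℕ i ≡ suc N
        i≡ = trans (sym (ℕ.+-identityʳ (toℕ i))) e
        final : (i , false , row x (toℕ i) , phase false (toℕ i) , zero) ≡ tTrack
        final = end≡ _ (i≡ , refl , trans (cong (row x) i≡) (row-end x)
                      -- Evenness decides here between `tTrack` and its sibling with `b ≡ true`.
                      , trans (cong (phase false) i≡) (trans (parity-ip x y) even) , refl)
      free-out (suc f) i e =
        free-from-last i false gᵢ (phase false (toℕ i)) last zero refl
          (free-cons _ (i , true , gᵢ , phase true (toℕ i) , fromℕ last)
            (inj₁ (inj₂ (inj₂ ((refl , refl , refl , refl) , refl , (Fin.toℕ-fromℕ last , Fin.toℕ-fromℕ last)))))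
            (free-from-first i true gᵢ (phase true (toℕ i)) last (fromℕ last) (Fin.toℕ-fromℕ last)
              (free-cons _ (i′ , false , row x (toℕ i′) , phase false (toℕ i′) , zero)
                (inj₁ (inj₂ (inj₁ ((refl , refl , i′≡ , cong (phase false) (sym i′≡)) , (refl , refl) ,
                    (refl , refl)))))
                (free-out f i′ (trans (cong (_+ f) i′≡) (trans (sym (ℕ.+-suc (toℕ i) f)) e))))))
        where
        gᵢ : Bool
        gᵢ = row x (toℕ i)
        i<N : suc (toℕ i) < suc (suc N)
        i<N = s≤s (subst (suc (toℕ i) ≤_) e
            (subst (_≤ toℕ i + suc f) (ℕ.+-comm (toℕ i) 1) (ℕ.+-monoʳ-≤ (toℕ i) (s≤s z≤n))))
        i′ : Fin (suc (suc N))
        i′ = fromℕ< i<N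
        i′≡ : toℕ i′ ≡ suc (toℕ i)
        i′≡ = Fin.toℕ-fromℕ< i<N

      even⇒detour : Free sTrack
      even⇒detour = free-cons sTrack (suc zero , false , row x 1 , false , zero)
        (inj₁ (inj₂ (inj₁ ((refl , refl , refl , refl) , (refl , refl) , (refl , refl)))))
            (free-out N (suc zero) refl)

  NotAt : ℕ → V → Set
  NotAt c (track u) = column u ≢ c
  NotAt c _         = ⊤

  same-x : ∀ {x y y′} u v → column u ≢ last ⊎ column v ≢ last → Link x y u v → Link x y′ u v
  same-x u v away (inj₁ l)        = inj₁ l
  same-x u v away (inj₂ (inj₁ l)) = inj₂ (inj₁ l)
  same-x u v away (inj₂ (inj₂ (_ , _ , e , e′))) = contradiction away λ { (inj₁ ne) → ne e ; (inj₂ ne) → ne e′ }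

  same-y : ∀ {x x′ y} u v → column u ≢ 0 ⊎ column v ≢ 0 → Link x y u v → Link x′ y u v
  same-y u v away (inj₁ l)        = inj₁ l
  same-y u v away (inj₂ (inj₂ l)) = inj₂ (inj₂ l)
  same-y u v away (inj₂ (inj₁ (_ , _ , e , e′))) = contradiction away λ { (inj₁ ne) → ne e ; (inj₂ ne) → ne e′ }

  arc-on : X → X → V → V → Maybe ℕ
  arc-on x y = Tails.arc iso (core x y) isRoot D

  arc-same : ∀ {x y x′ y′} c → (∀ u v → column u ≢ c ⊎ column v ≢ c → Link x y u v → Link x′ y′ u v) →
             (∀ u v → column u ≢ c ⊎ column v ≢ c → Link x′ y′ u v → Link x y u v) →
             ∀ a b → NotAt c a ⊎ NotAt c b → arc-on x y a b ≡ arc-on x′ y′ a b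
  arc-same c f f′ (track u)       (track v)       away =
    when-cong (arc? _ _ u v) (arc? _ _ u v) (λ { (inj₁ l) → inj₁ (f u v away l) ; (inj₂ st) → inj₂ st })
                                            (λ { (inj₁ l) → inj₁ (f′ u v away l) ; (inj₂ st) → inj₂ st })
  arc-same c f f′ (track u)       (inj₁ (inj₂ v)) away = refl
  arc-same c f f′ (inj₁ (inj₂ u)) (inj₁ b)        away = arc-tree b
    where
    arc-tree : ∀ {x y x′ y′} b → arc-on x y (inj₁ (inj₂ u)) (inj₁ b) ≡ arc-on x′ y′ (inj₁ (inj₂ u)) (inj₁ b)
    arc-tree (inj₁ v) = refl
    arc-tree (inj₂ v) = refl
  arc-same c f f′ (inj₁ a)        (inj₂ j)        away = refl
  arc-same c f f′ (inj₂ i)        (inj₁ b)        away = refl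
  arc-same c f f′ (inj₂ i)        (inj₂ j)        away = refl

  place : Fin n → V
  place = Inverse.to iso

  nodeAt : V → Fin n
  nodeAt = Inverse.from iso

  edge-on : X → X → Fin n → Fin n → Maybe ℕ
  edge-on x y = edge (Instance.graph (inst x y))

  edge-same-x : ∀ {x y y′} u v → NotAt last (place u) ⊎ NotAt last (place v) → edge-on x y u v ≡ edge-on x y′ u v
  edge-same-x u v away = link-cong iso {u = u} {v}
    (arc-same last same-x same-x (place u) (place v) away)
        (arc-same last same-x same-x (place v) (place u) ([ inj₂ , inj₁ ]′ away))

  edge-same-y : ∀ {x x′ y} u v → NotAt 0 (place u) ⊎ NotAt 0 (place v) → edge-on x y u v ≡ edge-on x′ y u v
  edge-same-y u v away = link-cong iso {u = u} {v}
    (arc-same 0 same-y same-y (place u) (place v) away)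
        (arc-same 0 same-y same-y (place v) (place u) ([ inj₂ , inj₁ ]′ away))

  I : X × X → Instance n
  I (x , y) = inst x y

  -- Alice and Bob on the comb

  module Parties (T : ℕ) (T+T<last : T + suc T ≤ last) where

    -- Alice starts without the last column, Bob without column 0, and each loses a column per
    -- round, the speed of information. With `T + suc T ≤ last` their regions still cover all
    -- columns after `T` rounds.
    right left : ℕ → ℕ
    right k = last ∸ k
    left k  = suc k

    k<last : ∀ {k} → k ≤ T → k < last
    k<last k≤T = ℕ.≤-trans (s≤s k≤T) (ℕ.≤-trans (ℕ.m≤n+m (suc T) T) T+T<last)

    left≤right : ∀ {k} → k ≤ T → left k ≤ right k
    left≤right {k} k≤T = ℕ.m+n≤o⇒m≤o∸n (suc k)
        (ℕ.≤-trans (ℕ.≤-trans (ℕ.≤-reflexive (ℕ.+-comm (suc k) k)) (ℕ.+-mono-≤ k≤T (s≤s k≤T))) T+T<last)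

    1≤right : ∀ {k} → k ≤ T → 1 ≤ right k
    1≤right k≤T = ℕ.≤-trans (s≤s z≤n) (left≤right k≤T)

    right-suc : ∀ {k} → k ≤ T → suc (right (suc k)) ≡ right k
    right-suc k≤T = sym (ℕ.+-∸-assoc 1 (k<last k≤T))

    right≤ : ∀ k → right (suc k) ≤ right k
    right≤ k = ℕ.∸-monoʳ-≤ last (ℕ.n≤1+n k)

    up-d : ∀ {k} → k ≤ T → up d (right k) ≡ 1
    up-d {k} k≤T = up-top d (1≤right k≤T) (ℕ.≤-trans (ℕ.m∸n≤m last k) (ℕ.<⇒≤ last<2^d))

    down-d : ∀ {k} → k ≤ T → down d (left k) ≡ 0
    down-d k≤T = down-top d (ℕ.≤-<-trans (k<last k≤T) last<2^d)

    -- Of the tree, a party knows the nodes over its columns. The root is known to both, by `up-d`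
    -- and `down-d`, so both can follow the tails and the leaves.
    Left Right : ℕ → V → Set
    Left k (track u)       = column u < right k
    Left k (tree j p)      = toℕ p < up (toℕ j) (right k)
    Left k (inj₂ _)        = ⊤
    Right k (track u)      = left k ≤ column u
    Right k (tree j p)     = down (toℕ j) (left k) ≤ toℕ p
    Right k (inj₂ _)       = ⊤

    left? : ∀ k a → Dec (Left k a)
    left? k (track u)  = column u ℕ.<? right k
    left? k (tree j p) = toℕ p ℕ.<? up (toℕ j) (right k)
    left? k (inj₂ _)   = yes tt

    right? : ∀ k a → Dec (Right k a)
    right? k (track u)  = left k ℕ.≤? column u
    right? k (tree j p) = down (toℕ j) (left k) ℕ.≤? toℕ p
    right? k (inj₂ _)   = yes tt

    covered : ∀ a → Left T a ⊎ Right T a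
    covered (track u) with ℕ.<-≤-connex (column u) (right T)
    ... | inj₁ h = inj₁ h
    ... | inj₂ h = inj₂ (ℕ.≤-trans (left≤right ℕ.≤-refl) h)
    covered (tree j p) with ℕ.<-≤-connex (toℕ p) (up (toℕ j) (right T))
    ... | inj₁ h = inj₁ h
    ... | inj₂ h = inj₂ (ℕ.≤-trans (down≤up (toℕ j) (left≤right ℕ.≤-refl)) h)
    covered (inj₂ _) = inj₁ tt

    shrink-left : ∀ k a → Left (suc k) a → Left k a
    shrink-left k (track u)  h = ℕ.<-≤-trans h (right≤ k)
    shrink-left k (tree j p) h = ℕ.<-≤-trans h (up-mono (toℕ j) (right≤ k))
    shrink-left k (inj₂ _)   h = tt

    shrink-right : ∀ k a → Right (suc k) a → Right k a
    shrink-right k (track u)  h = ℕ.<⇒≤ h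
    shrink-right k (tree j p) h = ℕ.≤-trans (down-mono (toℕ j) (ℕ.n≤1+n (suc k))) h
    shrink-right k (inj₂ _)   h = tt

    to-parent : Tree d last → Fin n × Fin n
    to-parent v = nodeAt (inj₁ (inj₂ v)) , nodeAt (inj₁ (inj₂ (parent v)))

    -- On each level of the tree, only the first node outside the known region sends a message into it.
    senderˡ senderʳ : ℕ → Fin (suc d) → Tree d last
    senderˡ k l = l , clamp (up (toℕ l) (right k))
    senderʳ k l = l , clamp (down (toℕ l) (left k) ∸ 1)

    module _ {x y : X} {k} (k<T : k < T) where

      private
        k≤T = ℕ.<⇒≤ k<T

      level≤ : (j : Fin (suc d)) → toℕ j ≤ d
      level≤ j = ℕ.s≤s⁻¹ (Fin.toℕ<n j)

      -- The border retreats as fast as messages advance, so none crosses it on a track: the tracks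
      -- cost no communication.
      track-left : ∀ u v → Link x y u v ⊎ (Start u × End v) →
                   (column u < right (suc k) → column v < right k) × (column v < right (suc k) → column u < right k)
      track-left u v (inj₁ (inj₁ (_ , p′≡))) =
          (λ h → subst (_< right k) (sym p′≡) (ℕ.≤-trans (s≤s h) (ℕ.≤-reflexive (right-suc k≤T))))
        , (λ h → ℕ.<-trans (ℕ.n<1+n _) (subst (_< right k) p′≡ (ℕ.<-≤-trans h (right≤ k))))
      track-left u v (inj₁ (inj₂ (inj₁ (_ , _ , p≡ , p′≡)))) =
        (λ _ → subst (_< right k) (sym p′≡) (1≤right k≤T)) , (λ _ → subst (_< right k) (sym p≡) (1≤right k≤T))
      track-left u v (inj₁ (inj₂ (inj₂ (_ , _ , p≡ , p′≡)))) =
          (λ h → contradiction (ℕ.m∸n≤m last (suc k)) (ℕ.<⇒≱ (subst (_< right (suc k)) p≡ h)))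
        , (λ h → contradiction (ℕ.m∸n≤m last (suc k)) (ℕ.<⇒≱ (subst (_< right (suc k)) p′≡ h)))
      track-left u v (inj₂ ((_ , _ , _ , _ , p≡) , (_ , _ , _ , _ , p′≡))) =
        (λ _ → subst (_< right k) (sym p′≡) (1≤right k≤T)) , (λ _ → subst (_< right k) (sym p≡) (1≤right k≤T))

      track-right : ∀ u v → Link x y u v ⊎ (Start u × End v) →
                    (left (suc k) ≤ column u → left k ≤ column v) × (left (suc k) ≤ column v → left k ≤ column u)
      track-right u v (inj₁ (inj₁ (_ , p′≡))) =
          (λ h → subst (left k ≤_) (sym p′≡) (ℕ.m≤n⇒m≤1+n (ℕ.<⇒≤ h)))
        , (λ h → ℕ.s≤s⁻¹ (subst (left (suc k) ≤_) p′≡ h))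
      track-right u v (inj₁ (inj₂ (inj₂ (_ , _ , p≡ , p′≡)))) =
        (λ _ → subst (left k ≤_) (sym p′≡) (k<last k≤T)) , (λ _ → subst (left k ≤_) (sym p≡) (k<last k≤T))
      track-right u v (inj₁ (inj₂ (inj₁ (_ , _ , p≡ , p′≡)))) =
        (λ h → contradiction (subst (left (suc k) ≤_) p≡ h) λ ()) ,
            (λ h → contradiction (subst (left (suc k) ≤_) p′≡ h) λ ())
      track-right u v (inj₂ ((_ , _ , _ , _ , p≡) , (_ , _ , _ , _ , p′≡))) =
        (λ h → contradiction (subst (left (suc k) ≤_) p≡ h) λ ()) ,
            (λ h → contradiction (subst (left (suc k) ≤_) p′≡ h) λ ())

      -- The parent of a known tree node is known, so an unknown neighbour can only be a child, and
      -- its message to the parent is the one that has to be heard.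
      arc-left : ∀ a b {w} → arc-on x y a b ≡ just w →
        (Left (suc k) a → Left k b) × (Left (suc k) b → Left k a ⊎ ∃ λ l → to-parent (senderˡ k l) ≡
            (nodeAt a , nodeAt b))
      arc-left (track u) (track v) e = let f , f′ = track-left u v (proj₁ (when-elim (arc? x y u v) e)) in f , (inj₁ ∘ f′)
      arc-left (track u) (tree j p) e with proj₁ (when-elim (above? u (j , p)) e)
      ... | e₁ , e₂ rewrite e₂ | e₁ = (λ h → ℕ.<-≤-trans h (right≤ k)) , (λ h → inj₁ (ℕ.<-≤-trans h (right≤ k)))
      arc-left (tree j p) (track u) ()
      arc-left (tree j p) (tree j′ p′) e with proj₁ (when-elim (parent? (j , p) (j′ , p′)) e)
      ... | par = down-tree , up-tree
        where
        parent-up : up (toℕ j′) (right k) ≡ ⌈ up (toℕ j) (right k) /2⌉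
        parent-up = trans (cong (λ j → up j (right k)) (proj₁ par)) (up-parent d (level≤ j) (up-d k≤T))
        down-tree : toℕ p < up (toℕ j) (right (suc k)) → toℕ p′ < up (toℕ j′) (right k)
        down-tree h = subst₂ _<_ (sym (proj₂ par)) (sym parent-up)
            (⌊/2⌋<⌈/2⌉ (ℕ.<-≤-trans h (up-mono (toℕ j) (right≤ k))))
        up-tree : toℕ p′ < up (toℕ j′) (right (suc k)) →
                  Left k (tree j p) ⊎ ∃ λ l → to-parent (senderˡ k l) ≡ (nodeAt (tree j p) , nodeAt (tree j′ p′))
        up-tree h with ℕ.m≤n⇒m<n∨m≡n (⌊/2⌋<⌈/2⌉⇒≤ {toℕ p} {up (toℕ j) (right k)}
                         (subst₂ _<_ (proj₂ par) parent-up (ℕ.<-≤-trans h (up-mono (toℕ j′) (right≤ k)))))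
        ... | inj₁ p<  = inj₁ p<
        ... | inj₂ p≡  = inj₂ (j , trans (cong (λ p → to-parent (j , p)) (trans (cong clamp (sym p≡)) (clamp-toℕ p)))
                                       (cong (λ v → nodeAt (tree j p) , nodeAt (inj₁ (inj₂ v)))
                                           (sym (parent-unique (j , p) (j′ , p′) par))))
      arc-left (track u) (inj₂ i) e = (λ _ → tt) ,
          (λ _ → contradiction (proj₁ (Tails.attached-elim iso (core x y) isRoot D (inj₁ u) i e)) λ ())
      arc-left (tree j p) (inj₂ i) e = (λ _ → tt) , (λ _ → inj₁ in-root)
        where
        r = isRoot⇒ (j , p) (proj₁ (Tails.attached-elim iso (core x y) isRoot D (inj₂ (j , p)) i e))
        in-root : toℕ p < up (toℕ j) (right k)
        in-root = subst₂ _<_ (sym (proj₂ r)) (sym (trans (cong (λ j → up j (right k)) (proj₁ r)) (up-d k≤T)))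
            (s≤s z≤n)
      arc-left (inj₂ i) (inj₁ b) ()
      arc-left (inj₂ i) (inj₂ j) e = (λ _ → tt) , (λ _ → inj₁ tt)

      arc-right : ∀ a b {w} → arc-on x y a b ≡ just w →
        (Right (suc k) a → Right k b) ×
            (Right (suc k) b → Right k a ⊎ ∃ λ l → to-parent (senderʳ k l) ≡ (nodeAt a , nodeAt b))
      arc-right (track u) (track v) e = let f , f′ = track-right u v (proj₁ (when-elim (arc? x y u v) e)) in f , (inj₁ ∘ f′)
      arc-right (track u) (tree j p) e with proj₁ (when-elim (above? u (j , p)) e)
      ... | e₁ , e₂ rewrite e₂ | e₁ = ℕ.<⇒≤ , (λ h → inj₁ (ℕ.<⇒≤ h))
      arc-right (tree j p) (track u) ()
      arc-right (tree j p) (tree j′ p′) e with proj₁ (when-elim (parent? (j , p) (j′ , p′)) e)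
      ... | par = down-tree , up-tree
        where
        parent-down : down (toℕ j′) (left k) ≡ ⌊ down (toℕ j) (left k) /2⌋
        parent-down = trans (cong (λ j → down j (left k)) (proj₁ par)) (down-parent d (level≤ j) (down-d k≤T))
        down-tree : down (toℕ j) (left (suc k)) ≤ toℕ p → down (toℕ j′) (left k) ≤ toℕ p′
        down-tree h = subst₂ _≤_ (sym parent-down) (sym (proj₂ par))
            (ℕ.⌊n/2⌋-mono (ℕ.≤-trans (down-mono (toℕ j) (ℕ.n≤1+n (suc k))) h))
        up-tree : down (toℕ j′) (left (suc k)) ≤ toℕ p′ →
                  Right k (tree j p) ⊎ ∃ λ l → to-parent (senderʳ k l) ≡ (nodeAt (tree j p) , nodeAt (tree j′ p′))
        up-tree h with ℕ.m≤n⇒m<n∨m≡n (⌊/2⌋-cancel-≤ {down (toℕ j) (left k)} {toℕ p}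
                         (subst₂ _≤_ parent-down (proj₂ par) (ℕ.≤-trans (down-mono (toℕ j′) (ℕ.n≤1+n (suc k))) h)))
        ... | inj₁ b<  = inj₁ (ℕ.s≤s⁻¹ b<)
        ... | inj₂ b≡  = inj₂ (j , trans
            (cong (λ p → to-parent (j , p)) (trans (cong (λ b → clamp (b ∸ 1)) b≡) (clamp-toℕ p)))
                                       (cong (λ v → nodeAt (tree j p) , nodeAt (inj₁ (inj₂ v)))
                                           (sym (parent-unique (j , p) (j′ , p′) par))))
      arc-right (track u) (inj₂ i) e = (λ _ → tt) ,
          (λ _ → contradiction (proj₁ (Tails.attached-elim iso (core x y) isRoot D (inj₁ u) i e)) λ ())
      arc-right (tree j p) (inj₂ i) e = (λ _ → tt) , (λ _ → inj₁ in-root)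
        where
        r = isRoot⇒ (j , p) (proj₁ (Tails.attached-elim iso (core x y) isRoot D (inj₂ (j , p)) i e))
        in-root : down (toℕ j) (left k) ≤ toℕ p
        in-root = subst (_≤ toℕ p) (sym (trans (cong (λ j → down j (left k)) (proj₁ r)) (down-d k≤T))) z≤n
      arc-right (inj₂ i) (inj₁ b) ()
      arc-right (inj₂ i) (inj₂ j) e = (λ _ → tt) , (λ _ → inj₁ tt)

    left-away : ∀ {k} a → Left k a → NotAt last a
    left-away {k} (track u) h e = ℕ.<⇒≱ (subst (_< right k) e h) (ℕ.m∸n≤m last k)
    left-away (tree _ _) _ = tt
    left-away (inj₂ _)   _ = tt

    right-away : ∀ {k} a → Right k a → NotAt 0 a
    right-away {k} (track u) h e = contradiction (subst (left k ≤_) e h) λ ()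
    right-away (tree _ _) _ = tt
    right-away (inj₂ _)   _ = tt

    known : (V → Set) → Fin n → Set
    known K v = K (place v)

    at-sender : ∀ (K : V → Set) v → K (inj₁ (inj₂ v)) → K (place (proj₁ (to-parent v)))
    at-sender K v h = subst K (sym (Inverse.strictlyInverseˡ iso (inj₁ (inj₂ v)))) h

    alice : Party I (λ z z′ → proj₁ z ≡ proj₁ z′) T (suc d) (λ k → known (Left k)) (λ k → known (Right k))
    alice = record
      { heard      = λ k l → to-parent (senderˡ k l)
      ; knows?     = λ v → left? T (place v)
      ; shrink     = λ {k} {v} _ → shrink-left k (place v)
      ; view-known = λ { {z} {z′} {v} refl kv → view-cong (I z) (I z′) v (λ u → edge-same-x v u (inj₁ (left-away (place v) kv))) refl refl refl }
      ; edge-known = λ { {v = v} refl kv u → edge-same-x u v (inj₂ (left-away (place v) kv)) }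
      ; neighbour  = λ {k} {v} k<T z u w e kv → neighbour k<T z u v e kv
      ; sender     = λ {k} k<T l → at-sender (Right k) (senderˡ k l) (sender k<T l)
      }
      where
      neighbour : ∀ {k} → k < T → ∀ z u v {w} → edge-on (proj₁ z) (proj₂ z) u v ≡ just w → Left (suc k) (place v) →
                  Left k (place u) ⊎ ∃ λ l → to-parent (senderˡ k l) ≡ (u , v)
      neighbour {k} k<T z u v e kv with Tails.link⇒arc iso (core (proj₁ z) (proj₂ z)) isRoot D u v e
      ... | inj₁ e′ = subst₂ (λ u′ v′ → Left k (place u) ⊎ ∃ λ l → to-parent (senderˡ k l) ≡ (u′ , v′))
        (Inverse.strictlyInverseʳ iso u) (Inverse.strictlyInverseʳ iso v)
            (proj₂ (arc-left k<T (place u) (place v) e′) kv)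
      ... | inj₂ e′ = inj₁ (proj₁ (arc-left k<T (place v) (place u) e′) kv)
      sender : ∀ {k} → k < T → ∀ l → Right k (inj₁ (inj₂ (senderˡ k l)))
      sender {k} k<T l = subst (down (toℕ l) (left k) ≤_)
        (sym (toℕ-clamp (ℕ.≤-trans (up≤ (toℕ l) (right k)) (ℕ.m∸n≤m last k))))
            (down≤up (toℕ l) (left≤right (ℕ.<⇒≤ k<T)))

    bob : Party I (λ z z′ → proj₂ z ≡ proj₂ z′) T (suc d) (λ k → known (Right k)) (λ k → known (Left k))
    bob = record
      { heard      = λ k l → to-parent (senderʳ k l)
      ; knows?     = λ v → right? T (place v)
      ; shrink     = λ {k} {v} _ → shrink-right k (place v)
      ; view-known = λ { {z} {z′} {v} refl kv → view-cong (I z) (I z′) v (λ u → edge-same-y v u (inj₁ (right-away (place v) kv))) refl refl refl }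
      ; edge-known = λ { {v = v} refl kv u → edge-same-y u v (inj₂ (right-away (place v) kv)) }
      ; neighbour  = λ {k} {v} k<T z u w e kv → neighbour k<T z u v e kv
      ; sender     = λ {k} k<T l → at-sender (Left k) (senderʳ k l) (sender k<T l)
      }
      where
      neighbour : ∀ {k} → k < T → ∀ z u v {w} → edge-on (proj₁ z) (proj₂ z) u v ≡ just w → Right (suc k) (place v) →
                  Right k (place u) ⊎ ∃ λ l → to-parent (senderʳ k l) ≡ (u , v)
      neighbour {k} k<T z u v e kv with Tails.link⇒arc iso (core (proj₁ z) (proj₂ z)) isRoot D u v e
      ... | inj₁ e′ = subst₂ (λ u′ v′ → Right k (place u) ⊎ ∃ λ l → to-parent (senderʳ k l) ≡ (u′ , v′))
        (Inverse.strictlyInverseʳ iso u) (Inverse.strictlyInverseʳ iso v)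
            (proj₂ (arc-right k<T (place u) (place v) e′) kv)
      ... | inj₂ e′ = inj₁ (proj₁ (arc-right k<T (place v) (place u) e′) kv)
      sender : ∀ {k} → k < T → ∀ l → Left k (inj₁ (inj₂ (senderʳ k l)))
      -- On a level that Bob knows entirely, truncated subtraction makes node 0 the sender; Alice
      -- knows it, as `up` is at least 1.
      sender {k} k<T l = subst (_< up (toℕ l) (right k)) (sym (toℕ-clamp small))
        (ℕ.≤-trans (s≤s (ℕ.∸-monoˡ-≤ 1 (down≤up (toℕ l) (left≤right k≤T))))
            (ℕ.≤-reflexive (ℕ.m+[n∸m]≡n (1≤up (toℕ l) (1≤right k≤T)))))
        where
        k≤T = ℕ.<⇒≤ k<T
        small : down (toℕ l) (left k) ∸ 1 ≤ last
        small = ℕ.≤-trans (ℕ.m∸n≤m _ 1)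
            (ℕ.≤-trans (down≤up (toℕ l) (left≤right k≤T)) (ℕ.≤-trans (up≤ (toℕ l) (right k)) (ℕ.m∸n≤m last k)))

    announces : ∀ {Π} → NodeOutput Π n → Query Π n → Bool
    announces o q with report o q
    ... | just (fin zero) = true
    ... | _               = false

    announces-true : ∀ {Π} (o : NodeOutput Π n) q {x} → report o q ≡ just x → Criterion.Meets weightless x →
        announces o q ≡ true
    announces-true o q {fin _} e refl rewrite e = refl

    announces-false : ∀ {Π} (o : NodeOutput Π n) q →
        (∀ x → report o q ≡ just x → ¬ Criterion.Meets weightless x) → announces o q ≡ false
    announces-false o q h with report o q
    ... | nothing            = refl
    ... | just (fin zero)    = contradiction refl (h _ refl)
    ... | just (fin (suc _)) = refl
    ... | just ∞             = refl

    module _ {Π B} (goal : Goal) (A : Algorithm Π n B)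
             (solves : ∀ z → WithProbability≥2/3 A (λ r → Correct (I z) Π goal (outputs A (I z) r T))) where

      open Algorithm A using (coinSides; coinSides-nonZero; output)
      open import Data.Fin.Subset using (_∈_)
      open import Data.Bool.Properties using (not-involutive)

      asked-query : Query Π n
      asked-query = query Π (nodeAt (track sTrack)) (nodeAt (track tTrack))

      verdict : Algorithm.State A → Bool
      verdict σ = announces (output σ) asked-query

      module C (r : Seed A) = CutAndPaste A r I
      module _ (r : Seed A) where
        τ = C.transcript r alice bob (covered ∘ place) verdict
        announced = C.announced r alice bob (covered ∘ place) verdict

      decides : ∀ z r → r ∈ proj₁ (solves z) → announced r (τ r z) ≡ not (ip (proj₁ z) (proj₂ z))
      decides z@(x , y) r r∈ with ip x y in parity≡
      ... | false = let p , a , w≡0 = even⇒detour x y parity≡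
                        v , ω , e , m = Reports.reports-cheap weightless {light = λ _ → z≤n} goal
                            (proj₂ (proj₂ (solves z)) r r∈) p a w≡0
                    in C.announced-true r alice bob (covered ∘ place) verdict z v
                         (announces-true (outputs A (I z) r T v) asked-query e m)
      ... | true  = C.announced-false r alice bob (covered ∘ place) verdict z λ v →
                      announces-false (outputs A (I z) r T v) asked-query
                        (Reports.reports-costly weightless {light = λ _ → z≤n} goal
                            (proj₂ (proj₂ (solves z)) r r∈) (odd⇒¬detour x y parity≡) v)

      many-messages : ∀ M → N ≡ M + M → ¬ (3 * ((2 * 2) * ((letters B * letters B) ^ suc d) ^ T) < 2 ^ M)
      many-messages M refl few = Communication.ip-hard M (ℕ.m^n>0 coinSides n) few
        (λ x y → proj₁ (solves (x , y))) (λ x y → proj₁ (proj₂ (solves (x , y))))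
        (λ r x y → τ r (x , y)) (λ r → C.transcript-rectangular r alice bob (covered ∘ place) verdict refl refl)
        (λ r c → not (announced r c))
        (λ x y r r∈ → trans (cong not (decides (x , y) r r∈)) (not-involutive (ip x y)))

-- Choice of parameters

n≤2^⌈log₂n⌉ : ∀ n → n ≤ 2 ^ ⌈log₂ n ⌉
n≤2^⌈log₂n⌉ n = go ⌈log₂ n ⌉ n ℕ.≤-refl
  where
  open import Data.Nat.Logarithm using (⌈log₂⌉-mono-≤; ⌈log₂⌈n/2⌉⌉≡⌈log₂n⌉∸1)
  go : ∀ e n → ⌈log₂ n ⌉ ≤ e → n ≤ 2 ^ e
  go zero    n h = ℕ.≮⇒≥ λ 2≤n → ℕ.<⇒≱ (⌈log₂⌉-mono-≤ 2≤n) h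
  go (suc e) n h = begin
    n                      ≡⟨ ℕ.⌊n/2⌋+⌈n/2⌉≡n n ⟨
    ⌊ n /2⌋ + ⌈ n /2⌉      ≤⟨ ℕ.+-monoˡ-≤ ⌈ n /2⌉ (ℕ.⌊n/2⌋≤⌈n/2⌉ n) ⟩
    ⌈ n /2⌉ + ⌈ n /2⌉      ≤⟨ ℕ.+-mono-≤ half half ⟩
    2 ^ e + 2 ^ e          ≡⟨ cong (λ x → 2 ^ e + x) (ℕ.+-identityʳ (2 ^ e)) ⟨
    2 ^ suc e              ∎
    where
    open ℕ.≤-Reasoning
    half : ⌈ n /2⌉ ≤ 2 ^ e
    half = go e ⌈ n /2⌉ (ℕ.≤-trans (ℕ.≤-reflexive (⌈log₂⌈n/2⌉⌉≡⌈log₂n⌉∸1 n)) (ℕ.∸-monoˡ-≤ 1 h))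

1≤⌈log₂n⌉ : ∀ {n} → 2 ≤ n → 1 ≤ ⌈log₂ n ⌉
1≤⌈log₂n⌉ = ⌈log₂⌉-mono-≤
  where open import Data.Nat.Logarithm using (⌈log₂⌉-mono-≤)

split : ∀ {C : Set} {k q n} → k + q ≡ n → Fin k ↔ C → Fin n ↔ (C ⊎ Fin q)
split refl iso = Fin.+↔⊎ ⟨⊎⟩ iso
  where
  open import Data.Sum.Function.Propositional using (_⊎-↔_)
  open import Function.Construct.Composition using (_↔-∘_)
  open import Function.Construct.Identity using (↔-id)
  _⟨⊎⟩_ : ∀ {k q} {C : Set} → Fin (k + q) ↔ (Fin k ⊎ Fin q) → Fin k ↔ C → Fin (k + q) ↔ (C ⊎ Fin q)
  i ⟨⊎⟩ j = (j ⊎-↔ ↔-id _) ↔-∘ i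

-- Restricting to paths of one edge lets the weighted bound reuse this one: as `1 ≤ W n`, these
-- instances belong to its class too.
diameter-bound : ∀ {Π B n D T} (goal : Goal) → 16 ≤ D → 2 * D ≤ n → (A : Algorithm Π n B) →
  (∀ I → UnweightedClass D I → Instance.hops I (Instance.Pst I) ≤ 1 →
    WithProbability≥2/3 A (λ r → Correct I Π goal (outputs A I r T))) →
  D ≤ 32 * T
diameter-bound {Π} {B} {n} {D} {T} goal 16≤D 2D≤n A solves = ℕ.≮⇒≥ λ 32T<D →
  let 16T+16≤D = long T 32T<D in
  Long.absurd 16T+16≤D
  where
  open import Data.Nat.Tactic.RingSolver using (solve-∀)
  open import Function.Construct.Identity using (↔-id)
  open ℕ.≤-Reasoning
  -- Half of 32 * T pays for the additive 16, except at T = 0, where the threshold `16 ≤ D` takes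
  -- over.
  long : ∀ T → 32 * T < D → 16 * T + 16 ≤ D
  long zero    _     = 16≤D
  long (suc T) 32T<D = begin
    16 * suc T + 16         ≤⟨ ℕ.m≤m+n _ (16 * T) ⟩
    16 * suc T + 16 + 16 * T ≡⟨ e T ⟩
    32 * suc T              ≤⟨ ℕ.<⇒≤ 32T<D ⟩
    D                       ∎
    where
    e : ∀ T → 16 * suc T + 16 + 16 * T ≡ 32 * suc T
    e = solve-∀
  module Long (16T+16≤D : 16 * T + 16 ≤ D) where
    g m : ℕ
    -- The least `g` allowed by `gap`; it makes `m + m` equal to 16 * T + 16.
    g = 2 * T + 2
    m = 4 * g
    m+m≤D : m + m ≤ D
    m+m≤D = subst (_≤ D) (e T) 16T+16≤D
      where
      e : ∀ T → 16 * T + 16 ≡ 4 * (2 * T + 2) + 4 * (2 * T + 2)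
      e = solve-∀
    2≤m : 2 ≤ m
    2≤m = ℕ.≤-trans (s≤s (s≤s z≤n)) (ℕ.*-monoʳ-≤ 4 (ℕ.m≤n+m 2 (2 * T)))
    fits : suc m + D ≤ n
    fits = begin
      suc m + D   ≤⟨ ℕ.+-monoˡ-≤ D (ℕ.≤-trans (ℕ.+-monoˡ-≤ m (ℕ.<⇒≤ 2≤m)) m+m≤D) ⟩
      D + D       ≡⟨ cong (λ x → D + x) (ℕ.+-identityʳ D) ⟨
      2 * D       ≤⟨ 2D≤n ⟩
      n           ∎
    open Cycle D m 2≤m m+m≤D {n} {n ∸ suc m} (split (ℕ.m+[n∸m]≡n (ℕ.m+n≤o⇒m≤o (suc m) fits)) (↔-id _))
      (ℕ.m+n≤o⇒m≤o∸n D (subst (_≤ n) (ℕ.+-comm (suc m) D) fits))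
    absurd : ⊥
    absurd = LowerBound.impossible T g
        (ℕ.≤-trans (ℕ.≤-reflexive (ℕ.+-comm 1 T)) (ℕ.+-mono-≤ (ℕ.m≤m+n T (T + 0)) (s≤s z≤n)))
      ℕ.≤-refl refl goal A (λ ρ → solves (inst ρ) (unweighted ρ , diameter ρ) ℕ.≤-refl)

core-size : ℕ → ℕ → ℕ → ℕ
core-size N last d = (2 + N) * (2 * (2 * (2 * suc last))) + suc d * suc last

core-iso : ∀ N last d → Fin (core-size N last d) ↔ (Track N last ⊎ Tree d last)
core-iso N last d =
  ((Fin.*↔× then (↔-id _ ×-↔ (Fin.*↔× then
      (Fin.2↔Bool ×-↔ (Fin.*↔× then (Fin.2↔Bool ×-↔ (Fin.*↔× then (Fin.2↔Bool ×-↔ ↔-id _))))))))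
    ⊎-↔ Fin.*↔×) ↔-∘ Fin.+↔⊎
  where
  open import Data.Product.Function.NonDependent.Propositional using (_×-↔_)
  open import Data.Sum.Function.Propositional using (_⊎-↔_)
  open import Function.Construct.Composition using (_↔-∘_)
  open import Function.Construct.Identity using (↔-id)
  _then_ : {X Y Z : Set} → X ↔ Y → Y ↔ Z → X ↔ Z
  i then j = j ↔-∘ i

-- The origin of `M` below: a message is one of fewer than 2^(B+1) strings, two of them pass on each
-- of `L` levels in each of `T` rounds, and 3 * 4 = 12 is less than 2^4.
transcripts-bound : ∀ B L T → 3 * ((2 * 2) * ((letters B * letters B) ^ L) ^ T) < 2 ^ (4 + (suc B + suc B) * L * T)
transcripts-bound B L T = begin-strict
  3 * (4 * ((letters B * letters B) ^ L) ^ T)        ≤⟨ ℕ.*-monoʳ-≤ 3 (ℕ.*-monoʳ-≤ 4 few) ⟩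
  3 * (4 * 2 ^ E)                                    ≡⟨ ℕ.*-assoc 3 4 (2 ^ E) ⟨
  12 * 2 ^ E                                         <⟨ ℕ.*-monoˡ-< (2 ^ E) {{ℕ.m^n≢0 2 E}} (ℕ.m≤m+n 13 3) ⟩
  2 ^ 4 * 2 ^ E                                      ≡⟨ ℕ.^-distribˡ-+-* 2 4 E ⟨
  2 ^ (4 + E)                                        ∎
  where
  open ℕ.≤-Reasoning
  E : ℕ
  E = (suc B + suc B) * L * T
  alphabet : letters B ≤ 2 ^ suc B
  alphabet = ℕ.≤-trans (ℕ.n≤1+n _) (ℕ.≤-reflexive (letters<2^ B))
  few : ((letters B * letters B) ^ L) ^ T ≤ 2 ^ E
  few = begin
    ((letters B * letters B) ^ L) ^ T      ≤⟨ ℕ.^-monoˡ-≤ T (ℕ.^-monoˡ-≤ L (ℕ.*-mono-≤ alphabet alphabet)) ⟩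
    ((2 ^ suc B * 2 ^ suc B) ^ L) ^ T      ≡⟨ cong (λ x → (x ^ L) ^ T) (ℕ.^-distribˡ-+-* 2 (suc B) (suc B)) ⟨
    ((2 ^ (suc B + suc B)) ^ L) ^ T        ≡⟨ cong (_^ T) (ℕ.^-*-assoc 2 (suc B + suc B) L) ⟩
    (2 ^ ((suc B + suc B) * L)) ^ T        ≡⟨ ℕ.^-*-assoc 2 ((suc B + suc B) * L) T ⟩
    2 ^ E                                  ∎

-- The coefficient that comes out of `core-size-bound`: 2 * 32 * (8 * β + 18) from the tracks and 2
-- * 8 from the tree.
root-constant : ℕ → ℕ
root-constant β = 512 * β + 1168

-- The factor 2 on the left reserves half of the nodes for the tails.
core-size-bound : ∀ β λ₂ T → 1 ≤ λ₂ → 1 ≤ T →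
  let M = 4 + (suc (β * λ₂) + suc (β * λ₂)) * suc λ₂ * T in
  2 * core-size (M + M) (T + suc T) λ₂ ≤ root-constant β * ((T * λ₂) * (T * λ₂))
core-size-bound β λ₂ T 1≤λ₂ 1≤T = begin
  2 * ((2 + (M + M)) * (2 * (2 * (2 * ℓ))) + suc λ₂ * ℓ)
    ≤⟨ ℕ.*-monoʳ-≤ 2 (ℕ.+-mono-≤ (ℕ.*-mono-≤ rows (ℕ.*-monoʳ-≤ 2 (ℕ.*-monoʳ-≤ 2 (ℕ.*-monoʳ-≤ 2 ℓ≤4T)))) levels) ⟩
  2 * ((8 * β + 18) * (λ₂ * λ₂ * T) * (2 * (2 * (2 * (4 * T)))) + 8 * (λ₂ * λ₂ * T * T))
    ≡⟨ e₃ β λ₂ T ⟩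
  root-constant β * ((T * λ₂) * (T * λ₂)) ∎
  where
  open ℕ.≤-Reasoning
  open import Data.Nat.Tactic.RingSolver using (solve-∀)
  M ℓ : ℕ
  M = 4 + (suc (β * λ₂) + suc (β * λ₂)) * suc λ₂ * T
  ℓ = suc (T + suc T)
  double : ∀ {x} → 1 ≤ x → suc x ≤ x + x
  double {x} 1≤x = ℕ.+-monoˡ-≤ x 1≤x
  ℓ≤4T : ℓ ≤ 4 * T
  ℓ≤4T = ℕ.≤-trans (ℕ.≤-reflexive (e T)) (ℕ.≤-trans (ℕ.+-mono-≤ (double 1≤T) (double 1≤T)) (ℕ.≤-reflexive (e′ T)))
    where
    e : ∀ T → suc (T + suc T) ≡ suc T + suc T
    e = solve-∀
    e′ : ∀ T → (T + T) + (T + T) ≡ 4 * T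
    e′ = solve-∀
  1≤λ₂λ₂T : 1 ≤ λ₂ * λ₂ * T
  1≤λ₂λ₂T = ℕ.*-mono-≤ (ℕ.*-mono-≤ 1≤λ₂ 1≤λ₂) 1≤T
  letter : suc (β * λ₂) ≤ λ₂ + β * λ₂
  letter = ℕ.+-monoˡ-≤ (β * λ₂) 1≤λ₂
  rows : 2 + (M + M) ≤ (8 * β + 18) * (λ₂ * λ₂ * T)
  rows = begin
    2 + (M + M)
      ≡⟨ e₁ ((suc (β * λ₂) + suc (β * λ₂)) * suc λ₂ * T) ⟩
    10 * 1 + 2 * ((suc (β * λ₂) + suc (β * λ₂)) * suc λ₂ * T)
      ≤⟨ ℕ.+-mono-≤ (ℕ.*-monoʳ-≤ 10 1≤λ₂λ₂T)
          (ℕ.*-monoʳ-≤ 2 (ℕ.*-monoˡ-≤ T (ℕ.*-mono-≤ (ℕ.+-mono-≤ letter letter) (double 1≤λ₂)))) ⟩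
    10 * (λ₂ * λ₂ * T) + 2 * (((λ₂ + β * λ₂) + (λ₂ + β * λ₂)) * (λ₂ + λ₂) * T)
      ≡⟨ e₂ β λ₂ T ⟩
    (8 * β + 18) * (λ₂ * λ₂ * T) ∎
    where
    e₁ : ∀ E → 2 + ((4 + E) + (4 + E)) ≡ 10 * 1 + 2 * E
    e₁ = solve-∀
    e₂ : ∀ β l T → 10 * (l * l * T) + 2 * (((l + β * l) + (l + β * l)) * (l + l) * T) ≡ (8 * β + 18) * (l * l * T)
    e₂ = solve-∀
  levels : suc λ₂ * ℓ ≤ 8 * (λ₂ * λ₂ * T * T)
  levels = begin
    suc λ₂ * ℓ                   ≤⟨ ℕ.*-mono-≤ (double 1≤λ₂) ℓ≤4T ⟩
    (λ₂ + λ₂) * (4 * T)          ≡⟨ e₄ λ₂ T ⟩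
    8 * ((λ₂ * T) * (1 * 1))     ≤⟨ ℕ.*-monoʳ-≤ 8 (ℕ.*-monoʳ-≤ (λ₂ * T) (ℕ.*-mono-≤ 1≤λ₂ 1≤T)) ⟩
    8 * ((λ₂ * T) * (λ₂ * T))    ≡⟨ e₅ λ₂ T ⟩
    8 * (λ₂ * λ₂ * T * T)        ∎
    where
    e₄ : ∀ l T → (l + l) * (4 * T) ≡ 8 * ((l * T) * (1 * 1))
    e₄ = solve-∀
    e₅ : ∀ l T → 8 * ((l * T) * (l * T)) ≡ 8 * (l * l * T * T)
    e₅ = solve-∀
  e₃ : ∀ β l T → 2 * ((8 * β + 18) * (l * l * T) * (2 * (2 * (2 * (4 * T)))) + 8 * (l * l * T * T)) ≡
      (512 * β + 1168) * ((T * l) * (T * l))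
  e₃ = solve-∀

-- If n were larger, half of the nodes would hold a comb that is long enough for `T` rounds and has
-- more rows than the messages can handle, contrary to `many-messages`.
root-bound : ∀ {Π β n D T} (goal : Goal) → 2 ≤ n → 16 * ⌈log₂ n ⌉ ≤ D → 2 * D ≤ n → 1 ≤ T →
    (A : Algorithm Π n (β * ⌈log₂ n ⌉)) →
  (∀ I → WeightedClass 1 D 1 I → WithProbability≥2/3 A (λ r → Correct I Π goal (outputs A I r T))) →
  n ≤ (root-constant β * T * ⌈log₂ n ⌉) ^ 2
root-bound {Π} {β} {n} {D} {T} goal 2≤n 16λ≤D 2D≤n 1≤T A solves = ℕ.≮⇒≥ Large.absurd
  where
  open ℕ.≤-Reasoning
  open import Data.Nat.Tactic.RingSolver using (solve-∀)
  c l M N last : ℕ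
  c = root-constant β
  l = ⌈log₂ n ⌉
  M = 4 + (suc (β * l) + suc (β * l)) * suc l * T
  N = M + M
  last = T + suc T
  1≤l : 1 ≤ l
  1≤l = 1≤⌈log₂n⌉ 2≤n
  module Large (large : (c * T * l) ^ 2 < n) where
    small : c * ((T * l) * (T * l)) ≤ n
    small = begin
      c * ((T * l) * (T * l))          ≤⟨ ℕ.m≤n*m _ c {{ℕ.>-nonZero 1≤c}} ⟩
      c * (c * ((T * l) * (T * l)))    ≡⟨ e c T l ⟩
      (c * T * l) ^ 2                  ≤⟨ ℕ.<⇒≤ large ⟩
      n                                ∎
      where
      1≤c : 1 ≤ c
      1≤c = ℕ.≤-trans (s≤s z≤n) (ℕ.m≤n+m 1168 (512 * β))
      e : ∀ c T l → c * (c * ((T * l) * (T * l))) ≡ (c * T * l) * ((c * T * l) * 1)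
      e = solve-∀
    S : ℕ
    S = core-size N last l
    2S≤n : 2 * S ≤ n
    2S≤n = ℕ.≤-trans (core-size-bound β l T 1≤l 1≤T) small
    fits : S + D ≤ n
    fits = ℕ.*-cancelˡ-≤ 2 (begin
      2 * (S + D)        ≡⟨ ℕ.*-distribˡ-+ 2 S D ⟩
      2 * S + 2 * D      ≤⟨ ℕ.+-mono-≤ 2S≤n 2D≤n ⟩
      n + n              ≡⟨ cong (λ x → n + x) (ℕ.+-identityʳ n) ⟨
      2 * n              ∎)
    -- The columns are part of a network with n ≤ 2^l nodes, so a tree of depth l spans them.
    last<2^l : last < 2 ^ l
    last<2^l = begin-strict
      last               <⟨ ℕ.n<1+n last ⟩
      suc last           ≤⟨ ℕ.m≤m+n (suc last) (l * suc last) ⟩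
      suc l * suc last   ≤⟨ ℕ.m≤n+m _ ((2 + N) * (2 * (2 * (2 * suc last)))) ⟩
      S                  ≤⟨ ℕ.m≤m+n S D ⟩
      S + D              ≤⟨ fits ⟩
      n                  ≤⟨ n≤2^⌈log₂n⌉ n ⟩
      2 ^ l              ∎
    depth≤ : suc l + suc l ≤ D
    depth≤ = begin
      suc l + suc l        ≤⟨ ℕ.+-mono-≤ (ℕ.+-monoˡ-≤ l 1≤l) (ℕ.+-monoˡ-≤ l 1≤l) ⟩
      (l + l) + (l + l)    ≤⟨ ℕ.m≤m+n _ (12 * l) ⟩
      (l + l) + (l + l) + 12 * l ≡⟨ e l ⟩
      16 * l               ≤⟨ 16λ≤D ⟩
      D                    ∎
      where
      e : ∀ l → (l + l) + (l + l) + 12 * l ≡ 16 * l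
      e = solve-∀
    open Comb N last l D (s≤s z≤n) (ℕ.≤-trans 1≤T (ℕ.m≤m+n T (suc T))) last<2^l depth≤ {n} {n ∸ S}
      (split (ℕ.m+[n∸m]≡n (ℕ.m+n≤o⇒m≤o S fits)) (core-iso N last l))
      (ℕ.m+n≤o⇒m≤o∸n D (subst (_≤ n) (ℕ.+-comm S D) fits))
    absurd : ⊥
    absurd = Parties.many-messages T ℕ.≤-refl goal A
      (λ (x , y) → solves (inst x y) (weights≤1 x y , diameter x y , ℕ.≤-refl)) M refl
          (transcripts-bound (β * l) (suc l) T)

theorem5 : (∀ (Π : Problem) (g : Goal) (β : ℕ) (W : ℕ → ℕ) →
    PolynomiallyBounded W → (∀ n → 1 ≤ W n) →
    ∃ λ h → ∃ λ n₀ → ∃ λ a → ∃ λ b → ∃ λ C →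
    ∀ n D → n₀ ≤ n → a * ⌈log₂ n ⌉ ≤ D → b * D ≤ n →
    ∀ (A : Algorithm Π n (β * ⌈log₂ n ⌉)) (T : ℕ) →
    SolvesWithin A g (WeightedClass (W n) D h) T →
    √ n /log+ D ≤ (C * T))
    ×
    (∀ (Π : Problem) (g : Goal) (β : ℕ) →
    ∃ λ D₀ → ∃ λ b → ∃ λ C →
    ∀ n D → D₀ ≤ D → b * D ≤ n →
    ∀ (A : Algorithm Π n (β * ⌈log₂ n ⌉)) (T : ℕ) →
    SolvesWithin A g (UnweightedClass D) T →
    D ≤ C * T)
theorem5 = (λ Π g β W _ 1≤W → 1 , 2 , 16 , 2 , 32 + root-constant β , λ n D 2≤n 16λ≤D 2D≤n A T solves →
    weighted g β W 1≤W n D 2≤n 16λ≤D 2D≤n A T solves)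
  , (λ Π g β → 16 , 2 , 32 , λ n D 16≤D 2D≤n A T solves →
    diameter-bound {T = T} g 16≤D 2D≤n A (λ I class _ → solves I class))
  where
  weighted : ∀ {Π} g β W → (∀ n → 1 ≤ W n) → ∀ n D → 2 ≤ n → 16 * ⌈log₂ n ⌉ ≤ D → 2 * D ≤ n →
    ∀ (A : Algorithm Π n (β * ⌈log₂ n ⌉)) T → SolvesWithin A g (WeightedClass (W n) D 1) T →
    √ n /log+ D ≤ ((32 + root-constant β) * T)
  -- The share 32 * T of the bound pays for the `D` that is subtracted, and c * T remains under the
  -- square.
  weighted g β W 1≤W n D 2≤n 16λ≤D 2D≤n A T solves = ℕ.≤-trans D≤32T
      (ℕ.≤-trans (ℕ.m≤m+n (32 * T) (c * T)) (ℕ.≤-reflexive (sym split-sum)))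
    , ℕ.≤-trans (root-bound {β = β} g 2≤n 16λ≤D 2D≤n 1≤T A
        (λ I (w , d , h) → solves I ((λ u v x e → ℕ.≤-trans (w u v x e) (1≤W n)) , d , h)))
        (ℕ.^-monoˡ-≤ 2 (ℕ.*-monoˡ-≤ ⌈log₂ n ⌉ (ℕ.m+n≤o⇒m≤o∸n (c * T)
          (subst (c * T + D ≤_) (trans (ℕ.+-comm (c * T) (32 * T)) (sym split-sum)) (ℕ.+-monoʳ-≤ (c * T) D≤32T)))))
    where
    c : ℕ
    c = root-constant β
    split-sum : (32 + c) * T ≡ 32 * T + c * T
    split-sum = ℕ.*-distribʳ-+ T 32 c
    16≤D : 16 ≤ D
    16≤D = ℕ.≤-trans (ℕ.*-monoʳ-≤ 16 (1≤⌈log₂n⌉ 2≤n)) 16λ≤D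
    D≤32T : D ≤ 32 * T
    D≤32T = diameter-bound {T = T} g 16≤D 2D≤n A λ I (unw , diam) h →
      solves I ((λ u v x e → ℕ.≤-trans (ℕ.≤-reflexive (unw u v x e)) (1≤W n)) , diam , h)
    -- The size estimates need `1 ≤ T`; zero rounds are excluded by `16 ≤ D`.
    positive : ∀ T → D ≤ 32 * T → 1 ≤ T
    positive zero    D≤0 = contradiction (ℕ.≤-trans 16≤D D≤0) λ ()
    positive (suc T) _   = s≤s z≤n
    1≤T : 1 ≤ T
    1≤T = positive T D≤32T
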